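{- Let $0<|q|<1$ and let $x,y,u,v,t$ be complex numbers with $|t|<1$, $|xt|<1$, $|ut|<1$, $|uxt|<1$. Then $$\sum_{n=0}^\infty h_n(x,y|q)\,h_n(u,v|q)\,\frac{t^n}{(q;q)_n}=\frac{(yt,vxt;q)_\infty}{(t,xt,uxt;q)_\infty}\ {}_3\phi_2\left(\begin{array}{c} y,\ xt,\ v/u\\ yt,\ vxt\end{array}; q,\ ut\right).$$
   Context: Throughout $|q|<1$. The $q$-shifted factorials are $(a;q)_0=1$, $(a;q)_n=\prod_{k=0}^{n-1}(1-aq^k)$, $(a;q)_\infty=\prod_{k=0}^\infty(1-aq^k)$, and $(a_1,\dots,a_m;q)_n=(a_1;q)_n\cdots(a_m;q)_n$ (similarly for $n=\infty$). The Gaussian coefficient is ${n\brack k}=\frac{(q;q)_n}{(q;q)_k(q;q)_{n-k}}$. The basic hypergeometric series is ${}_{r+1}\phi_r\left(\begin{array}{c}a_1,\dots,a_{r+1}\\ b_1,\dots,b_r\end{array};q,z\right)=\sum_{n\ge0}\frac{(a_1,\dots,a_{r+1};q)_n}{(q,b_1,\dots,b_r;q)_n}z^n$. The Cauchy polynomials are $P_n(x,y)=(x-y)(x-qy)\cdots(x-q^{n-1}y)$ (with $P_0=1$), and the bivariate Rogers–Szegő polynomials are $h_n(x,y|q)=\sum_{k=0}^n {n\brack k}P_k(x,y)$. -}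

module Defs where

open import Level using (Level; _⊔_) renaming (suc to lsuc)
open import Algebra.Apartness.Bundles using (HeytingField; HeytingCommutativeRing)
open import Algebra.Bundles using (CommutativeRing)
open import Data.Nat.Base as ℕ using (ℕ; zero; suc)
open import Data.Product.Base using (Σ; ∃; _×_; _,_; proj₁; proj₂)
open import Data.Sum.Base using (_⊎_; inj₁; inj₂)
open import Data.Vec.Base using (Vec; []; _∷_)
open import Data.Vec.Relation.Unary.All using (All; []; _∷_)
open import Relation.Binary.Core using (Rel)
open import Relation.Binary.Structures using (IsStrictPartialOrder)
open import Relation.Nullary.Negation using (¬_; contradiction)
import Algebra.Definitions.RawMonoid as RawMonoidOps
import Algebra.Apartness.Properties.HeytingCommutativeRing as HeytingProperties
import Relation.Binary.Reasoning.Setoid as SetoidReasoning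
import Algebra.Properties.AbelianGroup as AbelianGroupProperties
import Algebra.Properties.Group as GroupProperties
import Algebra.Properties.Ring as RingProperties
import Algebra.Solver.Ring.NaturalCoefficients.Default as SemiringSolver

-- The real numbers, axiomatised as a Cauchy-complete Archimedean ordered field.
-- All axioms hold classically for ℝ (which they determine up to isomorphism,
-- with _#_ being inequality) and constructively for the Cauchy reals, where
-- trichotomy is unavailable and is replaced by the cotransitive apartness _#_.
record RealField c ℓ₁ ℓ₂ ℓ₃ : Set (lsuc (c ⊔ ℓ₁ ⊔ ℓ₂ ⊔ ℓ₃)) where
  infix 4 _<_ _≤_
  field
    heytingField : HeytingField c ℓ₁ ℓ₂

  open HeytingField heytingField public

  commutativeRing : CommutativeRing c ℓ₁
  commutativeRing = HeytingCommutativeRing.commutativeRing heytingCommutativeRing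

  open RawMonoidOps (CommutativeRing.+-rawMonoid commutativeRing) public
    using () renaming (_×_ to _ℕ×_)

  field
    _<_                  : Rel Carrier ℓ₃
    isStrictPartialOrder : IsStrictPartialOrder _≈_ _<_
    <⇒#                  : ∀ {x y} → x < y → x # y
    #⇒<⊎>                : ∀ {x y} → x # y → x < y ⊎ y < x
    +-monoˡ-<            : ∀ z {x y} → x < y → x + z < y + z
    *-pos                : ∀ {x y} → 0# < x → 0# < y → 0# < x * y
    archimedean          : ∀ x → ∃ λ n → x < n ℕ× 1#

  _≤_ : Rel Carrier ℓ₃
  x ≤ y = ¬ (y < x)

  -- As m and n range independently, the one-sided bound is |s m - s n| < ε.
  IsCauchy : (ℕ → Carrier) → Set (c ⊔ ℓ₃)
  IsCauchy s = ∀ ε → 0# < ε → ∃ λ N → ∀ m n → N ℕ.≤ m → N ℕ.≤ n → s m < s n + ε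

  IsLimit : (ℕ → Carrier) → Carrier → Set (c ⊔ ℓ₃)
  IsLimit s l = ∀ ε → 0# < ε → ∃ λ N → ∀ n → N ℕ.≤ n → s n < l + ε × l < s n + ε

  -- Square roots follow from completeness; they are a field so that the complex
  -- modulus is an operation.  √ is total, but nothing is assumed of it at negative
  -- arguments: on the reals one may take x ↦ √(max x 0).
  field
    complete : ∀ s → IsCauchy s → ∃ (IsLimit s)
    √        : Carrier → Carrier
    √-nonNeg : ∀ x → 0# ≤ x → 0# ≤ √ x
    √-square : ∀ x → 0# ≤ x → √ x * √ x ≈ x

module RealFieldProperties {c ℓ₁ ℓ₂ ℓ₃ : Level} (R : RealField c ℓ₁ ℓ₂ ℓ₃) where
  open RealField R
  open HeytingProperties heytingCommutativeRing public
    using (x-0≈x; 1#0; x#0y#0→xy#0; invertibleʳ⇒#; #-congʳ)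
  open SetoidReasoning (CommutativeRing.setoid commutativeRing)
  private
    module < = IsStrictPartialOrder isStrictPartialOrder
    module CR = CommutativeRing commutativeRing
    module Solver = SemiringSolver CR.commutativeSemiring
  open GroupProperties CR.+-group using (//-rightDividesˡ; //-rightDividesʳ)
  open AbelianGroupProperties CR.+-abelianGroup using (xyx⁻¹≈y)
  open RingProperties CR.ring
    using (-‿distribˡ-*; -‿distribʳ-*; -‿involutive; x[y-z]≈xy-xz; [y-z]x≈yx-zx)

  telescope : ∀ x y z → (x - y) + (y - z) ≈ x - z
  telescope x y z = begin
    (x - y) + (y - z)   ≈⟨ +-assoc (x - y) y (- z) ⟨
    (x - y) + y - z     ≈⟨ +-congʳ (//-rightDividesˡ y x) ⟩
    x - z               ∎

  -x*-x≈x*x : ∀ x → - x * - x ≈ x * x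
  -x*-x≈x*x x = begin
    - x * - x     ≈⟨ -‿distribˡ-* x (- x) ⟨
    - (x * - x)   ≈⟨ -‿cong (-‿distribʳ-* x x) ⟨
    - - (x * x)   ≈⟨ -‿involutive (x * x) ⟩
    x * x         ∎

  x*[11+00]≈x : ∀ x → x * (1# * 1# + 0# * 0#) ≈ x
  x*[11+00]≈x x = solve 1 (λ x → x :* (con 1 :* con 1 :+ con 0 :* con 0) := x) refl x
    where open Solver using (solve; con; _:=_; _:+_; _:*_)

  -- The multiplicativity of the squared complex modulus.
  sumOfSquares-* : ∀ a b c d →
    (a * c - b * d) * (a * c - b * d) + (a * d + b * c) * (a * d + b * c)
      ≈ (a * a + b * b) * (c * c + d * d)
  sumOfSquares-* a b c d = begin
    (a * c + n) * (a * c + n) + (a * d + b * c) * (a * d + b * c)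
      ≈⟨ solve 5 (λ a b c d n →
           (((a :* c) :+ n) :* ((a :* c) :+ n) :+ ((a :* d) :+ (b :* c)) :* ((a :* d) :+ (b :* c)))
           := ((a :* a :* (c :* c) :+ (a :* a :* (d :* d)) :+ (b :* b :* (c :* c)) :+ n :* n)
               :+ (a :* c :+ a :* c) :* (b :* d :+ n))) refl a b c d n ⟩
    (a * a * (c * c) + a * a * (d * d) + b * b * (c * c) + n * n) + (a * c + a * c) * (b * d + n)
      ≈⟨ +-cong (+-congˡ (-x*-x≈x*x (b * d)))
           (trans (*-congˡ (-‿inverseʳ (b * d))) (CR.zeroʳ _)) ⟩
    (a * a * (c * c) + a * a * (d * d) + b * b * (c * c) + b * d * (b * d)) + 0#
      ≈⟨ +-identityʳ _ ⟩
    a * a * (c * c) + a * a * (d * d) + b * b * (c * c) + b * d * (b * d)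
      ≈⟨ solve 4 (λ a b c d →
           (a :* a :* (c :* c) :+ (a :* a :* (d :* d)) :+ (b :* b :* (c :* c)) :+ b :* d :* (b :* d))
           := ((a :* a :+ b :* b) :* (c :* c :+ d :* d))) refl a b c d ⟩
    (a * a + b * b) * (c * c + d * d) ∎
    where
    open Solver using (solve; _:=_; _:+_; _:*_)
    n = - (b * d)

  <-respʳ : ∀ {x y z} → y ≈ z → x < y → x < z
  <-respʳ = <.<-respʳ-≈

  <-respˡ : ∀ {x y z} → y ≈ z → y < x → z < x
  <-respˡ = <.<-respˡ-≈

  <-cotrans : ∀ {x y} → x < y → ∀ z → x < z ⊎ z < y
  <-cotrans x<y z with #-cotrans (<⇒# x<y) z
  ... | inj₁ x#z with #⇒<⊎> x#z
  ...   | inj₁ x<z = inj₁ x<z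
  ...   | inj₂ z<x = inj₂ (<.trans z<x x<y)
  <-cotrans x<y z | inj₂ z#y with #⇒<⊎> z#y
  ...   | inj₁ z<y = inj₂ z<y
  ...   | inj₂ y<z = inj₁ (<.trans x<y y<z)

  nonNeg∧#⇒pos : ∀ {x} → 0# ≤ x → x # 0# → 0# < x
  nonNeg∧#⇒pos 0≤x x#0 with #⇒<⊎> x#0
  ... | inj₁ x<0 = contradiction x<0 0≤x
  ... | inj₂ 0<x = 0<x

  pos⇒# : ∀ {x} → 0# < x → x # 0#
  pos⇒# 0<x = #-sym (<⇒# 0<x)

  pos⇒nonNeg : ∀ {x} → 0# < x → 0# ≤ x
  pos⇒nonNeg = <.asym

  *-#0⇒#0ˡ : ∀ x y → x * y # 0# → x # 0#
  *-#0⇒#0ˡ x y xy#0 with #⇒invertible xy#0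
  ... | i , _ , inv = invertibleʳ⇒# (y * i , (begin
    (x - 0#) * (y * i)    ≈⟨ *-congʳ (x-0≈x x) ⟩
    x * (y * i)           ≈⟨ *-assoc x y i ⟨
    x * y * i             ≈⟨ *-congʳ (x-0≈x (x * y)) ⟨
    (x * y - 0#) * i      ≈⟨ inv ⟩
    1#                    ∎))

  neg-pos : ∀ {x} → x < 0# → 0# < - x
  neg-pos {x} x<0 = <-respˡ (-‿inverseʳ x) (<-respʳ (+-identityˡ (- x)) (+-monoˡ-< (- x) x<0))

  pos-diff : ∀ {x y} → x < y → 0# < y - x
  pos-diff {x} x<y = <-respˡ (-‿inverseʳ x) (+-monoˡ-< (- x) x<y)

  diff-pos : ∀ {x y} → 0# < y - x → x < y
  diff-pos {x} {y} p = <-respˡ (+-identityˡ x) (<-respʳ (//-rightDividesˡ x y) (+-monoˡ-< x p))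

  square-pos : ∀ {x} → x # 0# → 0# < x * x
  square-pos {x} x#0 with #⇒<⊎> x#0
  ... | inj₁ x<0 = <-respʳ (-x*-x≈x*x x) (*-pos (neg-pos x<0) (neg-pos x<0))
  ... | inj₂ 0<x = *-pos 0<x 0<x

  square-nonNeg : ∀ x → 0# ≤ x * x
  square-nonNeg x xx<0 = pos⇒nonNeg (square-pos (*-#0⇒#0ˡ x x (<⇒# xx<0))) xx<0

  0<1 : 0# < 1#
  0<1 = <-respʳ (*-identityˡ 1#) (square-pos 1#0)

  pos+nonNeg : ∀ {x y} → 0# < x → 0# ≤ y → 0# < x + y
  pos+nonNeg {x} {y} 0<x 0≤y
    with <-cotrans (<-respˡ (+-identityˡ y) (+-monoˡ-< y 0<x)) 0#
  ... | inj₁ y<0   = contradiction y<0 0≤y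
  ... | inj₂ 0<x+y = 0<x+y

  nonNeg+nonNeg : ∀ {x y} → 0# ≤ x → 0# ≤ y → 0# ≤ x + y
  nonNeg+nonNeg {x} {y} 0≤x 0≤y s with <-cotrans s y
  ... | inj₂ y<0   = 0≤y y<0
  ... | inj₁ x+y<y = 0≤x (<-respˡ (//-rightDividesʳ y x)
      (<-respʳ (-‿inverseʳ y) (+-monoˡ-< (- y) x+y<y)))

  nonNeg*pos : ∀ {x y} → 0# ≤ x → 0# < y → 0# ≤ x * y
  nonNeg*pos {x} {y} 0≤x 0<y xy<0 =
    pos⇒nonNeg (*-pos (nonNeg∧#⇒pos 0≤x (*-#0⇒#0ˡ x y (<⇒# xy<0))) 0<y) xy<0

  ≤-<-trans : ∀ {x y z} → x ≤ y → y < z → x < z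
  ≤-<-trans {x} x≤y y<z with <-cotrans y<z x
  ... | inj₁ y<x = contradiction y<x x≤y
  ... | inj₂ x<z = x<z

  x≤x+nonNeg : ∀ {x y} → 0# ≤ y → x ≤ x + y
  x≤x+nonNeg {x} {y} 0≤y x+y<x = 0≤y (<-respˡ (xyx⁻¹≈y x y)
      (<-respʳ (-‿inverseʳ x) (+-monoˡ-< (- x) x+y<x)))

  *-<1 : ∀ {x y} → 0# ≤ x → x < 1# → y < 1# → x * y < 1#
  *-<1 {x} {y} 0≤x x<1 y<1 = diff-pos (<-respʳ identity
    (pos+nonNeg (pos-diff x<1) (nonNeg*pos 0≤x (pos-diff y<1))))
    where
    identity : 1# - x + x * (1# - y) ≈ 1# - x * y
    identity = begin
      1# - x + x * (1# - y)       ≈⟨ +-congˡ (x[y-z]≈xy-xz x 1# y) ⟩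
      1# - x + (x * 1# - x * y)   ≈⟨ +-congˡ (+-congʳ (*-identityʳ x)) ⟩
      1# - x + (x - x * y)        ≈⟨ telescope 1# x (x * y) ⟩
      1# - x * y                  ∎

  square<1⇒<1 : ∀ {x} → x * x < 1# → x < 1#
  square<1⇒<1 {x} xx<1 with <-cotrans 0<1 x
  ... | inj₂ x<1 = x<1
  ... | inj₁ 0<x with #⇒<⊎> (*-#0⇒#0ˡ (1# - x) (1# + x) (#-congʳ 1-xx (pos⇒# (pos-diff xx<1))))
    where
    1-xx : 1# - x * x ≈ (1# - x) * (1# + x)
    1-xx = begin
      1# - x * x                        ≈⟨ telescope 1# x (x * x) ⟨
      (1# - x) + (x - x * x)            ≈⟨ +-cong (*-identityʳ _) (+-congʳ (*-identityˡ x)) ⟨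
      (1# - x) * 1# + (1# * x - x * x)  ≈⟨ +-congˡ ([y-z]x≈yx-zx x 1# x) ⟨
      (1# - x) * 1# + (1# - x) * x      ≈⟨ distribˡ (1# - x) 1# x ⟨
      (1# - x) * (1# + x)               ∎
  ...   | inj₂ 0<1-x = diff-pos 0<1-x
  ...   | inj₁ 1-x<0 = contradiction xx<1 (<.asym (<.trans 1<x x<xx))
    where
    1<x : 1# < x
    1<x = <-respˡ (//-rightDividesˡ x 1#) (<-respʳ (+-identityˡ x) (+-monoˡ-< x 1-x<0))
    x<xx : x < x * x
    x<xx = diff-pos (<-respʳ (trans (x[y-z]≈xy-xz x x 1#) (+-congˡ (-‿cong (*-identityʳ x))))
             (*-pos 0<x (pos-diff 1<x)))

  <1⇒square<1 : ∀ {x} → 0# ≤ x → x < 1# → x * x < 1#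
  <1⇒square<1 0≤x x<1 = *-<1 0≤x x<1 x<1

module ComplexAnalysis {c ℓ₁ ℓ₂ ℓ₃ : Level} (R : RealField c ℓ₁ ℓ₂ ℓ₃) where
  private
    module ℝ = RealField R
    module ℝₚ = RealFieldProperties R
  open ℝ public using (_<_) renaming (Carrier to ℝ; 0# to 0ℝ; 1# to 1ℝ)

  infix  4 _≈_ _⟶_
  infixl 6 _+_ _-_
  infixl 7 _*_
  infixl 7 _/_[_]
  infixr 8 _^_

  record ℂ : Set c where
    constructor _+i_
    field
      re im : ℝ
  open ℂ public

  _≈_ : Rel ℂ ℓ₁
  z ≈ w = re z ℝ.≈ re w × im z ℝ.≈ im w

  0ℂ 1ℂ : ℂ
  0ℂ = 0ℝ +i 0ℝ
  1ℂ = 1ℝ +i 0ℝ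

  _+_ _-_ _*_ : ℂ → ℂ → ℂ
  z + w = (re z ℝ.+ re w) +i (im z ℝ.+ im w)
  z - w = (re z ℝ.- re w) +i (im z ℝ.- im w)
  z * w = (re z ℝ.* re w ℝ.- im z ℝ.* im w) +i (re z ℝ.* im w ℝ.+ im z ℝ.* re w)

  _^_ : ℂ → ℕ → ℂ
  z ^ zero  = 1ℂ
  z ^ suc n = z * z ^ n

  conj : ℂ → ℂ
  conj z = re z +i (ℝ.- im z)

  scale : ℝ → ℂ → ℂ
  scale r z = (r ℝ.* re z) +i (r ℝ.* im z)

  normSq : ℂ → ℝ
  normSq z = re z ℝ.* re z ℝ.+ im z ℝ.* im z

  ∣_∣ : ℂ → ℝ
  ∣ z ∣ = ℝ.√ (normSq z)

  -- z ≠ 0 in its positive form.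
  NonZero : ℂ → Set ℓ₃
  NonZero z = 0ℝ < ∣ z ∣

  ∣_∣⁻¹ : (w : ℂ) → NonZero w → ℝ
  ∣ w ∣⁻¹ w≠0 = proj₁ (ℝ.#⇒invertible (ℝₚ.pos⇒# w≠0))

  -- z / w = |w|⁻² z w̄.
  _/_[_] : ℂ → (w : ℂ) → NonZero w → ℂ
  z / w [ w≠0 ] = scale (∣ w ∣⁻¹ w≠0 ℝ.* ∣ w ∣⁻¹ w≠0) (z * conj w)

  _⟶_ : (ℕ → ℂ) → ℂ → Set (c ⊔ ℓ₃)
  s ⟶ l = ∀ ε → 0ℝ < ε → ∃ λ N → ∀ n → N ℕ.≤ n → ∣ s n - l ∣ < ε

  ∑< ∏< : ℕ → (ℕ → ℂ) → ℂ
  ∑< zero    f = 0ℂ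
  ∑< (suc n) f = ∑< n f + f n
  ∏< zero    f = 1ℂ
  ∏< (suc n) f = ∏< n f * f n

  HasSum : (ℕ → ℂ) → ℂ → Set (c ⊔ ℓ₃)
  HasSum f s = (λ n → ∑< n f) ⟶ s

  HasProduct : (ℕ → ℂ) → ℂ → Set (c ⊔ ℓ₃)
  HasProduct f p = (λ n → ∏< n f) ⟶ p

  qFactor : ℂ → ℂ → ℕ → ℂ
  qFactor a q k = 1ℂ - a * q ^ k

  ⟨_⨾_⟩_ : ℂ → ℂ → ℕ → ℂ
  ⟨ a ⨾ q ⟩ n = ∏< n (qFactor a q)

  ⟪_⨾_⟫_ : ∀ {m} → Vec ℂ m → ℂ → ℕ → ℂ
  ⟪ []     ⨾ q ⟫ n = 1ℂ
  ⟪ a ∷ as ⨾ q ⟫ n = ⟨ a ⨾ q ⟩ n * ⟪ as ⨾ q ⟫ n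

  -- (a₁,…,aₘ;q)_∞ converges with value p.
  ⟪_⨾_⟫∞≡_ : ∀ {m} → Vec ℂ m → ℂ → ℂ → Set (c ⊔ ℓ₁ ⊔ ℓ₃)
  ⟪ []     ⨾ q ⟫∞≡ p = Level.Lift (c ⊔ ℓ₃) (p ≈ 1ℂ)
  ⟪ a ∷ as ⨾ q ⟫∞≡ p = ∃ λ p₁ → ∃ λ p₂ →
    HasProduct (qFactor a q) p₁ × ⟪ as ⨾ q ⟫∞≡ p₂ × p ≈ p₁ * p₂

  normSq-nonNeg : ∀ z → 0ℝ ℝ.≤ normSq z
  normSq-nonNeg z = ℝₚ.nonNeg+nonNeg (ℝₚ.square-nonNeg (re z)) (ℝₚ.square-nonNeg (im z))

  ∣∣² : ∀ z → ∣ z ∣ ℝ.* ∣ z ∣ ℝ.≈ normSq z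
  ∣∣² z = ℝ.√-square (normSq z) (normSq-nonNeg z)

  normSq-pos⇒NonZero : ∀ z → 0ℝ < normSq z → NonZero z
  normSq-pos⇒NonZero z p = ℝₚ.nonNeg∧#⇒pos (ℝ.√-nonNeg _ (normSq-nonNeg z))
    (ℝₚ.*-#0⇒#0ˡ ∣ z ∣ ∣ z ∣ (ℝₚ.#-congʳ (ℝ.sym (∣∣² z)) (ℝₚ.pos⇒# p)))

  normSq-* : ∀ z w → normSq (z * w) ℝ.≈ normSq z ℝ.* normSq w
  normSq-* (a +i b) (c +i d) = ℝₚ.sumOfSquares-* a b c d

  1-NonZero : NonZero 1ℂ
  1-NonZero = normSq-pos⇒NonZero 1ℂ
    (ℝₚ.pos+nonNeg (ℝₚ.square-pos ℝₚ.1#0) (ℝₚ.square-nonNeg 0ℝ))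

  *-NonZero : ∀ {z w} → NonZero z → NonZero w → NonZero (z * w)
  *-NonZero {z} {w} z≠0 w≠0 = normSq-pos⇒NonZero (z * w) (ℝₚ.<-respʳ
    (ℝ.sym (ℝ.trans (normSq-* z w) (ℝ.sym (ℝ.*-cong (∣∣² z) (∣∣² w)))))
    (ℝ.*-pos (ℝ.*-pos z≠0 z≠0) (ℝ.*-pos w≠0 w≠0)))

  -- No factor of (a;q)_∞ vanishes, i.e. a ∉ {q⁻ᵏ : k ≥ 0}.
  Regular : ℂ → ℂ → Set ℓ₃
  Regular q a = ∀ k → NonZero (qFactor a q k)

  poch-NonZero : ∀ {q a} → Regular q a → ∀ n → NonZero (⟨ a ⨾ q ⟩ n)
  poch-NonZero reg zero    = 1-NonZero
  poch-NonZero reg (suc n) = *-NonZero (poch-NonZero reg n) (reg n)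

  pochs-NonZero : ∀ {q m} {as : Vec ℂ m} → All (Regular q) as → ∀ n → NonZero (⟪ as ⨾ q ⟫ n)
  pochs-NonZero []           n = 1-NonZero
  pochs-NonZero (reg ∷ regs) n = *-NonZero (poch-NonZero reg n) (pochs-NonZero regs n)

  normSq<1⇒1-NonZero : ∀ z → normSq z < 1ℝ → NonZero (1ℂ - z)
  normSq<1⇒1-NonZero z nz<1 = normSq-pos⇒NonZero (1ℂ - z)
    (ℝₚ.pos+nonNeg (ℝₚ.square-pos (ℝₚ.pos⇒# (ℝₚ.pos-diff (ℝₚ.square<1⇒<1 re²<1))))
      (ℝₚ.square-nonNeg _))
    where
    re²<1 : re z ℝ.* re z < 1ℝ
    re²<1 = ℝₚ.≤-<-trans (ℝₚ.x≤x+nonNeg (ℝₚ.square-nonNeg (im z))) nz<1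

  ∣q∣<1⇒Regular : ∀ {q} → ∣ q ∣ < 1ℝ → Regular q q
  ∣q∣<1⇒Regular {q} ∣q∣<1 k = normSq<1⇒1-NonZero (q ^ suc k) (power k)
    where
    base : normSq q < 1ℝ
    base = ℝₚ.<-respˡ (∣∣² q)
      (ℝₚ.<1⇒square<1 (ℝ.√-nonNeg _ (normSq-nonNeg q)) ∣q∣<1)
    power : ∀ k → normSq (q ^ suc k) < 1ℝ
    power zero    = ℝₚ.<-respˡ (ℝ.sym (ℝ.trans (normSq-* q 1ℂ) (ℝₚ.x*[11+00]≈x (normSq q)))) base
    power (suc k) = ℝₚ.<-respˡ (ℝ.sym (normSq-* q (q ^ suc k)))
      (ℝₚ.*-<1 (normSq-nonNeg q) base (power k))

  module _ (q : ℂ) (∣q∣<1 : ∣ q ∣ < 1ℝ) where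

    qq-NonZero : ∀ n → NonZero (⟨ q ⨾ q ⟩ n)
    qq-NonZero = poch-NonZero (∣q∣<1⇒Regular ∣q∣<1)

    -- The Gaussian coefficient, used only for k ≤ n.
    gauss : ℕ → ℕ → ℂ
    gauss n k = ⟨ q ⨾ q ⟩ n / (⟨ q ⨾ q ⟩ k * ⟨ q ⨾ q ⟩ (n ℕ.∸ k))
      [ *-NonZero (qq-NonZero k) (qq-NonZero (n ℕ.∸ k)) ]

    cauchyPoly : ℕ → ℂ → ℂ → ℂ
    cauchyPoly n x y = ∏< n (λ k → x - q ^ k * y)

    rogersSzegő : ℕ → ℂ → ℂ → ℂ
    rogersSzegő n x y = ∑< (suc n) (λ k → gauss n k * cauchyPoly k x y)

    hypergeometricTerm : ∀ {r} → Vec ℂ (suc r) → (bs : Vec ℂ r) → All (Regular q) bs →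
                         ℂ → ℕ → ℂ
    hypergeometricTerm as bs regs z n =
      ⟪ as ⨾ q ⟫ n / ⟪ q ∷ bs ⨾ q ⟫ n [ pochs-NonZero (∣q∣<1⇒Regular ∣q∣<1 ∷ regs) n ] * z ^ n

{-# OPTIONS --safe #-}

-- By the q-binomial theorem ∑ₙ (a)ₙ zⁿ/(q)ₙ = (az)_∞/(z)_∞, the j-th term of the ₃φ₂ series times the
-- infinite products in front of it is (y)ⱼ (v/u)ⱼ (ut)ʲ/(q)ⱼ times the product of the three series for
-- (qʲyt)_∞/(t)_∞, 1/(qʲxt)_∞ and (qʲvxt)_∞/(uxt)_∞.  Expanding these gives a multiple series with a
-- geometric majorant, so that it may be summed by total degree in t, and the claim is reduced to an
-- identity between polynomials in each degree.
--
-- Grouping that identity by Pₖ(u,v) leaves the coefficients of the Rogers-type formula for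
-- ∑ₚ h_{k+p}(x,y|q) tᵖ/(q)ₚ, which follow by induction on k from the q-Pascal rule, and the symmetry
-- ∑ₖ [n,k] Pₖ(x,y) cⁿ⁻ᵏ = ∑ₖ [n,k] Pₖ(c,y) xⁿ⁻ᵏ, where the two q-Pascal rules give both sides the same
-- recurrence.

module Submission where

open import Defs
open import Level using (Level; _⊔_; lift) renaming (suc to lsuc)
open import Algebra.Bundles using (CommutativeRing)
open import Data.Maybe.Base using (Maybe; just; nothing)
open import Data.Nat.Base as ℕ using (ℕ; zero; suc)
open import Data.Product.Base as Product using (Σ; ∃; _×_; _,_; proj₁; proj₂)
open import Data.Sum.Base using (_⊎_; inj₁; inj₂)
open import Data.Vec.Base using ([]; _∷_)
open import Data.Vec.Relation.Unary.All using ([]; _∷_)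
open import Relation.Binary.PropositionalEquality.Core as ≡ using (_≡_)
open import Relation.Binary.Structures using (IsPreorder; IsStrictPartialOrder)
open import Relation.Nullary.Decidable.Core using (yes; no)
open import Relation.Nullary.Negation using (contradiction)
import Algebra.Properties.AbelianGroup as AbelianGroupProperties
import Algebra.Properties.CommutativeSemiring.Exp as Exp
import Algebra.Properties.Ring as RingProperties
import Algebra.Properties.Semiring.Mult.TCOptimised as Mult
import Algebra.Solver.Ring as RingSolver
import Algebra.Solver.Ring.AlmostCommutativeRing as ACR
import Data.Integer.Base as ℤ
import Data.Integer.Properties as ℤₚ
import Data.Nat.Properties as ℕₚ
import Relation.Binary.Reasoning.Base.Triple as TripleReasoning
import Relation.Binary.Reasoning.Setoid as SetoidReasoning

-- Division by anything but (q;q)ₙ is postponed. The q-binomial theorem is used in the form s (z)_∞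
-- = (az)_∞, the hypergeometric terms enter through equations with cleared denominators, and only at
-- the end is the result divided by (yt)_∞ (vxt)_∞ and by (t)_∞ (xt)_∞ (uxt)_∞. Writing X = xt, Y =
-- yt and v = uw makes the finite identities homogeneous and polynomial, so they hold in any
-- commutative ring in which the (q;q)ₙ are invertible. The analysis is constructive: only apartness
-- is available on the reals, so no case distinction picks the larger of two numbers. Two geometric
-- majorants get the common ratio 1 - (1 - θ₁)(1 - θ₂), infinite products are bounded by a discrete
-- induction in place of the exponential function, and an explicit error estimate between summation
-- by rows and by diagonals replaces a theory of absolute convergence. Each Cauchy product costs a
-- factor n + 1, which is absorbed by enlarging the ratio while keeping it below 1.

module IntegerRingSolver {c ℓ} (K : CommutativeRing c ℓ) where
  open CommutativeRing K
  open RingProperties ring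
  open Mult semiring using (×-homo-+; ×1-homo-*) renaming (_×_ to _ℕ×_)
  open SetoidReasoning setoid

  private
    -- Integer coefficients have decidable equality, so the solver can see that terms cancel;
    -- coefficients from `K` itself could not be compared.
    fromℤ : ℤ.ℤ → Carrier
    fromℤ (ℤ.+ n)      = n ℕ× 1#
    fromℤ (ℤ.-[1+ n ]) = - (suc n ℕ× 1#)

    fromℤ-neg : ∀ i → fromℤ (ℤ.- i) ≈ - fromℤ i
    fromℤ-neg (ℤ.+ zero)   = sym -0#≈0#
    fromℤ-neg (ℤ.+ suc n)  = refl
    fromℤ-neg ℤ.-[1+ n ]   = sym (-‿involutive _)

    cancel : ∀ a b d → (d + a) - (d + b) ≈ a - b
    cancel a b d = begin
      (d + a) - (d + b)       ≈⟨ +-cong (+-comm d a) (sym (-‿+-comm d b)) ⟩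
      (a + d) + (- d - b)     ≈⟨ +-assoc a d _ ⟩
      a + (d + (- d - b))     ≈⟨ +-congˡ (sym (+-assoc d (- d) (- b))) ⟩
      a + ((d - d) - b)       ≈⟨ +-congˡ (trans (+-congʳ (-‿inverseʳ d)) (+-identityˡ _)) ⟩
      a - b                   ∎

    fromℤ-⊖ : ∀ m n → fromℤ (m ℤ.⊖ n) ≈ m ℕ× 1# - n ℕ× 1#
    fromℤ-⊖ m       zero    = sym (trans (+-congˡ -0#≈0#) (+-identityʳ _))
    fromℤ-⊖ zero    (suc n) = sym (+-identityˡ _)
    fromℤ-⊖ (suc m) (suc n) = begin
      fromℤ (suc m ℤ.⊖ suc n)           ≡⟨ ≡.cong fromℤ (ℤₚ.[1+m]⊖[1+n]≡m⊖n m n) ⟩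
      fromℤ (m ℤ.⊖ n)                   ≈⟨ fromℤ-⊖ m n ⟩
      m ℕ× 1# - n ℕ× 1#                   ≈⟨ cancel _ _ 1# ⟨
      (1# + m ℕ× 1#) - (1# + n ℕ× 1#)
        ≈⟨ +-cong (×-homo-+ 1# 1 m) (-‿cong (×-homo-+ 1# 1 n)) ⟨
      suc m ℕ× 1# - suc n ℕ× 1#           ∎

    fromℤ-+ : ∀ i j → fromℤ (i ℤ.+ j) ≈ fromℤ i + fromℤ j
    fromℤ-+ (ℤ.+ m)    (ℤ.+ n)    = ×-homo-+ 1# m n
    fromℤ-+ (ℤ.+ m)    ℤ.-[1+ n ] = fromℤ-⊖ m (suc n)
    fromℤ-+ ℤ.-[1+ m ] (ℤ.+ n)    = trans (fromℤ-⊖ n (suc m)) (+-comm _ _)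
    fromℤ-+ ℤ.-[1+ m ] ℤ.-[1+ n ] = begin
      - (suc (suc (m ℕ.+ n)) ℕ× 1#)      ≡⟨ ≡.cong (λ k → - (suc k ℕ× 1#)) (ℕₚ.+-suc m n) ⟨
      - ((suc m ℕ.+ suc n) ℕ× 1#)        ≈⟨ -‿cong (×-homo-+ 1# (suc m) (suc n)) ⟩
      - (suc m ℕ× 1# + suc n ℕ× 1#)       ≈⟨ -‿+-comm _ _ ⟨
      - (suc m ℕ× 1#) - (suc n ℕ× 1#)     ∎

    fromℤ-*ʳ : ∀ m j → fromℤ (ℤ.+ m ℤ.* j) ≈ m ℕ× 1# * fromℤ j
    fromℤ-*ʳ m (ℤ.+ n)    = begin
      fromℤ (ℤ.+ m ℤ.* ℤ.+ n)    ≡⟨ ≡.cong fromℤ (ℤₚ.pos-* m n) ⟨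
      (m ℕ.* n) ℕ× 1#             ≈⟨ ×1-homo-* m n ⟩
      m ℕ× 1# * n ℕ× 1#            ∎
    fromℤ-*ʳ m ℤ.-[1+ n ] = begin
      fromℤ (ℤ.+ m ℤ.* ℤ.-[1+ n ])          ≡⟨ ≡.cong fromℤ (ℤₚ.neg-distribʳ-* (ℤ.+ m) (ℤ.+ suc n)) ⟨
      fromℤ (ℤ.- (ℤ.+ m ℤ.* ℤ.+ suc n))     ≈⟨ fromℤ-neg (ℤ.+ m ℤ.* ℤ.+ suc n) ⟩
      - fromℤ (ℤ.+ m ℤ.* ℤ.+ suc n)         ≈⟨ -‿cong (fromℤ-*ʳ m (ℤ.+ suc n)) ⟩
      - (m ℕ× 1# * suc n ℕ× 1#)               ≈⟨ -‿distribʳ-* _ _ ⟩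
      m ℕ× 1# * - (suc n ℕ× 1#)               ∎

    fromℤ-* : ∀ i j → fromℤ (i ℤ.* j) ≈ fromℤ i * fromℤ j
    fromℤ-* (ℤ.+ m)    j = fromℤ-*ʳ m j
    fromℤ-* ℤ.-[1+ m ] j = begin
      fromℤ (ℤ.-[1+ m ] ℤ.* j)              ≡⟨ ≡.cong fromℤ (ℤₚ.neg-distribˡ-* (ℤ.+ suc m) j) ⟨
      fromℤ (ℤ.- (ℤ.+ suc m ℤ.* j))         ≈⟨ fromℤ-neg (ℤ.+ suc m ℤ.* j) ⟩
      - fromℤ (ℤ.+ suc m ℤ.* j)             ≈⟨ -‿cong (fromℤ-*ʳ (suc m) j) ⟩
      - (suc m ℕ× 1# * fromℤ j)              ≈⟨ -‿distribˡ-* _ _ ⟩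
      - (suc m ℕ× 1#) * fromℤ j              ∎

    morphism : ℤ.+-*-rawRing ACR.-Raw-AlmostCommutative⟶ ACR.fromCommutativeRing K
    morphism = record
      { ⟦_⟧    = fromℤ
      ; +-homo = fromℤ-+
      ; *-homo = fromℤ-*
      ; -‿homo = fromℤ-neg
      ; 0-homo = refl
      ; 1-homo = refl
      }

    weaklyDecide : ∀ i j → Maybe (fromℤ i ≈ fromℤ j)
    weaklyDecide i j with i ℤₚ.≟ j
    ... | yes i≡j = just (reflexive (≡.cong fromℤ i≡j))
    ... | no  _   = nothing

  open RingSolver ℤ.+-*-rawRing (ACR.fromCommutativeRing K) morphism weaklyDecide public
    using (solve; con; _:=_; _:+_; _:*_; _:-_; :-_)

  pattern :0 = con (ℤ.+ 0)
  pattern :1 = con (ℤ.+ 1)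

-- Finite sums and sums over i + k = n.

module Sums {c ℓ} (K : CommutativeRing c ℓ) where
  open CommutativeRing K
  open IntegerRingSolver K
  open SetoidReasoning setoid

  ∑< : ℕ → (ℕ → Carrier) → Carrier
  ∑< zero    f = 0#
  ∑< (suc n) f = ∑< n f + f n

  ∑<-cong : ∀ n {f g} → (∀ k → f k ≈ g k) → ∑< n f ≈ ∑< n g
  ∑<-cong zero    eq = refl
  ∑<-cong (suc n) eq = +-cong (∑<-cong n eq) (eq n)

  ∑<-head : ∀ n f → ∑< (suc n) f ≈ f 0 + ∑< n (λ k → f (suc k))
  ∑<-head zero    f = +-comm 0# (f 0)
  ∑<-head (suc n) f = trans (+-congʳ (∑<-head n f)) (+-assoc _ _ _)

  ∑<-distrib-+ : ∀ n f g → ∑< n (λ k → f k + g k) ≈ ∑< n f + ∑< n g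
  ∑<-distrib-+ zero    f g = sym (+-identityˡ 0#)
  ∑<-distrib-+ (suc n) f g = trans (+-congʳ (∑<-distrib-+ n f g))
    (solve 4 (λ a b c d → a :+ b :+ (c :+ d) := a :+ c :+ (b :+ d)) refl _ _ _ _)

  ∑<-distribˡ-* : ∀ n a f → ∑< n (λ k → a * f k) ≈ a * ∑< n f
  ∑<-distribˡ-* zero    a f = sym (zeroʳ a)
  ∑<-distribˡ-* (suc n) a f = trans (+-congʳ (∑<-distribˡ-* n a f)) (sym (distribˡ a _ _))

  -- ∑△ n f = ∑_{i+k=n} f i k
  ∑△ : ℕ → (ℕ → ℕ → Carrier) → Carrier
  ∑△ zero    f = f 0 0
  ∑△ (suc n) f = f 0 (suc n) + ∑△ n (λ i k → f (suc i) k)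

  ∑△-cong : ∀ n {f g} → (∀ i k → i ℕ.+ k ≡ n → f i k ≈ g i k) → ∑△ n f ≈ ∑△ n g
  ∑△-cong zero    eq = eq 0 0 ≡.refl
  ∑△-cong (suc n) eq = +-cong (eq 0 (suc n) ≡.refl)
    (∑△-cong n (λ i k i+k≡n → eq (suc i) k (≡.cong suc i+k≡n)))

  ∑△-distrib-+ : ∀ n f g → ∑△ n (λ i k → f i k + g i k) ≈ ∑△ n f + ∑△ n g
  ∑△-distrib-+ zero    f g = refl
  ∑△-distrib-+ (suc n) f g = trans (+-congˡ (∑△-distrib-+ n _ _))
    (solve 4 (λ a b c d → a :+ b :+ (c :+ d) := a :+ c :+ (b :+ d)) refl _ _ _ _)

  ∑△-distribˡ-* : ∀ n a f → ∑△ n (λ i k → a * f i k) ≈ a * ∑△ n f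
  ∑△-distribˡ-* zero    a f = refl
  ∑△-distribˡ-* (suc n) a f = trans (+-congˡ (∑△-distribˡ-* n a _)) (sym (distribˡ a _ _))

  ∑△-last : ∀ n f → ∑△ (suc n) f ≈ ∑△ n (λ i k → f i (suc k)) + f (suc n) 0
  ∑△-last zero    f = refl
  ∑△-last (suc n) f = trans (+-congˡ (∑△-last n (λ i → f (suc i)))) (sym (+-assoc _ _ _))

  ∑△-assoc : ∀ n (f : ℕ → ℕ → ℕ → Carrier) →
    ∑△ n (λ j r → ∑△ r (λ i p → f j i p)) ≈ ∑△ n (λ k p → ∑△ k (λ j i → f j i p))
  ∑△-assoc zero    f = refl
  ∑△-assoc (suc n) f = begin
    f 0 0 (suc n) + ∑△ n (λ i p → f 0 (suc i) p) + ∑△ n (λ j r → ∑△ r (f (suc j)))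
      ≈⟨ +-congˡ (∑△-assoc n (λ j → f (suc j))) ⟩
    f 0 0 (suc n) + ∑△ n (λ k p → f 0 (suc k) p) + ∑△ n (λ k p → ∑△ k (λ j i → f (suc j) i p))
      ≈⟨ +-assoc _ _ _ ⟩
    f 0 0 (suc n) + (∑△ n (λ k p → f 0 (suc k) p) + ∑△ n (λ k p → ∑△ k (λ j i → f (suc j) i p)))
      ≈⟨ +-congˡ (∑△-distrib-+ n _ _) ⟨
    f 0 0 (suc n) + ∑△ n (λ k p → f 0 (suc k) p + ∑△ k (λ j i → f (suc j) i p)) ∎

  ∑<≈∑△ : ∀ n (f : ℕ → ℕ → Carrier) → ∑< (suc n) (λ k → f k (n ℕ.∸ k)) ≈ ∑△ n f
  ∑<≈∑△ zero    f = +-identityˡ _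
  ∑<≈∑△ (suc n) f = trans (∑<-head (suc n) _) (+-congˡ (∑<≈∑△ n (λ k → f (suc k))))

-- Cauchy polynomials over a commutative ring.

module CauchyPolynomials {c ℓ} (K : CommutativeRing c ℓ) (q : CommutativeRing.Carrier K) where
  open CommutativeRing K
  open IntegerRingSolver K
  open SetoidReasoning setoid
  open Exp commutativeSemiring using (_^_; ^-homo-*)

  P : ℕ → Carrier → Carrier → Carrier
  P zero    x y = 1#
  P (suc n) x y = P n x y * (x - q ^ n * y)

  P-cong : ∀ n {x x′ y y′} → x ≈ x′ → y ≈ y′ → P n x y ≈ P n x′ y′
  P-cong zero    x≈ y≈ = refl
  P-cong (suc n) x≈ y≈ = *-cong (P-cong n x≈ y≈) (+-cong x≈ (-‿cong (*-congˡ y≈)))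

  P-head : ∀ n x y → P (suc n) x y ≈ (x - y) * P n x (q * y)
  P-head zero    x y = solve 2 (λ x y → :1 :* (x :- :1 :* y) := (x :- y) :* :1) refl x y
  P-head (suc n) x y = trans (*-congʳ (P-head n x y))
    (solve 5 (λ x y q p s → (x :- y) :* p :* (x :- q :* s :* y)
                         := (x :- y) :* (p :* (x :- s :* (q :* y)))) refl x y q _ (q ^ n))

  P-scale : ∀ n s x y → P n (s * x) (s * y) ≈ s ^ n * P n x y
  P-scale zero    s x y = sym (*-identityˡ 1#)
  P-scale (suc n) s x y = trans (*-congʳ (P-scale n s x y))
    (solve 6 (λ s x y p S Q → S :* p :* (s :* x :- Q :* (s :* y))
                            := s :* S :* (p :* (x :- Q :* y))) refl s x y _ (s ^ n) (q ^ n))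

  -- The homogeneous form of (a;q)ⱼ₊ᵢ = (a;q)ⱼ (qʲa;q)ᵢ. It merges the two factors in u and v of the
  -- multiple series, and as i grows it splits the infinite products.
  P-+ : ∀ j i x y → P (j ℕ.+ i) x y ≈ P j x y * P i x (q ^ j * y)
  P-+ j zero    x y = trans (reflexive (≡.cong (λ k → P k x y) (ℕₚ.+-identityʳ j)))
                            (sym (*-identityʳ _))
  P-+ j (suc i) x y = begin
    P (j ℕ.+ suc i) x y                                       ≡⟨ ≡.cong (λ k → P k x y) (ℕₚ.+-suc j i) ⟩
    P (j ℕ.+ i) x y * (x - q ^ (j ℕ.+ i) * y)
      ≈⟨ *-cong (P-+ j i x y) (+-congˡ (-‿cong (*-congʳ (^-homo-* q j i)))) ⟩
    P j x y * P i x (q ^ j * y) * (x - q ^ j * q ^ i * y)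
      ≈⟨ solve 6 (λ a b x y s r → a :* b :* (x :- s :* r :* y) := a :* (b :* (x :- r :* (s :* y))))
           refl (P j x y) (P i x (q ^ j * y)) x y (q ^ j) (q ^ i) ⟩
    P j x y * P (suc i) x (q ^ j * y)                         ∎

-- Q n = (q;q)ₙ, and e n is its inverse.
record QFactorials {c ℓ} (K : CommutativeRing c ℓ) : Set (c ⊔ ℓ) where
  open CommutativeRing K
  open Exp commutativeSemiring using (_^_)
  field
    q      : Carrier
    Q e    : ℕ → Carrier
    Q-zero : Q 0 ≈ 1#
    Q-suc  : ∀ n → Q (suc n) ≈ Q n * (1# - q ^ suc n)
    Q*e≈1  : ∀ n → Q n * e n ≈ 1#

-- Rogers-Szegő polynomials and the polynomial identity in each degree.

module RogersSzegő {c ℓ} (K : CommutativeRing c ℓ) (F : QFactorials K) where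
  open CommutativeRing K
  open Exp commutativeSemiring using (_^_; ^-congˡ; ^-distrib-*; ^-homo-*)
  open QFactorials F
  open IntegerRingSolver K
  open SetoidReasoning setoid
  open Sums K
  open CauchyPolynomials K q

  e-zero : e 0 ≈ 1#
  e-zero = trans (sym (*-identityˡ _)) (trans (*-congʳ (sym Q-zero)) (Q*e≈1 0))

  e-suc : ∀ n → (1# - q ^ suc n) * e (suc n) ≈ e n
  e-suc n = begin
    d * e (suc n)                         ≈⟨ *-identityˡ _ ⟨
    1# * (d * e (suc n))                  ≈⟨ *-congʳ (Q*e≈1 n) ⟨
    Q n * e n * (d * e (suc n))           ≈⟨ solve 4 (λ Q e d f → Q :* e :* (d :* f) := e :* (Q :* d :* f)) refl _ _ _ _ ⟩
    e n * (Q n * d * e (suc n))           ≈⟨ *-congˡ (*-congʳ (Q-suc n)) ⟨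
    e n * (Q (suc n) * e (suc n))         ≈⟨ *-congˡ (Q*e≈1 (suc n)) ⟩
    e n * 1#                              ≈⟨ *-identityʳ _ ⟩
    e n                                   ∎
    where d = 1# - q ^ suc n

  -- `Q n * e (suc n)` is an inverse of the factor. Hence a recurrence for a multiple of the next
  -- value by 1 - qⁿ⁺¹ determines that value.
  1-qⁿ-cancel : ∀ n {a b} → (1# - q ^ suc n) * a ≈ (1# - q ^ suc n) * b → a ≈ b
  1-qⁿ-cancel n {a} {b} eq = begin
    a                              ≈⟨ inverse a ⟨
    Q n * e (suc n) * (d * a)      ≈⟨ *-congˡ eq ⟩
    Q n * e (suc n) * (d * b)      ≈⟨ inverse b ⟩
    b                              ∎
    where
    d = 1# - q ^ suc n
    inverse : ∀ a → Q n * e (suc n) * (d * a) ≈ a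
    inverse a = begin
      Q n * e (suc n) * (d * a)      ≈⟨ solve 4 (λ Q f d a → Q :* f :* (d :* a) := Q :* (d :* f) :* a) refl _ _ _ _ ⟩
      Q n * (d * e (suc n)) * a      ≈⟨ *-congʳ (trans (*-congˡ (e-suc n)) (Q*e≈1 n)) ⟩
      1# * a                         ≈⟨ *-identityˡ a ⟩
      a                              ∎

  private
    -- The factor 1 - qⁱ kills the boundary term i = 0 and lowers the index of `e` in all others,
    -- which leaves a sum of degree n.
    drop-first : ∀ n (f : ℕ → ℕ → Carrier) →
      ∑△ (suc n) (λ i k → (1# - q ^ i) * e i * f i k) ≈ ∑△ n (λ i k → e i * f (suc i) k)
    drop-first n f = trans (+-cong
      (solve 2 (λ a b → (:1 :- :1) :* a :* b := :0) refl (e 0) (f 0 (suc n)))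
      (∑△-cong n (λ i k _ → *-congʳ (e-suc i)))) (+-identityˡ _)

    drop-last : ∀ n (f : ℕ → ℕ → Carrier) →
      ∑△ (suc n) (λ i k → (1# - q ^ k) * e k * f i k) ≈ ∑△ n (λ i k → e k * f i (suc k))
    drop-last n f = trans (∑△-last n (λ i k → (1# - q ^ k) * e k * f i k)) (trans (+-cong
      (∑△-cong n (λ i k _ → *-congʳ (e-suc k)))
      (solve 2 (λ a b → (:1 :- :1) :* a :* b := :0) refl (e 0) (f (suc n) 0))) (+-identityʳ _))

    q^i*q^k : ∀ n i k → i ℕ.+ k ≡ suc n → q ^ suc n ≈ q ^ i * q ^ k
    q^i*q^k n i k i+k≡ = trans (reflexive (≡.cong (q ^_) (≡.sym i+k≡))) (^-homo-* q i k)

  -- The two q-Pascal rules, summed against an arbitrary f.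
  pascalˡ : ∀ n (f : ℕ → ℕ → Carrier) →
    (1# - q ^ suc n) * ∑△ (suc n) (λ i k → e i * e k * f i k) ≈
    ∑△ n (λ i k → e i * e k * f (suc i) k) + ∑△ n (λ i k → e i * e k * (q ^ i * f i (suc k)))
  pascalˡ n f = begin
    (1# - q ^ suc n) * ∑△ (suc n) (λ i k → e i * e k * f i k)
      ≈⟨ ∑△-distribˡ-* (suc n) _ (λ i k → e i * e k * f i k) ⟨
    ∑△ (suc n) (λ i k → (1# - q ^ suc n) * (e i * e k * f i k))
      -- With x = qⁱ and y = qᵏ, this uses 1 - xy = (1 - x) + x(1 - y); the other rule comes from 1
      -- - xy = (1 - x)y + (1 - y).
      ≈⟨ ∑△-cong (suc n) (λ i k i+k≡ → trans (*-congʳ (+-congˡ (-‿cong (q^i*q^k n i k i+k≡))))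
           (solve 5 (λ x y a b f → (:1 :- x :* y) :* (a :* b :* f)
             := (:1 :- x) :* a :* (b :* f) :+ (:1 :- y) :* b :* (a :* (x :* f)))
             refl (q ^ i) (q ^ k) (e i) (e k) (f i k))) ⟩
    ∑△ (suc n) (λ i k → (1# - q ^ i) * e i * (e k * f i k)
                      + (1# - q ^ k) * e k * (e i * (q ^ i * f i k)))
      ≈⟨ ∑△-distrib-+ (suc n) (λ i k → (1# - q ^ i) * e i * (e k * f i k))
                                (λ i k → (1# - q ^ k) * e k * (e i * (q ^ i * f i k))) ⟩
    ∑△ (suc n) (λ i k → (1# - q ^ i) * e i * (e k * f i k))
      + ∑△ (suc n) (λ i k → (1# - q ^ k) * e k * (e i * (q ^ i * f i k)))
      ≈⟨ +-cong (drop-first n (λ i k → e k * f i k)) (drop-last n (λ i k → e i * (q ^ i * f i k))) ⟩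
    ∑△ n (λ i k → e i * (e k * f (suc i) k)) + ∑△ n (λ i k → e k * (e i * (q ^ i * f i (suc k))))
      ≈⟨ +-cong (∑△-cong n (λ i k _ → sym (*-assoc _ _ _)))
                (∑△-cong n (λ i k _ → trans (sym (*-assoc _ _ _)) (*-congʳ (*-comm _ _)))) ⟩
    ∑△ n (λ i k → e i * e k * f (suc i) k) + ∑△ n (λ i k → e i * e k * (q ^ i * f i (suc k))) ∎

  pascalʳ : ∀ n (f : ℕ → ℕ → Carrier) →
    (1# - q ^ suc n) * ∑△ (suc n) (λ i k → e i * e k * f i k) ≈
    ∑△ n (λ i k → e i * e k * (q ^ k * f (suc i) k)) + ∑△ n (λ i k → e i * e k * f i (suc k))
  pascalʳ n f = begin
    (1# - q ^ suc n) * ∑△ (suc n) (λ i k → e i * e k * f i k)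
      ≈⟨ ∑△-distribˡ-* (suc n) _ (λ i k → e i * e k * f i k) ⟨
    ∑△ (suc n) (λ i k → (1# - q ^ suc n) * (e i * e k * f i k))
      ≈⟨ ∑△-cong (suc n) (λ i k i+k≡ → trans (*-congʳ (+-congˡ (-‿cong (q^i*q^k n i k i+k≡))))
           (solve 5 (λ x y a b f → (:1 :- x :* y) :* (a :* b :* f)
             := (:1 :- x) :* a :* (b :* (y :* f)) :+ (:1 :- y) :* b :* (a :* f))
             refl (q ^ i) (q ^ k) (e i) (e k) (f i k))) ⟩
    ∑△ (suc n) (λ i k → (1# - q ^ i) * e i * (e k * (q ^ k * f i k))
                      + (1# - q ^ k) * e k * (e i * f i k))
      ≈⟨ ∑△-distrib-+ (suc n) (λ i k → (1# - q ^ i) * e i * (e k * (q ^ k * f i k)))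
                                (λ i k → (1# - q ^ k) * e k * (e i * f i k)) ⟩
    ∑△ (suc n) (λ i k → (1# - q ^ i) * e i * (e k * (q ^ k * f i k)))
      + ∑△ (suc n) (λ i k → (1# - q ^ k) * e k * (e i * f i k))
      ≈⟨ +-cong (drop-first n (λ i k → e k * (q ^ k * f i k))) (drop-last n (λ i k → e i * f i k)) ⟩
    ∑△ n (λ i k → e i * (e k * (q ^ k * f (suc i) k))) + ∑△ n (λ i k → e k * (e i * f i (suc k)))
      ≈⟨ +-cong (∑△-cong n (λ i k _ → sym (*-assoc _ _ _)))
                (∑△-cong n (λ i k _ → trans (sym (*-assoc _ _ _)) (*-congʳ (*-comm _ _)))) ⟩
    ∑△ n (λ i k → e i * e k * (q ^ k * f (suc i) k)) + ∑△ n (λ i k → e i * e k * f i (suc k)) ∎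

  -- S n x 1 y = hₙ(x,y|q)/(q;q)ₙ; the third variable makes the polynomial homogeneous.
  S : ℕ → Carrier → Carrier → Carrier → Carrier
  S n x c y = ∑△ n (λ i k → e i * e k * (P i x y * c ^ k))

  S-cong : ∀ n {x x′ c c′ y y′} → x ≈ x′ → c ≈ c′ → y ≈ y′ → S n x c y ≈ S n x′ c′ y′
  S-cong n x≈ c≈ y≈ = ∑△-cong n (λ i k _ → *-congˡ (*-cong (P-cong i x≈ y≈) (^-congˡ k c≈)))

  S-scale : ∀ n s x c y → S n (s * x) (s * c) (s * y) ≈ s ^ n * S n x c y
  S-scale n s x c y = trans (∑△-cong n (λ i k i+k≡n → begin
    e i * e k * (P i (s * x) (s * y) * (s * c) ^ k)
      ≈⟨ *-congˡ (*-cong (P-scale i s x y) (^-distrib-* s c k)) ⟩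
    e i * e k * (s ^ i * P i x y * (s ^ k * c ^ k))
      ≈⟨ solve 5 (λ a u b v d → a :* (u :* b :* (v :* d)) := u :* v :* (a :* (b :* d))) refl _ _ _ _ _ ⟩
    s ^ i * s ^ k * (e i * e k * (P i x y * c ^ k))
      ≈⟨ *-congʳ (trans (sym (^-homo-* s i k)) (reflexive (≡.cong (s ^_) i+k≡n))) ⟩
    s ^ n * (e i * e k * (P i x y * c ^ k)) ∎)) (∑△-distribˡ-* n _ _)

  -- The `S n x c y` are the coefficients of F(z) = (yz)_∞ / ((xz)_∞ (cz)_∞), and formally this is
  -- F(z) - F(qz) = z (c + (x - y)(1 - cz)/(1 - yz)) F(z). `S-suc′` is its mirror image in x and c,
  -- but is proved separately because the symmetry is deduced from the pair.
  S-suc : ∀ n x c y →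
    (1# - q ^ suc n) * S (suc n) x c y ≈ c * S n x c y + (x - y) * S n x (q * c) (q * y)
  S-suc n x c y = begin
    (1# - q ^ suc n) * S (suc n) x c y
      ≈⟨ pascalʳ n (λ i k → P i x y * c ^ k) ⟩
    ∑△ n (λ i k → e i * e k * (q ^ k * (P (suc i) x y * c ^ k)))
      + ∑△ n (λ i k → e i * e k * (P i x y * (c * c ^ k)))
      ≈⟨ +-cong
           (∑△-cong n (λ i k _ → trans (*-congˡ (*-congˡ (*-congʳ (P-head i x y))))
             (trans (solve 5 (λ a b u p v → a :* (u :* (b :* p :* v)) := b :* (a :* (p :* (u :* v))))
                       refl (e i * e k) (x - y) (q ^ k) (P i x (q * y)) (c ^ k))
               (*-congˡ (*-congˡ (*-congˡ (sym (^-distrib-* q c k))))))))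
           (∑△-cong n (λ i k _ → solve 4 (λ a p c d → a :* (p :* (c :* d)) := c :* (a :* (p :* d)))
                       refl (e i * e k) (P i x y) c (c ^ k))) ⟩
    ∑△ n (λ i k → (x - y) * (e i * e k * (P i x (q * y) * (q * c) ^ k)))
      + ∑△ n (λ i k → c * (e i * e k * (P i x y * c ^ k)))
      ≈⟨ +-cong (∑△-distribˡ-* n _ _) (∑△-distribˡ-* n _ _) ⟩
    (x - y) * S n x (q * c) (q * y) + c * S n x c y
      ≈⟨ +-comm _ _ ⟩
    c * S n x c y + (x - y) * S n x (q * c) (q * y) ∎

  S-suc′ : ∀ n x c y →
    (1# - q ^ suc n) * S (suc n) x c y ≈ x * S n x c y + (c - y) * S n (q * x) c (q * y)
  S-suc′ n x c y = begin
    (1# - q ^ suc n) * S (suc n) x c y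
      ≈⟨ pascalˡ n (λ i k → P i x y * c ^ k) ⟩
    ∑△ n (λ i k → e i * e k * (P (suc i) x y * c ^ k))
      + ∑△ n (λ i k → e i * e k * (q ^ i * (P i x y * (c * c ^ k))))
      ≈⟨ ∑△-distrib-+ n _ _ ⟨
    ∑△ n (λ i k → e i * e k * (P (suc i) x y * c ^ k)
                + e i * e k * (q ^ i * (P i x y * (c * c ^ k))))
      ≈⟨ ∑△-cong n (λ i k _ → trans
           (solve 7 (λ a p x u y d c →
              a :* (p :* (x :- u :* y) :* d) :+ a :* (u :* (p :* (c :* d)))
              := x :* (a :* (p :* d)) :+ (c :- y) :* (a :* (u :* p :* d)))
              refl (e i * e k) (P i x y) x (q ^ i) y (c ^ k) c)
           (+-congˡ (*-congˡ (*-congˡ (*-congʳ (sym (P-scale i q x y))))))) ⟩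
    ∑△ n (λ i k → x * (e i * e k * (P i x y * c ^ k))
                + (c - y) * (e i * e k * (P i (q * x) (q * y) * c ^ k)))
      ≈⟨ ∑△-distrib-+ n _ _ ⟩
    ∑△ n (λ i k → x * (e i * e k * (P i x y * c ^ k)))
      + ∑△ n (λ i k → (c - y) * (e i * e k * (P i (q * x) (q * y) * c ^ k)))
      ≈⟨ +-cong (∑△-distribˡ-* n _ _) (∑△-distribˡ-* n _ _) ⟩
    x * S n x c y + (c - y) * S n (q * x) c (q * y) ∎

  -- The generating function (yz)_∞ / ((xz)_∞ (cz)_∞) is visibly symmetric in x and c. The induction
  -- hypothesis is also needed at `q * c` and `q * y`, so the variables stay quantified.
  S-symmetric : ∀ n x c y → S n x c y ≈ S n c x y
  S-symmetric zero    x c y = refl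
  S-symmetric (suc n) x c y = 1-qⁿ-cancel n (begin
    (1# - q ^ suc n) * S (suc n) x c y                 ≈⟨ S-suc n x c y ⟩
    c * S n x c y + (x - y) * S n x (q * c) (q * y)
      ≈⟨ +-cong (*-congˡ (S-symmetric n x c y)) (*-congˡ (S-symmetric n x (q * c) (q * y))) ⟩
    c * S n c x y + (x - y) * S n (q * c) x (q * y)    ≈⟨ S-suc′ n c x y ⟨
    (1# - q ^ suc n) * S (suc n) c x y                 ∎)

  private
    T : ℕ → ℕ → Carrier → Carrier → Carrier → Carrier
    T k p c x y = ∑△ k (λ j i → e j * e i * (P j c y * (x ^ i * S p c (q ^ j * x) (q ^ j * y))))

    -- A unit moves from k to p. The Pascal rule raises either j, which yields the factor c - qʲy
    -- and moves `S p` to qʲ⁺¹x and qʲ⁺¹y, or i, which yields x with weight qʲ. Together these are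
    -- the two summands of `S-suc` at (c, qʲx, qʲy).
    T-suc : ∀ k p c x y → (1# - q ^ suc k) * T (suc k) p c x y ≈ (1# - q ^ suc p) * T k (suc p) c x y
    T-suc k p c x y = begin
      (1# - q ^ suc k) * T (suc k) p c x y
        ≈⟨ pascalˡ k (λ j i → P j c y * (x ^ i * S p c (q ^ j * x) (q ^ j * y))) ⟩
      ∑△ k (λ j i → e j * e i * (P (suc j) c y * (x ^ i * S p c (q * q ^ j * x) (q * q ^ j * y))))
        + ∑△ k (λ j i → e j * e i * (q ^ j * (P j c y * (x * x ^ i * S p c (q ^ j * x) (q ^ j * y)))))
        ≈⟨ ∑△-distrib-+ k _ _ ⟨
      ∑△ k (λ j i → e j * e i * (P (suc j) c y * (x ^ i * S p c (q * q ^ j * x) (q * q ^ j * y)))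
        + e j * e i * (q ^ j * (P j c y * (x * x ^ i * S p c (q ^ j * x) (q ^ j * y)))))
        ≈⟨ ∑△-cong k (λ j i _ → step j i) ⟩
      ∑△ k (λ j i → (1# - q ^ suc p) *
                    (e j * e i * (P j c y * (x ^ i * S (suc p) c (q ^ j * x) (q ^ j * y)))))
        ≈⟨ ∑△-distribˡ-* k _ _ ⟩
      (1# - q ^ suc p) * T k (suc p) c x y ∎
      where
      step : ∀ j i →
        e j * e i * (P (suc j) c y * (x ^ i * S p c (q * q ^ j * x) (q * q ^ j * y)))
          + e j * e i * (q ^ j * (P j c y * (x * x ^ i * S p c (q ^ j * x) (q ^ j * y))))
        ≈ (1# - q ^ suc p) * (e j * e i * (P j c y * (x ^ i * S (suc p) c (q ^ j * x) (q ^ j * y))))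
      step j i = begin
        e j * e i * (P (suc j) c y * (x ^ i * S p c (q * q ^ j * x) (q * q ^ j * y)))
          + e j * e i * (q ^ j * (P j c y * (x * x ^ i * S₀)))
          ≈⟨ +-congʳ (*-congˡ (*-congˡ (*-congˡ (S-cong p refl (*-assoc _ _ _) (*-assoc _ _ _))))) ⟩
        e j * e i * (P (suc j) c y * (x ^ i * S₁)) + e j * e i * (q ^ j * (P j c y * (x * x ^ i * S₀)))
          ≈⟨ solve 9 (λ a p c u y v s x r →
               a :* (p :* (c :- u :* y) :* (v :* s)) :+ a :* (u :* (p :* (x :* v :* r)))
               := a :* (p :* (v :* (u :* x :* r :+ (c :- u :* y) :* s))))
               refl (e j * e i) (P j c y) c (q ^ j) y (x ^ i) S₁ x S₀ ⟩
        e j * e i * (P j c y * (x ^ i * (q ^ j * x * S₀ + (c - q ^ j * y) * S₁)))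
          ≈⟨ *-congˡ (*-congˡ (*-congˡ (S-suc p c (q ^ j * x) (q ^ j * y)))) ⟨
        e j * e i * (P j c y * (x ^ i * ((1# - q ^ suc p) * S (suc p) c (q ^ j * x) (q ^ j * y))))
          ≈⟨ solve 5 (λ a p v d s → a :* (p :* (v :* (d :* s))) := d :* (a :* (p :* (v :* s))))
               refl (e j * e i) (P j c y) (x ^ i) (1# - q ^ suc p) _ ⟩
        (1# - q ^ suc p) * (e j * e i * (P j c y * (x ^ i * S (suc p) c (q ^ j * x) (q ^ j * y)))) ∎
        where
        S₀ = S p c (q ^ j * x) (q ^ j * y)
        S₁ = S p c (q * (q ^ j * x)) (q * (q ^ j * y))

  -- The coefficient form of ∑ₚ h_{k+p}(x,y|q) tᵖ/(q;q)ₚ.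
  rogers : ∀ k p c x y →
    ∑△ k (λ j i → e j * e i * (P j c y * (x ^ i * S p c (q ^ j * x) (q ^ j * y))))
      ≈ e k * (e p * (Q (k ℕ.+ p) * S (k ℕ.+ p) c x y))
  rogers zero p c x y = begin
    e 0 * e 0 * (1# * (1# * S p c (1# * x) (1# * y)))
      ≈⟨ *-cong (*-cong e-zero e-zero)
           (*-congˡ (*-congˡ (S-cong p refl (*-identityˡ x) (*-identityˡ y)))) ⟩
    1# * 1# * (1# * (1# * S p c x y))
      ≈⟨ solve 1 (λ s → :1 :* :1 :* (:1 :* (:1 :* s)) := :1 :* (:1 :* s)) refl _ ⟩
    1# * (1# * S p c x y)
      ≈⟨ *-cong e-zero (*-congʳ (Q*e≈1 p)) ⟨
    e 0 * (Q p * e p * S p c x y)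
      ≈⟨ *-congˡ (solve 3 (λ a b s → a :* b :* s := b :* (a :* s)) refl _ _ _) ⟩
    e 0 * (e p * (Q p * S p c x y)) ∎
  rogers (suc k) p c x y = 1-qⁿ-cancel k (begin
    (1# - q ^ suc k) * T (suc k) p c x y
      ≈⟨ T-suc k p c x y ⟩
    (1# - q ^ suc p) * T k (suc p) c x y
      ≈⟨ *-congˡ (rogers k (suc p) c x y) ⟩
    (1# - q ^ suc p) * (e k * (e (suc p) * (Q (k ℕ.+ suc p) * S (k ℕ.+ suc p) c x y)))
      ≡⟨ ≡.cong (λ m → (1# - q ^ suc p) * (e k * (e (suc p) * (Q m * S m c x y)))) (ℕₚ.+-suc k p) ⟩
    (1# - q ^ suc p) * (e k * (e (suc p) * Z))
      ≈⟨ solve 4 (λ d a b z → d :* (a :* (b :* z)) := a :* (d :* b :* z)) refl _ _ _ _ ⟩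
    e k * ((1# - q ^ suc p) * e (suc p) * Z)
      ≈⟨ *-cong (sym (e-suc k)) (*-congʳ (e-suc p)) ⟩
    (1# - q ^ suc k) * e (suc k) * (e p * Z)
      ≈⟨ *-assoc _ _ _ ⟩
    (1# - q ^ suc k) * (e (suc k) * (e p * Z)) ∎)
    where Z = Q (suc (k ℕ.+ p)) * S (suc (k ℕ.+ p)) c x y

  bilinear : ∀ n c x y u v →
    ∑△ n (λ j r → e j * (P j c y * P j u v) *
      ∑△ r (λ i p → P i u (q ^ j * v) * x ^ i * e i * S p c (q ^ j * x) (q ^ j * y)))
      ≈ Q n * S n x c y * ∑△ n (λ k p → e k * e p * P k u v)
  bilinear n c x y u v = begin
    ∑△ n (λ j r → e j * (P j c y * P j u v) *
      ∑△ r (λ i p → P i u (q ^ j * v) * x ^ i * e i * S p c (q ^ j * x) (q ^ j * y)))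
      ≈⟨ ∑△-cong n (λ j r _ → ∑△-distribˡ-* r _ _) ⟨
    ∑△ n (λ j r → ∑△ r (λ i p → e j * (P j c y * P j u v) *
      (P i u (q ^ j * v) * x ^ i * e i * S p c (q ^ j * x) (q ^ j * y))))
      ≈⟨ ∑△-assoc n _ ⟩
    ∑△ n (λ k p → ∑△ k (λ j i → e j * (P j c y * P j u v) *
      (P i u (q ^ j * v) * x ^ i * e i * S p c (q ^ j * x) (q ^ j * y))))
      ≈⟨ ∑△-cong n (λ k p k+p≡n → inner k p k+p≡n) ⟩
    ∑△ n (λ k p → Q n * S n x c y * (e k * e p * P k u v))
      ≈⟨ ∑△-distribˡ-* n _ _ ⟩
    Q n * S n x c y * ∑△ n (λ k p → e k * e p * P k u v) ∎
    where
    inner : ∀ k p → k ℕ.+ p ≡ n →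
      ∑△ k (λ j i → e j * (P j c y * P j u v) *
        (P i u (q ^ j * v) * x ^ i * e i * S p c (q ^ j * x) (q ^ j * y)))
      ≈ Q n * S n x c y * (e k * e p * P k u v)
    inner k p ≡.refl = begin
      ∑△ k (λ j i → e j * (P j c y * P j u v) *
        (P i u (q ^ j * v) * x ^ i * e i * S p c (q ^ j * x) (q ^ j * y)))
        ≈⟨ ∑△-cong k (λ j i j+i≡k → trans
             (solve 7 (λ a b c d f g h → a :* (b :* c) :* (d :* f :* g :* h)
                                       := c :* d :* (a :* g :* (b :* (f :* h))))
               refl (e j) (P j c y) (P j u v) (P i u (q ^ j * v)) (x ^ i) (e i) _)
             (*-congʳ (trans (sym (P-+ j i u v)) (reflexive (≡.cong (λ m → P m u v) j+i≡k))))) ⟩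
      ∑△ k (λ j i → P k u v * (e j * e i * (P j c y * (x ^ i * S p c (q ^ j * x) (q ^ j * y)))))
        ≈⟨ ∑△-distribˡ-* k _ _ ⟩
      P k u v * T k p c x y
        ≈⟨ *-congˡ (rogers k p c x y) ⟩
      P k u v * (e k * (e p * (Q n * S n c x y)))
        -- In `rogers` the factors `P j c y` force `c` to come first, whereas the Rogers-Szegő
        -- polynomial in x and y needs `x` there.
        ≈⟨ *-congˡ (*-congˡ (*-congˡ (*-congˡ (S-symmetric n c x y)))) ⟩
      P k u v * (e k * (e p * (Q n * S n x c y)))
        ≈⟨ solve 5 (λ p a b Q s → p :* (a :* (b :* (Q :* s))) := Q :* s :* (a :* b :* p)) refl _ _ _ _ _ ⟩
      Q n * S n x c y * (e k * e p * P k u v) ∎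

-- Inequalities, null sequences and geometric majorants on the reals.

module RealOrder {c ℓ₁ ℓ₂ ℓ₃} (R : RealField c ℓ₁ ℓ₂ ℓ₃) where
  open RealField R
  open RealFieldProperties R
  private
    module < = IsStrictPartialOrder isStrictPartialOrder
    module CR = CommutativeRing commutativeRing
  open Exp CR.commutativeSemiring public using (_^_; ^-distrib-*; ^-homo-*)
  open IntegerRingSolver commutativeRing

  <-≤-trans : ∀ {x y z} → x < y → y ≤ z → x < z
  <-≤-trans {z = z} x<y y≤z with <-cotrans x<y z
  ... | inj₁ x<z = x<z
  ... | inj₂ z<y = contradiction z<y y≤z

  ≤-reflexive : ∀ {x y} → x ≈ y → x ≤ y
  ≤-reflexive x≈y y<x = <.irrefl (sym x≈y) y<x

  ≤-trans : ∀ {x y z} → x ≤ y → y ≤ z → x ≤ z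
  ≤-trans x≤y y≤z z<x = y≤z (<-≤-trans z<x x≤y)

  ≤-antisym : ∀ {x y} → x ≤ y → y ≤ x → x ≈ y
  ≤-antisym x≤y y≤x = proj₁ (tight _ _) λ x#y → case-# (#⇒<⊎> x#y)
    where
    case-# : ∀ {a} {A : Set a} → _ ⊎ _ → A
    case-# (inj₁ x<y) = contradiction x<y y≤x
    case-# (inj₂ y<x) = contradiction y<x x≤y

  <⇒≤ : ∀ {x y} → x < y → x ≤ y
  <⇒≤ = <.asym

  ≤-isPreorder : IsPreorder _≈_ _≤_
  ≤-isPreorder = record
    { isEquivalence = isEquivalence
    ; reflexive     = ≤-reflexive
    ; trans         = ≤-trans
    }

  module ≤-Reasoning = TripleReasoning ≤-isPreorder
    <.asym <.trans <.<-resp-≈ <.asym <-≤-trans ≤-<-trans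
  open ≤-Reasoning

  ≤⇒0≤- : ∀ {x y} → x ≤ y → 0# ≤ y - x
  ≤⇒0≤- {x} {y} x≤y y-x<0 = x≤y (diff-pos (<-respʳ
    (solve 2 (λ x y → :- (y :- x) := x :- y) refl x y) (neg-pos y-x<0)))

  0≤-⇒≤ : ∀ {x y} → 0# ≤ y - x → x ≤ y
  0≤-⇒≤ {x} {y} 0≤y-x y<x = 0≤y-x (<-respˡ
    (solve 2 (λ x y → y :+ :- x := y :- x) refl x y)
    (<-respʳ (-‿inverseʳ x) (+-monoˡ-< (- x) y<x)))

  -- As `≤` is a negation, a negative product is to be refuted. Such a product makes y apart from 0,
  -- hence positive, and then `nonNeg*pos` applies.
  nonNeg-* : ∀ {x y} → 0# ≤ x → 0# ≤ y → 0# ≤ x * y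
  nonNeg-* {x} {y} 0≤x 0≤y xy<0 = nonNeg*pos 0≤x
    (nonNeg∧#⇒pos 0≤y (*-#0⇒#0ˡ y x (#-congʳ (*-comm x y) (<⇒# xy<0)))) xy<0

  opaque
    -- The product being apart from 0, so is y, and its sign can be decided.
    pos-cancelˡ : ∀ {x y} → 0# ≤ x → 0# < x * y → 0# < y
    pos-cancelˡ {x} {y} 0≤x 0<xy
      with #⇒<⊎> (*-#0⇒#0ˡ y x (#-congʳ (*-comm x y) (pos⇒# 0<xy)))
    ... | inj₂ 0<y = 0<y
    ... | inj₁ y<0 = contradiction x*-y<0 (nonNeg-* 0≤x (pos⇒nonNeg (neg-pos y<0)))
      where
      x*-y<0 : x * - y < 0#
      x*-y<0 = <-respˡ (solve 2 (λ x y → :0 :- x :* y := x :* :- y) refl x y)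
        (<-respʳ (-‿inverseʳ (x * y)) (+-monoˡ-< (- (x * y)) 0<xy))

  +-mono-≤ : ∀ {x y z w} → x ≤ y → z ≤ w → x + z ≤ y + w
  +-mono-≤ {x} {y} {z} {w} x≤y z≤w = 0≤-⇒≤ (≤-trans
    (nonNeg+nonNeg (≤⇒0≤- x≤y) (≤⇒0≤- z≤w))
    (≤-reflexive (solve 4 (λ x y z w → y :- x :+ (w :- z) := y :+ w :- (x :+ z)) refl x y z w)))

  +-monoʳ-≤ : ∀ x {y z} → y ≤ z → x + y ≤ x + z
  +-monoʳ-≤ x = +-mono-≤ (≤-reflexive refl)

  +-monoˡ-≤ : ∀ x {y z} → y ≤ z → y + x ≤ z + x
  +-monoˡ-≤ x y≤z = +-mono-≤ y≤z (≤-reflexive refl)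

  +-mono-< : ∀ {x y z w} → x < y → z < w → x + z < y + w
  +-mono-< {x} {y} {z} {w} x<y z<w = <.trans (+-monoˡ-< z x<y)
    (<-respˡ (+-comm z y) (<-respʳ (+-comm w y) (+-monoˡ-< y z<w)))

  *-monoˡ-≤ : ∀ {x y z} → 0# ≤ x → y ≤ z → x * y ≤ x * z
  *-monoˡ-≤ {x} {y} {z} 0≤x y≤z = 0≤-⇒≤ (≤-trans
    (nonNeg-* 0≤x (≤⇒0≤- y≤z))
    (≤-reflexive (solve 3 (λ x y z → x :* (z :- y) := x :* z :- x :* y) refl x y z)))

  *-monoʳ-≤ : ∀ {x y z} → 0# ≤ x → y ≤ z → y * x ≤ z * x
  *-monoʳ-≤ {x} {y} {z} 0≤x y≤z = ≤-trans (≤-reflexive (*-comm y x))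
    (≤-trans (*-monoˡ-≤ 0≤x y≤z) (≤-reflexive (*-comm x z)))

  *-mono-≤ : ∀ {x y z w} → 0# ≤ x → 0# ≤ w → x ≤ y → z ≤ w → x * z ≤ y * w
  *-mono-≤ 0≤x 0≤w x≤y z≤w = ≤-trans (*-monoˡ-≤ 0≤x z≤w) (*-monoʳ-≤ 0≤w x≤y)

  *-monoˡ-< : ∀ {x y z} → 0# < x → y < z → x * y < x * z
  *-monoˡ-< {x} {y} {z} 0<x y<z = diff-pos (<-respʳ
    (solve 3 (λ x y z → x :* (z :- y) := x :* z :- x :* y) refl x y z)
    (*-pos 0<x (pos-diff y<z)))

  square-cancel-≤ : ∀ {x y} → 0# ≤ y → x * x ≤ y * y → x ≤ y
  square-cancel-≤ {x} {y} 0≤y xx≤yy y<x = xx≤yy (diff-pos (<-respʳ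
    (solve 2 (λ x y → (x :- y) :* (x :+ y) := x :* x :- y :* y) refl x y)
    (*-pos (pos-diff y<x) (pos+nonNeg (≤-<-trans 0≤y y<x) 0≤y))))

  square-cancel-≈ : ∀ {x y} → 0# ≤ x → 0# ≤ y → x * x ≈ y * y → x ≈ y
  square-cancel-≈ 0≤x 0≤y xx≈yy = ≤-antisym
    (square-cancel-≤ 0≤y (≤-reflexive xx≈yy)) (square-cancel-≤ 0≤x (≤-reflexive (sym xx≈yy)))

  opaque
    inverse : ∀ {x} → 0# < x → ∃ λ y → 0# < y × y * x ≈ 1#
    inverse {x} 0<x with #⇒invertible (pos⇒# 0<x)
    ... | y , y[x-0]≈1 , _ = y , pos-cancelˡ (pos⇒nonNeg 0<x) (<-respʳ (trans (sym yx≈1) (*-comm y x)) 0<1) , yx≈1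
      where
      yx≈1 : y * x ≈ 1#
      yx≈1 = trans (*-congˡ (sym (x-0≈x x))) y[x-0]≈1

  halve : (∃ λ h → 0# < h × h * (1# + 1#) ≈ 1#) → ∃ λ h → 0# < h × h + h ≈ 1#
  halve (h , 0<h , h*2≈1) =
    h , 0<h , trans (solve 1 (λ h → h :+ h := h :* (:1 :+ :1)) refl h) h*2≈1

  opaque
    half : ∃ λ h → 0# < h × h + h ≈ 1#
    half = halve (inverse (pos+nonNeg 0<1 (pos⇒nonNeg 0<1)))

  0≤1 : 0# ≤ 1#
  0≤1 = pos⇒nonNeg 0<1

  ^-nonNeg : ∀ {x} → 0# ≤ x → ∀ n → 0# ≤ x ^ n
  ^-nonNeg 0≤x zero    = 0≤1
  ^-nonNeg 0≤x (suc n) = nonNeg-* 0≤x (^-nonNeg 0≤x n)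

  ^-monoˡ-≤ : ∀ {x y} → 0# ≤ x → x ≤ y → ∀ n → x ^ n ≤ y ^ n
  ^-monoˡ-≤ 0≤x x≤y zero    = ≤-reflexive refl
  ^-monoˡ-≤ 0≤x x≤y (suc n) =
    *-mono-≤ 0≤x (^-nonNeg (≤-trans 0≤x x≤y) n) x≤y (^-monoˡ-≤ 0≤x x≤y n)

  ^≤1 : ∀ {x} → 0# ≤ x → x ≤ 1# → ∀ n → x ^ n ≤ 1#
  ^≤1 0≤x x≤1 zero    = ≤-reflexive refl
  ^≤1 0≤x x≤1 (suc n) = ≤-trans
    (*-mono-≤ 0≤x 0≤1 x≤1 (^≤1 0≤x x≤1 n)) (≤-reflexive (*-identityˡ 1#))

  x-nonNeg≤x : ∀ {x y} → 0# ≤ y → x - y ≤ x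
  x-nonNeg≤x {x} {y} 0≤y = 0≤-⇒≤ (≤-trans 0≤y (≤-reflexive
    (solve 2 (λ x y → y := x :- (x :- y)) refl x y)))

  0≤ℕ× : ∀ n → 0# ≤ n ℕ× 1#
  0≤ℕ× zero    = ≤-reflexive refl
  0≤ℕ× (suc n) = nonNeg+nonNeg 0≤1 (0≤ℕ× n)

  ℕ×-mono : ∀ {m n} → m ℕ.≤ n → m ℕ× 1# ≤ n ℕ× 1#
  ℕ×-mono {n = n} ℕ.z≤n = 0≤ℕ× n
  ℕ×-mono (ℕ.s≤s m≤n)   = +-monoʳ-≤ 1# (ℕ×-mono m≤n)

  -- One-sided, because it is applied to moduli and to their majorants.
  Null : (ℕ → Carrier) → Set (c ⊔ ℓ₃)
  Null r = ∀ ε → 0# < ε → ∃ λ N → ∀ n → N ℕ.≤ n → r n < ε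

  null-≤ : ∀ {r s} → (∀ n → r n ≤ s n) → Null s → Null r
  null-≤ r≤s null ε 0<ε with null ε 0<ε
  ... | N , s<ε = N , λ n N≤n → ≤-<-trans (r≤s n) (s<ε n N≤n)

  opaque
    null-+ : ∀ {r s} → Null r → Null s → Null (λ n → r n + s n)
    null-+ null₁ null₂ ε 0<ε with half
    ... | h , 0<h , h+h≈1 with null₁ (ε * h) (*-pos 0<ε 0<h) | null₂ (ε * h) (*-pos 0<ε 0<h)
    ...   | M , r< | N , s< = M ℕ.⊔ N , λ n M⊔N≤n → <-respʳ
        (trans (sym (CR.distribˡ ε h h)) (trans (*-congˡ h+h≈1) (*-identityʳ ε)))
        (+-mono-< (r< n (ℕₚ.≤-trans (ℕₚ.m≤m⊔n M N) M⊔N≤n)) (s< n (ℕₚ.≤-trans (ℕₚ.m≤n⊔m M N) M⊔N≤n)))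

  opaque
    null-*ˡ : ∀ {r} C → 0# ≤ C → (∀ n → 0# ≤ r n) → Null r → Null (λ n → C * r n)
    -- Whether `C` vanishes cannot be decided; `1# + C` is positive in either case and can be
    -- inverted.
    null-*ˡ {r} C 0≤C 0≤r null ε 0<ε with inverse (pos+nonNeg 0<1 0≤C)
    ... | i , 0<i , i*[1+C]≈1 with null (i * ε) (*-pos 0<i 0<ε)
    ...   | N , r< = N , λ n N≤n → begin-strict
        C * r n              ≤⟨ 0≤-⇒≤ (≤-trans (0≤r n) (≤-reflexive
                                  (solve 2 (λ C r → r := (:1 :+ C) :* r :- C :* r) refl C (r n)))) ⟩
        (1# + C) * r n       <⟨ *-monoˡ-< (pos+nonNeg 0<1 0≤C) (r< n N≤n) ⟩
        (1# + C) * (i * ε)   ≈⟨ solve 3 (λ C i ε → (:1 :+ C) :* (i :* ε) := i :* (:1 :+ C) :* ε) refl C i ε ⟩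
        i * (1# + C) * ε     ≈⟨ trans (*-congʳ i*[1+C]≈1) (*-identityˡ ε) ⟩
        ε                    ∎

  -- Ratios of geometric majorants.
  record Ratio : Set (c ⊔ ℓ₃) where
    field
      θ   : Carrier
      0≤θ : 0# ≤ θ
      θ<1 : θ < 1#

    0≤θ^ : ∀ n → 0# ≤ θ ^ n
    0≤θ^ = ^-nonNeg 0≤θ

    θ^≤1 : ∀ n → θ ^ n ≤ 1#
    θ^≤1 = ^≤1 0≤θ (<.asym θ<1)

    opaque
      -- 1 / (1 − θ)
      total : Carrier
      total = proj₁ (inverse (pos-diff θ<1))

      0≤total : 0# ≤ total
      0≤total = pos⇒nonNeg (proj₁ (proj₂ (inverse (pos-diff θ<1))))

      total*[1-θ]≈1 : total * (1# - θ) ≈ 1#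
      total*[1-θ]≈1 = proj₂ (proj₂ (inverse (pos-diff θ<1)))

    private
      n[1-θ]θ^n+θ^n≤1 : ∀ n → n ℕ× 1# * ((1# - θ) * θ ^ n) + θ ^ n ≤ 1#
      n[1-θ]θ^n+θ^n≤1 zero    = ≤-reflexive (solve 1 (λ a → :0 :* a :+ :1 := :1) refl _)
      n[1-θ]θ^n+θ^n≤1 (suc n) = begin
        (1# + n ℕ× 1#) * ((1# - θ) * (θ * θ ^ n)) + θ * θ ^ n
          ≈⟨ solve 3 (λ N t T → (:1 :+ N) :* ((:1 :- t) :* (t :* T)) :+ t :* T
                := t :* (N :* ((:1 :- t) :* T) :+ T) :+ (:1 :- t) :* (t :* T)) refl (n ℕ× 1#) θ (θ ^ n) ⟩
        θ * (n ℕ× 1# * ((1# - θ) * θ ^ n) + θ ^ n) + (1# - θ) * θ ^ suc n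
          ≤⟨ +-mono-≤ (*-monoˡ-≤ 0≤θ (n[1-θ]θ^n+θ^n≤1 n))
                      (*-monoˡ-≤ (pos⇒nonNeg (pos-diff θ<1)) (θ^≤1 (suc n))) ⟩
        θ * 1# + (1# - θ) * 1#
          ≈⟨ solve 1 (λ t → t :* :1 :+ (:1 :- t) :* :1 := :1) refl θ ⟩
        1# ∎

    -- Each of the n + 1 summands of 1 + θ + ... + θⁿ is at least θⁿ, and their sum (1 - θⁿ⁺¹)/(1 -
    -- θ) is at most 1/(1 - θ). This gives both the decay of θⁿ and the means of absorbing linear
    -- factors.
    [1+n]θ^n≤total : ∀ n → suc n ℕ× 1# * θ ^ n ≤ total
    [1+n]θ^n≤total n = begin
      (1# + n ℕ× 1#) * θ ^ n
        ≈⟨ *-identityˡ _ ⟨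
      1# * ((1# + n ℕ× 1#) * θ ^ n)
        ≈⟨ *-congʳ total*[1-θ]≈1 ⟨
      total * (1# - θ) * ((1# + n ℕ× 1#) * θ ^ n)
        ≈⟨ solve 4 (λ i t N T → i :* (:1 :- t) :* ((:1 :+ N) :* T)
             := i :* (N :* ((:1 :- t) :* T) :+ T :- t :* T)) refl total θ (n ℕ× 1#) (θ ^ n) ⟩
      total * (n ℕ× 1# * ((1# - θ) * θ ^ n) + θ ^ n - θ ^ suc n)
        ≤⟨ *-monoˡ-≤ 0≤total (≤-trans (0≤-⇒≤ (≤-trans (0≤θ^ (suc n)) (≤-reflexive
             (solve 2 (λ a t → t := a :- (a :- t)) refl _ _)))) (n[1-θ]θ^n+θ^n≤1 n)) ⟩
      total * 1#
        ≈⟨ *-identityʳ total ⟩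
      total ∎

    -- With s = θⁿ⁺¹, 1/(1 - s) = 1 + s/(1 - s) and s/(1 - s) ≤ θⁿ/(1 - θ). This brings the growth
    -- of 1/(q;q)ₙ into the form that `growthBound` handles.
    1≤[1-θ^]*[1+total*θ^] : ∀ n → 1# ≤ (1# - θ ^ suc n) * (1# + total * θ ^ n)
    1≤[1-θ^]*[1+total*θ^] n = 0≤-⇒≤ (≤-trans (nonNeg-* (0≤θ^ n) (nonNeg+nonNeg
        (<⇒≤ (pos-diff θ<1)) (nonNeg-* (nonNeg-* 0≤total 0≤θ) (≤⇒0≤- (θ^≤1 n)))))
      (≤-reflexive (trans
        (solve 3 (λ i t T → T :* (:1 :- t :+ i :* t :* (:1 :- T))
          := (:1 :- t :* T) :* (:1 :+ i :* T) :- :1 :+ T :* (:1 :- i :* (:1 :- t)))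
          refl total θ (θ ^ n))
        (trans (+-congˡ (trans (*-congˡ (trans (+-congˡ (-‿cong total*[1-θ]≈1)) (-‿inverseʳ 1#))) (CR.zeroʳ _)))
          (+-identityʳ _)))))

    opaque
      -- The Archimedean axiom gives N above total/ε; for n ≥ N then (n + 1)θⁿ ≤ total < Nε ≤ (n +
      -- 1)ε, and n + 1 is cancelled.
      null-θ^ : Null (θ ^_)
      null-θ^ ε 0<ε with inverse 0<ε
      ... | j , 0<j , j*ε≈1 with archimedean (total * j)
      ...   | N , tj<N = N , λ n N≤n → diff-pos (pos-cancelˡ (0≤ℕ× (suc n)) (<-respʳ
          (sym (CR.trans (CR.distribˡ _ _ _) (+-congˡ
            (solve 2 (λ a b → a :* :- b := :- (a :* b)) refl (suc n ℕ× 1#) (θ ^ n)))))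
          (pos-diff (begin-strict
            suc n ℕ× 1# * θ ^ n    ≤⟨ [1+n]θ^n≤total n ⟩
            total                  ≈⟨ *-identityʳ total ⟨
            total * 1#             ≈⟨ *-congˡ j*ε≈1 ⟨
            total * (j * ε)        ≈⟨ solve 3 (λ t j ε → t :* (j :* ε) := ε :* (t :* j)) refl total j ε ⟩
            ε * (total * j)        <⟨ *-monoˡ-< 0<ε tj<N ⟩
            ε * N ℕ× 1#            ≤⟨ *-monoˡ-≤ (pos⇒nonNeg 0<ε) (ℕ×-mono (ℕₚ.m≤n⇒m≤1+n N≤n)) ⟩
            ε * suc n ℕ× 1#        ≈⟨ *-comm _ _ ⟩
            suc n ℕ× 1# * ε        ∎))))

  opaque
    -- 1 − (1 − θ₁)(1 − θ₂)
    join : (ρ₁ ρ₂ : Ratio) → Σ Ratio λ ρ → Ratio.θ ρ₁ ≤ Ratio.θ ρ × Ratio.θ ρ₂ ≤ Ratio.θ ρ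
    join ρ₁ ρ₂ = record { θ = a + b - a * b ; 0≤θ = ≤-trans (Ratio.0≤θ ρ₁) a≤ ; θ<1 = <1 } , a≤ , b≤
      where
      a b : Carrier
      a = Ratio.θ ρ₁
      b = Ratio.θ ρ₂
      a≤ : a ≤ a + b - a * b
      a≤ = 0≤-⇒≤ (≤-trans (nonNeg-* (Ratio.0≤θ ρ₂) (pos⇒nonNeg (pos-diff (Ratio.θ<1 ρ₁))))
        (≤-reflexive (solve 2 (λ a b → b :* (:1 :- a) := a :+ b :- a :* b :- a) refl a b)))
      b≤ : b ≤ a + b - a * b
      b≤ = 0≤-⇒≤ (≤-trans (nonNeg-* (Ratio.0≤θ ρ₁) (pos⇒nonNeg (pos-diff (Ratio.θ<1 ρ₂))))
        (≤-reflexive (solve 2 (λ a b → a :* (:1 :- b) := a :+ b :- a :* b :- b) refl a b)))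
      <1 : a + b - a * b < 1#
      <1 = diff-pos (<-respʳ
        (solve 2 (λ a b → (:1 :- a) :* (:1 :- b) := :1 :- (a :+ b :- a :* b)) refl a b)
        (*-pos (pos-diff (Ratio.θ<1 ρ₁)) (pos-diff (Ratio.θ<1 ρ₂))))

  module _ {h} (0<h : 0# < h) (h+h≈1 : h + h ≈ 1#) where
    opaque
      half-<1 : ∀ {x} → x < 1# → h * (1# + x) < 1#
      half-<1 {x} x<1 = <-respʳ
        (trans (solve 1 (λ h → h :* (:1 :+ :1) := h :+ h) refl h) h+h≈1)
        (*-monoˡ-< 0<h (<-respˡ (+-comm x 1#) (+-monoˡ-< 1# x<1)))

      -- The inequality of the means of 1 and x.
      ≤half² : ∀ x → x ≤ h * (1# + x) * (h * (1# + x))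
      ≤half² x = 0≤-⇒≤ (≤-trans (square-nonNeg (h * (1# - x))) (≤-reflexive (trans
        (solve 2 (λ h t → (h :* (:1 :- t)) :* (h :* (:1 :- t))
           := h :* (:1 :+ t) :* (h :* (:1 :+ t)) :- (h :+ h) :* ((h :+ h) :* t)) refl h x)
        (+-congˡ (-‿cong (trans (*-cong h+h≈1 (*-congʳ h+h≈1)) (trans (*-identityˡ _) (*-identityˡ x))))))))

    midpoint : Ratio → Ratio
    midpoint ρ = record
      { θ   = h * (1# + Ratio.θ ρ)
      ; 0≤θ = nonNeg-* (pos⇒nonNeg 0<h) (nonNeg+nonNeg 0≤1 (Ratio.0≤θ ρ))
      ; θ<1 = half-<1 (Ratio.θ<1 ρ)
      }

  opaque
    -- The arithmetic mean of 1 and θ stands in for a square root of θ and is evidently below 1.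
    squeeze : (ρ : Ratio) → ∃ λ ρ⁺ → Ratio.θ ρ ≤ Ratio.θ ρ⁺ * Ratio.θ ρ⁺
    squeeze ρ = midpoint (proj₁ (proj₂ half)) (proj₂ (proj₂ half)) ρ
              , ≤half² (proj₁ (proj₂ half)) (proj₂ (proj₂ half)) (Ratio.θ ρ)

  -- Pays for the n + 1 terms of a diagonal. With θ ≤ ϑ², one factor ϑⁿ absorbs n + 1 and the other
  -- remains as the new majorant.
  record Widening (ρ : Ratio) : Set (c ⊔ ℓ₃) where
    field
      ratio : Ratio
      θ≤θ⁺  : Ratio.θ ρ ≤ Ratio.θ ratio
      M     : Carrier
      0≤M   : 0# ≤ M
      bound : ∀ n → suc n ℕ× 1# * Ratio.θ ρ ^ n ≤ M * Ratio.θ ratio ^ n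

    θ^≤θ⁺^ : ∀ n → Ratio.θ ρ ^ n ≤ Ratio.θ ratio ^ n
    θ^≤θ⁺^ = ^-monoˡ-≤ (Ratio.0≤θ ρ) θ≤θ⁺

  opaque
    widen : ∀ ρ → Widening ρ
    widen ρ with squeeze ρ
    ... | ρ⁺ , θ≤ϑ² = record { ratio = ρ⁺ ; θ≤θ⁺ = θ≤ϑ ; M = total ; 0≤M = 0≤total ; bound = bound }
      where
      open Ratio ρ⁺ renaming (θ to ϑ)
      θ≤ϑ : Ratio.θ ρ ≤ ϑ
      θ≤ϑ = begin
        Ratio.θ ρ    ≤⟨ θ≤ϑ² ⟩
        ϑ * ϑ        ≤⟨ *-monoˡ-≤ 0≤θ (<⇒≤ θ<1) ⟩
        ϑ * 1#       ≈⟨ *-identityʳ ϑ ⟩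
        ϑ            ∎
      bound : ∀ n → suc n ℕ× 1# * Ratio.θ ρ ^ n ≤ total * ϑ ^ n
      bound n = begin
        suc n ℕ× 1# * Ratio.θ ρ ^ n
          ≤⟨ *-monoˡ-≤ (0≤ℕ× (suc n)) (^-monoˡ-≤ (Ratio.0≤θ ρ) θ≤ϑ² n) ⟩
        suc n ℕ× 1# * (ϑ * ϑ) ^ n
          ≈⟨ trans (*-congˡ (^-distrib-* ϑ ϑ n)) (sym (*-assoc _ _ _)) ⟩
        suc n ℕ× 1# * ϑ ^ n * ϑ ^ n
          ≤⟨ *-monoʳ-≤ (0≤θ^ n) ([1+n]θ^n≤total n) ⟩
        total * ϑ ^ n ∎

  -- Boundedness of products of factors 1 + Cθⁿ.

  module _ (ρ : Ratio) where
    open Ratio ρ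

    -- B bounds all partial products of ∏ (1 + Cθⁿ). It is phrased for every sequence with this
    -- growth, so that the same B may be applied to a shifted sequence.
    GrowthBound : Carrier → Set (c ⊔ ℓ₃)
    GrowthBound C = ∃ λ B → 1# ≤ B × ∀ (b : ℕ → Carrier) → 0# ≤ b 0 →
      (∀ n → b (suc n) ≤ b n * (1# + C * θ ^ n)) → ∀ n → b n ≤ B * b 0

    private
      -- 1 − C θⁿ/(1−θ) increases fast enough to absorb the factor 1 + C θⁿ.
      small : ∀ C → 0# ≤ C → (1# + 1#) * (C * total) ≤ 1# → GrowthBound C
      small C 0≤C 2Ci≤1 = 1# + 1# , ≤-trans (≤-reflexive (sym (+-identityʳ 1#))) (+-monoʳ-≤ 1# 0≤1) , go
        where
        m : ℕ → Carrier
        m n = 1# - C * total * θ ^ n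
        m-suc : ∀ n → m n * (1# + C * θ ^ n) ≤ m (suc n)
        m-suc n = 0≤-⇒≤ (≤-trans
          (nonNeg-* (nonNeg-* 0≤C (nonNeg-* 0≤total (0≤θ^ n))) (nonNeg-* 0≤C (0≤θ^ n)))
          (≤-reflexive (trans
            (solve 4 (λ C i t T → C :* (i :* T) :* (C :* T)
               := (:1 :- C :* i :* (t :* T)) :- (:1 :- C :* i :* T) :* (:1 :+ C :* T)
                  :+ C :* T :* (:1 :- i :* (:1 :- t))) refl C total θ (θ ^ n))
            (trans (+-congˡ (*-congˡ (trans (+-congˡ (-‿cong total*[1-θ]≈1)) (-‿inverseʳ 1#))))
              (trans (+-congˡ (CR.zeroʳ _)) (+-identityʳ _))))))
        go : ∀ b → 0# ≤ b 0 → (∀ n → b (suc n) ≤ b n * (1# + C * θ ^ n)) → ∀ n → b n ≤ (1# + 1#) * b 0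
        go b 0≤b₀ b-suc n = ≤-trans (b≤ n) (≤-trans
          (*-monoˡ-≤ 0≤2b₀ (0≤-⇒≤ (≤-trans (nonNeg-* (nonNeg-* 0≤C 0≤total) (0≤θ^ n))
            (≤-reflexive (solve 1 (λ a → a := :1 :- (:1 :- a)) refl _)))))
          (≤-reflexive (*-identityʳ _)))
          where
          0≤2b₀ : 0# ≤ (1# + 1#) * b 0
          0≤2b₀ = nonNeg-* (nonNeg+nonNeg 0≤1 0≤1) 0≤b₀
          -- The constant 2 is right at the start, since 2C/(1 - θ) ≤ 1 makes `m 0` at least one
          -- half; at the end m n ≤ 1 is dropped.
          b≤ : ∀ n → b n ≤ (1# + 1#) * b 0 * m n
          b≤ zero    = begin
            b 0
              ≈⟨ solve 2 (λ b a → b := b :* ((:1 :+ :1) :- :1)) refl (b 0) 1# ⟩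
            b 0 * ((1# + 1#) - 1#)
              ≤⟨ *-monoˡ-≤ 0≤b₀ (+-monoʳ-≤ (1# + 1#) (0≤-⇒≤ (≤-trans (≤⇒0≤- 2Ci≤1)
                   (≤-reflexive (solve 1 (λ a → :1 :- a := :- a :- :- :1) refl _))))) ⟩
            b 0 * ((1# + 1#) - (1# + 1#) * (C * total))
              ≈⟨ solve 3 (λ b C i → b :* ((:1 :+ :1) :- (:1 :+ :1) :* (C :* i))
                   := (:1 :+ :1) :* b :* (:1 :- C :* i :* :1)) refl (b 0) C total ⟩
            (1# + 1#) * b 0 * (1# - C * total * 1#) ∎
          b≤ (suc n) = begin
            b (suc n)                                    ≤⟨ b-suc n ⟩
            b n * (1# + C * θ ^ n)
              ≤⟨ *-monoʳ-≤ (nonNeg+nonNeg 0≤1 (nonNeg-* 0≤C (0≤θ^ n))) (b≤ n) ⟩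
            (1# + 1#) * b 0 * m n * (1# + C * θ ^ n)     ≈⟨ *-assoc _ _ _ ⟩
            (1# + 1#) * b 0 * (m n * (1# + C * θ ^ n))   ≤⟨ *-monoˡ-≤ 0≤2b₀ (m-suc n) ⟩
            (1# + 1#) * b 0 * m (suc n)                  ∎

      unshift : ∀ C → 0# ≤ C → GrowthBound (C * θ) → GrowthBound C
      unshift C 0≤C (B , 1≤B , bound) = B * (1# + C) , 1≤B[1+C] , go
        where
        1≤1+C : 1# ≤ 1# + C
        1≤1+C = x≤x+nonNeg 0≤C
        1≤B[1+C] : 1# ≤ B * (1# + C)
        1≤B[1+C] = ≤-trans (≤-reflexive (sym (*-identityˡ 1#)))
          (*-mono-≤ 0≤1 (≤-trans 0≤1 1≤1+C) 1≤B 1≤1+C)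
        go : ∀ b → 0# ≤ b 0 → (∀ n → b (suc n) ≤ b n * (1# + C * θ ^ n)) → ∀ n → b n ≤ B * (1# + C) * b 0
        go b 0≤b₀ b-suc zero    =
          ≤-trans (≤-reflexive (sym (*-identityˡ _))) (*-monoʳ-≤ 0≤b₀ 1≤B[1+C])
        go b 0≤b₀ b-suc (suc n) = begin
          b (suc n)                           ≤⟨ ≤-b₁ ⟩
          B * b₁
            ≈⟨ solve 3 (λ B b C → B :* (b :* (:1 :+ C :* :1)) := B :* (:1 :+ C) :* b) refl B (b 0) C ⟩
          B * (1# + C) * b 0                  ∎
          where
          b₁ = b 0 * (1# + C * θ ^ 0)
          -- The shifted sequence starts at the upper bound `b₁` of `b 1`, because nothing
          -- guarantees that `b 1` itself is nonnegative.
          b′ : ℕ → Carrier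
          b′ zero    = b₁
          b′ (suc n) = b (suc (suc n))
          shifted : ∀ n → b (suc (suc n)) ≤ b (suc n) * (1# + C * θ * θ ^ n)
          shifted n = ≤-trans (b-suc (suc n)) (≤-reflexive (*-congˡ (+-congˡ (sym (*-assoc _ _ _)))))
          0≤b₁ : 0# ≤ b₁
          0≤b₁ = nonNeg-* 0≤b₀ (nonNeg+nonNeg 0≤1 (nonNeg-* 0≤C 0≤1))
          b′-suc : ∀ n → b′ (suc n) ≤ b′ n * (1# + C * θ * θ ^ n)
          b′-suc zero    = ≤-trans (shifted 0)
            (*-monoʳ-≤ (nonNeg+nonNeg 0≤1 (nonNeg-* (nonNeg-* 0≤C 0≤θ) 0≤1)) (b-suc 0))
          b′-suc (suc n) = shifted (suc n)
          ≤b′ : ∀ n → b (suc n) ≤ b′ n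
          ≤b′ zero    = b-suc 0
          ≤b′ (suc n) = ≤-reflexive refl
          ≤-b₁ : b (suc n) ≤ B * b₁
          ≤-b₁ = ≤-trans (≤b′ n) (bound b′ 0≤b₁ b′-suc n)

    opaque
      -- Splitting off the first N factors replaces C by CθᴺN-fold shifted, that is by Cθᴺ, and N is
      -- taken so large that `small` applies to this constant.
      growthBound : ∀ C → 0# ≤ C → GrowthBound C
      growthBound C 0≤C with null-*ˡ ((1# + 1#) * (C * total))
          (nonNeg-* (nonNeg+nonNeg 0≤1 0≤1) (nonNeg-* 0≤C 0≤total)) 0≤θ^ null-θ^ 1# 0<1
      ... | N , small-N = shifts N C 0≤C (<.asym (small-N N ℕₚ.≤-refl))
        where
        shifts : ∀ N C → 0# ≤ C → (1# + 1#) * (C * total) * θ ^ N ≤ 1# → GrowthBound C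
        shifts zero    C 0≤C 2Ci≤1 = small C 0≤C (≤-trans (≤-reflexive (sym (*-identityʳ _))) 2Ci≤1)
        shifts (suc N) C 0≤C 2Ci≤1 = unshift C 0≤C (shifts N (C * θ) (nonNeg-* 0≤C 0≤θ) (≤-trans
          (≤-reflexive (solve 5 (λ a C i t T → a :* (C :* t :* i) :* T := a :* (C :* i) :* (t :* T))
            refl _ _ _ _ _)) 2Ci≤1))

module Real {c ℓ₁ ℓ₂ ℓ₃ : Level} (R : RealField c ℓ₁ ℓ₂ ℓ₃) where
  open RealField R public
  open RealFieldProperties R public
  open RealOrder R public
  open IntegerRingSolver commutativeRing public

-- The q-series argument needs only a multiplicative modulus and completeness. Working over this
-- interface keeps real and imaginary parts out of all algebraic identities.
record CompleteValuedField {c ℓ₁ ℓ₂ ℓ₃} (R : RealField c ℓ₁ ℓ₂ ℓ₃) k ℓ :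
       Set (c ⊔ ℓ₁ ⊔ ℓ₂ ⊔ ℓ₃ ⊔ lsuc (k ⊔ ℓ)) where
  private module ℝ = Real R
  open ℝ using (_<_; _≤_)
  field
    commutativeRing : CommutativeRing k ℓ
  open CommutativeRing commutativeRing public
  field
    ∣_∣          : Carrier → ℝ.Carrier
    ∣∣-cong      : ∀ {x y} → x ≈ y → ∣ x ∣ ℝ.≈ ∣ y ∣
    0≤∣_∣        : ∀ x → ℝ.0# ≤ ∣ x ∣
    ∣x∣≤0⇒x≈0    : ∀ {x} → ∣ x ∣ ≤ ℝ.0# → x ≈ 0#
    ∣0∣≈0        : ∣ 0# ∣ ℝ.≈ ℝ.0#
    ∣1∣≈1        : ∣ 1# ∣ ℝ.≈ ℝ.1#
    ∣-_∣         : ∀ x → ∣ - x ∣ ℝ.≈ ∣ x ∣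
    ∣∣-*         : ∀ x y → ∣ x * y ∣ ℝ.≈ ∣ x ∣ ℝ.* ∣ y ∣
    ∣∣-+         : ∀ x y → ∣ x + y ∣ ≤ ∣ x ∣ ℝ.+ ∣ y ∣
    invertible   : ∀ {x} → ℝ.0# < ∣ x ∣ → ∃ λ y → y * x ≈ 1#

  infix 4 _⟶_
  _⟶_ : (ℕ → Carrier) → Carrier → Set (c ⊔ ℓ₃)
  s ⟶ l = ∀ ε → ℝ.0# < ε → ∃ λ N → ∀ n → N ℕ.≤ n → ∣ s n - l ∣ < ε

  field
    complete     : ∀ s →
      (∀ ε → ℝ.0# < ε → ∃ λ N → ∀ m n → N ℕ.≤ m → N ℕ.≤ n → ∣ s m - s n ∣ < ε) → ∃ (s ⟶_)

-- Limits, series and double series with geometric majorants.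

module Convergence {c ℓ₁ ℓ₂ ℓ₃ k ℓ} {R : RealField c ℓ₁ ℓ₂ ℓ₃}
                   (V : CompleteValuedField R k ℓ) where
  open CompleteValuedField V
  open IntegerRingSolver commutativeRing
  open Sums commutativeRing
  open Exp commutativeSemiring using (_^_)
  private module ℝ = Real R
  open ℝ using (_<_; _≤_; Null; Ratio; ≤-trans; ≤-reflexive; _ℕ×_; Widening)
  open ℝ.≤-Reasoning

  ∣∣-swap : ∀ x y → ∣ x - y ∣ ℝ.≈ ∣ y - x ∣
  ∣∣-swap x y = ℝ.trans (∣∣-cong (solve 2 (λ x y → x :- y := :- (y :- x)) refl x y)) (∣- (y - x) ∣)

  ∣∣-triangle : ∀ x y z → ∣ x - z ∣ ≤ ∣ x - y ∣ ℝ.+ ∣ y - z ∣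
  ∣∣-triangle x y z = ≤-trans (≤-reflexive (∣∣-cong
    (solve 3 (λ x y z → x :- z := x :- y :+ (y :- z)) refl x y z))) (∣∣-+ _ _)

  ∣x-y∣≤ : ∀ {x y B} → x ≈ y → ℝ.0# ≤ B → ∣ x - y ∣ ≤ B
  ∣x-y∣≤ {x} {y} x≈y 0≤B = ≤-trans (≤-reflexive (ℝ.trans
    (∣∣-cong (trans (+-congʳ x≈y) (-‿inverseʳ y))) ∣0∣≈0)) 0≤B

  open AbelianGroupProperties +-abelianGroup using (ε⁻¹≈ε)

  x-0≈x : ∀ x → x - 0# ≈ x
  x-0≈x x = trans (+-congˡ ε⁻¹≈ε) (+-identityʳ x)

  ∣∣^ : ∀ x n → ∣ x ^ n ∣ ℝ.≈ ∣ x ∣ ℝ.^ n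
  ∣∣^ x zero    = ∣1∣≈1
  ∣∣^ x (suc n) = ℝ.trans (∣∣-* x (x ^ n)) (ℝ.*-congˡ (∣∣^ x n))

  ⟶-null : ∀ {s l r} → (∀ n → ∣ s n - l ∣ ≤ r n) → Null r → s ⟶ l
  ⟶-null = ℝ.null-≤

  ⟶-cong : ∀ {s s′ l l′} → (∀ n → s n ≈ s′ n) → l ≈ l′ → s ⟶ l → s′ ⟶ l′
  ⟶-cong s≈ l≈ = ℝ.null-≤ (λ n → ≤-reflexive (∣∣-cong (+-cong (sym (s≈ n)) (-‿cong (sym l≈)))))

  ⟶-unique : ∀ {s l l′} → s ⟶ l → s ⟶ l′ → l ≈ l′
  ⟶-unique {s} {l} {l′} s⟶l s⟶l′ = trans
    (solve 2 (λ l m → l := l :- m :+ m) refl l l′)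
    (trans (+-congʳ (∣x∣≤0⇒x≈0 (λ 0<∣l-l′∣ → let N , ∣l-l′∣<∣l-l′∣ = bound _ 0<∣l-l′∣ in
      ≤-reflexive ℝ.refl (∣l-l′∣<∣l-l′∣ N ℕₚ.≤-refl)))) (+-identityˡ l′))
    where
    bound : Null (λ _ → ∣ l - l′ ∣)
    bound = ℝ.null-≤ (λ n → ≤-trans (∣∣-triangle l (s n) l′)
      (ℝ.+-monoˡ-≤ _ (≤-reflexive (∣∣-swap l (s n))))) (ℝ.null-+ s⟶l s⟶l′)

  opaque
    ⟶-≤ : ∀ {s l z B} N → s ⟶ l → (∀ n → N ℕ.≤ n → ∣ s n - z ∣ ≤ B) → ∣ l - z ∣ ≤ B
    ⟶-≤ {s} {l} {z} {B} N s⟶l s≤ B<∣l-z∣ with s⟶l (∣ l - z ∣ ℝ.- B) (ℝ.pos-diff B<∣l-z∣)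
    ... | M , close = ≤-reflexive ℝ.refl (begin-strict
      ∣ l - z ∣                              ≤⟨ ∣∣-triangle l (s n) z ⟩
      ∣ l - s n ∣ ℝ.+ ∣ s n - z ∣            ≤⟨ ℝ.+-monoʳ-≤ _ (s≤ n (ℕₚ.m≤m⊔n N M)) ⟩
      ∣ l - s n ∣ ℝ.+ B                      ≈⟨ ℝ.+-congʳ (∣∣-swap l (s n)) ⟩
      ∣ s n - l ∣ ℝ.+ B                      <⟨ ℝ.+-monoˡ-< B (close n (ℕₚ.m≤n⊔m N M)) ⟩
      ∣ l - z ∣ ℝ.- B ℝ.+ B                  ≈⟨ ℝ.solve 2 (λ a b → a ℝ.:- b ℝ.:+ b ℝ.:= a) ℝ.refl _ B ⟩
      ∣ l - z ∣                              ∎)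
      where
      n : ℕ
      n = N ℕ.⊔ M

  ⟶-const : ∀ l → (λ _ → l) ⟶ l
  ⟶-const l ε 0<ε = 0 , λ n _ → ℝ.≤-<-trans (∣x-y∣≤ refl (≤-reflexive ℝ.refl)) 0<ε

  ⟶-+ : ∀ {s s′ l l′} → s ⟶ l → s′ ⟶ l′ → (λ n → s n + s′ n) ⟶ l + l′
  ⟶-+ {s} {s′} {l} {l′} s⟶l s′⟶l′ = ⟶-null (λ n → ≤-trans
    (≤-reflexive (∣∣-cong (solve 4 (λ a b c d → a :+ b :- (c :+ d) := a :- c :+ (b :- d))
      refl (s n) (s′ n) l l′)))
    (∣∣-+ _ _)) (ℝ.null-+ s⟶l s′⟶l′)

  ⟶-*ˡ : ∀ {s l} a → s ⟶ l → (λ n → a * s n) ⟶ a * l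
  ⟶-*ˡ {s} {l} a s⟶l = ⟶-null (λ n → ≤-reflexive (ℝ.trans
    (∣∣-cong (solve 3 (λ a b c → a :* b :- a :* c := a :* (b :- c)) refl a (s n) l))
    (∣∣-* _ _))) (ℝ.null-*ˡ ∣ a ∣ (0≤∣ a ∣) (λ n → 0≤∣ s n - l ∣) s⟶l)

  ⟶-shift : ∀ {s l} k → s ⟶ l → (λ n → s (k ℕ.+ n)) ⟶ l
  ⟶-shift k s⟶l ε 0<ε with s⟶l ε 0<ε
  ... | N , close = N , λ n N≤n → close (k ℕ.+ n) (ℕₚ.m≤n⇒m≤o+n k N≤n)

  HasSum : (ℕ → Carrier) → Carrier → Set (c ⊔ ℓ₃)
  HasSum f s = (λ n → ∑< n f) ⟶ s

  hasSum-cong : ∀ {f g s} → (∀ n → f n ≈ g n) → HasSum f s → HasSum g s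
  hasSum-cong f≈g = ⟶-cong (λ n → ∑<-cong n f≈g) refl

  hasSum-*ˡ : ∀ {f s} a → HasSum f s → HasSum (λ n → a * f n) (a * s)
  hasSum-*ˡ {f} a f-sum = ⟶-cong (λ n → sym (∑<-distribˡ-* n a f)) refl (⟶-*ˡ a f-sum)

  ∣∑△∣≤ : ∀ n {f B} → (∀ i k → i ℕ.+ k ≡ n → ∣ f i k ∣ ≤ B) → ∣ ∑△ n f ∣ ≤ suc n ℕ× ℝ.1# ℝ.* B
  ∣∑△∣≤ zero    {B = B} f≤ = ≤-trans (f≤ 0 0 ≡.refl)
    (≤-reflexive (ℝ.solve 1 (λ B → B ℝ.:= (ℝ.:1 ℝ.:+ ℝ.:0) ℝ.:* B) ℝ.refl B))
  ∣∑△∣≤ (suc n) {B = B} f≤ = ≤-trans (∣∣-+ _ _) (≤-trans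
    (ℝ.+-mono-≤ (f≤ 0 (suc n) ≡.refl) (∣∑△∣≤ n (λ i k i+k≡n → f≤ (suc i) k (≡.cong suc i+k≡n))))
    (≤-reflexive (ℝ.solve 2 (λ N B → B ℝ.:+ N ℝ.:* B ℝ.:= (ℝ.:1 ℝ.:+ N) ℝ.:* B) ℝ.refl _ B)))

  -- Taking row 0 out of the triangle i + k ≤ n leaves the next smaller triangle of the shifted
  -- rows.
  ∑<-∑△-suc : ∀ n f → ∑< (suc n) (λ m → ∑△ m f)
                     ≈ ∑< (suc n) (f 0) + ∑< n (λ m → ∑△ m (λ i → f (suc i)))
  ∑<-∑△-suc zero    f = sym (+-identityʳ _)
  ∑<-∑△-suc (suc n) f = trans (+-congʳ (∑<-∑△-suc n f))
    (solve 4 (λ a b c d → a :+ b :+ (c :+ d) := a :+ c :+ (b :+ d)) refl _ _ _ _)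

  module GeometricSteps (ρ : Ratio) (C : ℝ.Carrier) (s : ℕ → Carrier) (0≤C : ℝ.0# ≤ C)
    (step : ∀ n → ∣ s (suc n) - s n ∣ ≤ C ℝ.* Ratio.θ ρ ℝ.^ n) where
    open Ratio ρ

    0≤C*total : ℝ.0# ≤ C ℝ.* total
    0≤C*total = ℝ.nonNeg-* 0≤C 0≤total

    opaque
      extend : ∀ a b → C ℝ.* a ℝ.+ C ℝ.* total ℝ.* (b ℝ.- a) ℝ.≈ C ℝ.* total ℝ.* (b ℝ.- θ ℝ.* a)
      extend a b = ℝ.trans
        (ℝ.+-congʳ (ℝ.trans (ℝ.sym (ℝ.*-identityˡ _)) (ℝ.*-congʳ (ℝ.sym total*[1-θ]≈1))))
        (ℝ.solve 5 (λ i t C T U → i ℝ.:* (ℝ.:1 ℝ.:- t) ℝ.:* (C ℝ.:* T) ℝ.:+ C ℝ.:* i ℝ.:* (U ℝ.:- T)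
               ℝ.:= C ℝ.:* i ℝ.:* (U ℝ.:- t ℝ.:* T)) ℝ.refl total θ C a b)

    opaque
      -- The bound is the exact value of the finite geometric sum of the step bounds, so the
      -- induction closes with an equality; its negative part is discarded only in `far`.
      near : ∀ n k → ∣ s (k ℕ.+ n) - s n ∣ ≤ C ℝ.* total ℝ.* (θ ℝ.^ n ℝ.- θ ℝ.^ (k ℕ.+ n))
      near n zero    = ∣x-y∣≤ refl (≤-reflexive (ℝ.sym
        (ℝ.trans (ℝ.*-congˡ (ℝ.-‿inverseʳ (θ ℝ.^ n))) (CommutativeRing.zeroʳ ℝ.commutativeRing _))))
      near n (suc k) = begin
        ∣ s (suc (k ℕ.+ n)) - s n ∣
          ≤⟨ ∣∣-triangle _ (s (k ℕ.+ n)) _ ⟩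
        ∣ s (suc (k ℕ.+ n)) - s (k ℕ.+ n) ∣ ℝ.+ ∣ s (k ℕ.+ n) - s n ∣
          ≤⟨ ℝ.+-mono-≤ (step (k ℕ.+ n)) (near n k) ⟩
        C ℝ.* θ ℝ.^ (k ℕ.+ n) ℝ.+ C ℝ.* total ℝ.* (θ ℝ.^ n ℝ.- θ ℝ.^ (k ℕ.+ n))
          ≈⟨ extend (θ ℝ.^ (k ℕ.+ n)) (θ ℝ.^ n) ⟩
        C ℝ.* total ℝ.* (θ ℝ.^ n ℝ.- θ ℝ.^ (suc k ℕ.+ n)) ∎

    opaque
      far : ∀ n m → n ℕ.≤ m → ∣ s m - s n ∣ ≤ C ℝ.* total ℝ.* θ ℝ.^ n
      far n m n≤m = begin
        ∣ s m - s n ∣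
          ≡⟨ ≡.cong (λ j → ∣ s j - s n ∣) (ℕₚ.m∸n+n≡m n≤m) ⟨
        ∣ s (m ℕ.∸ n ℕ.+ n) - s n ∣
          ≤⟨ near n (m ℕ.∸ n) ⟩
        C ℝ.* total ℝ.* (θ ℝ.^ n ℝ.- θ ℝ.^ (m ℕ.∸ n ℕ.+ n))
          ≤⟨ ℝ.*-monoˡ-≤ 0≤C*total (ℝ.x-nonNeg≤x (0≤θ^ (m ℕ.∸ n ℕ.+ n))) ⟩
        C ℝ.* total ℝ.* θ ℝ.^ n ∎

    opaque
      tail-null : Null (λ n → C ℝ.* total ℝ.* θ ℝ.^ n)
      tail-null = ℝ.null-*ˡ _ 0≤C*total 0≤θ^ null-θ^

    opaque
      limit : ∃ (s ⟶_)
      limit = complete s λ ε 0<ε → cauchy (ℝ.null-+ tail-null tail-null ε 0<ε)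
        where
        cauchy : ∀ {ε} →
          (∃ λ N → ∀ n → N ℕ.≤ n → C ℝ.* total ℝ.* θ ℝ.^ n ℝ.+ C ℝ.* total ℝ.* θ ℝ.^ n < ε) →
          ∃ λ N → ∀ m n → N ℕ.≤ m → N ℕ.≤ n → ∣ s m - s n ∣ < ε
        cauchy (N , tail<ε) = N , λ m n N≤m N≤n → ℝ.≤-<-trans (≤-trans (∣∣-triangle (s m) (s N) (s n))
          (ℝ.+-mono-≤ (far N m N≤m) (≤-trans (≤-reflexive (∣∣-swap (s N) (s n))) (far N n N≤n))))
          (tail<ε N ℕₚ.≤-refl)

  module _ (ρ : Ratio) where
    open Ratio ρ

    opaque
      geometric-⟶ : ∀ C s → ℝ.0# ≤ C → (∀ n → ∣ s (suc n) - s n ∣ ≤ C ℝ.* θ ℝ.^ n) →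
        ∃ λ l → s ⟶ l × ∀ n → ∣ l - s n ∣ ≤ C ℝ.* total ℝ.* θ ℝ.^ n
      geometric-⟶ C s 0≤C step = proj₁ limit , proj₂ limit , λ n → ⟶-≤ n (proj₂ limit) (far n)
        where open GeometricSteps ρ C s 0≤C step

    opaque
      geometric-HasSum : ∀ C f → ℝ.0# ≤ C → (∀ n → ∣ f n ∣ ≤ C ℝ.* θ ℝ.^ n) → ∃ (HasSum f)
      geometric-HasSum C f 0≤C f≤ with geometric-⟶ C (λ n → ∑< n f) 0≤C (λ n → ≤-trans
        (≤-reflexive (∣∣-cong (solve 2 (λ a b → a :+ b :- a := b) refl _ _))) (f≤ n))
      ... | l , f-sum , _ = l , f-sum

    opaque
      geometric-tail : ∀ C {f s} → ℝ.0# ≤ C → (∀ n → ∣ f n ∣ ≤ C ℝ.* θ ℝ.^ n) → HasSum f s →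
        ∀ n → ∣ s - ∑< n f ∣ ≤ C ℝ.* total ℝ.* θ ℝ.^ n
      geometric-tail C {f} 0≤C f≤ f-sum n with geometric-⟶ C (λ n → ∑< n f) 0≤C (λ n → ≤-trans
        (≤-reflexive (∣∣-cong (solve 2 (λ a b → a :+ b :- a := b) refl _ _))) (f≤ n))
      ... | l , f-sum′ , tail = ≤-trans
        (≤-reflexive (∣∣-cong (+-congʳ (⟶-unique f-sum f-sum′)))) (tail n)

    private
      opaque
        -- The first n diagonals contain the first n - j terms of row j, and the missing tail is at
        -- most Cθʲθⁿ⁻ʲ/(1 - θ). So each of the n rows has the same error bound Cθⁿ/(1 - θ). The
        -- induction removes row 0 and replaces C by Cθ.
        rows-diagonals : ∀ C (f : ℕ → ℕ → Carrier) g → ℝ.0# ≤ C →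
          (∀ j n → ∣ f j n ∣ ≤ C ℝ.* (θ ℝ.^ j ℝ.* θ ℝ.^ n)) → (∀ j → HasSum (f j) (g j)) →
          ∀ n → ∣ ∑< n g - ∑< n (λ m → ∑△ m f) ∣ ≤ n ℕ× ℝ.1# ℝ.* (C ℝ.* total ℝ.* θ ℝ.^ n)
        rows-diagonals C f g 0≤C f≤ rows zero    = ∣x-y∣≤ refl
          (≤-reflexive (ℝ.solve 1 (λ a → ℝ.:0 ℝ.:= ℝ.:0 ℝ.:* a) ℝ.refl _))
        rows-diagonals C f g 0≤C f≤ rows (suc n) = begin
          ∣ ∑< (suc n) g - ∑< (suc n) (λ m → ∑△ m f) ∣
            ≈⟨ ∣∣-cong (+-cong (∑<-head n g) (-‿cong (∑<-∑△-suc n f))) ⟩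
          ∣ (g 0 + ∑< n g′) - (∑< (suc n) (f 0) + ∑< n (λ m → ∑△ m f′)) ∣
            ≈⟨ ∣∣-cong (solve 4 (λ a b c d → a :+ b :- (c :+ d) := (a :- c) :+ (b :- d)) refl _ _ _ _) ⟩
          ∣ (g 0 - ∑< (suc n) (f 0)) + (∑< n g′ - ∑< n (λ m → ∑△ m f′)) ∣
            ≤⟨ ∣∣-+ _ _ ⟩
          ∣ g 0 - ∑< (suc n) (f 0) ∣ ℝ.+ ∣ ∑< n g′ - ∑< n (λ m → ∑△ m f′) ∣
            ≤⟨ ℝ.+-mono-≤
                 (geometric-tail C 0≤C (λ m → ≤-trans (f≤ 0 m) (≤-reflexive (ℝ.*-congˡ (ℝ.*-identityˡ _))))
                   (rows 0) (suc n))
                 (rows-diagonals (C ℝ.* θ) f′ g′ (ℝ.nonNeg-* 0≤C 0≤θ)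
                   (λ j m → ≤-trans (f≤ (suc j) m) (≤-reflexive (ℝ.solve 4
                     (λ C t a b → C ℝ.:* (t ℝ.:* a ℝ.:* b) ℝ.:= C ℝ.:* t ℝ.:* (a ℝ.:* b)) ℝ.refl C θ _ _)))
                   (λ j → rows (suc j)) n) ⟩
          C ℝ.* total ℝ.* (θ ℝ.* θ ℝ.^ n) ℝ.+ n ℕ× ℝ.1# ℝ.* (C ℝ.* θ ℝ.* total ℝ.* θ ℝ.^ n)
            ≈⟨ ℝ.solve 5 (λ C i t T N → C ℝ.:* i ℝ.:* (t ℝ.:* T) ℝ.:+ N ℝ.:* (C ℝ.:* t ℝ.:* i ℝ.:* T)
                 ℝ.:= (ℝ.:1 ℝ.:+ N) ℝ.:* (C ℝ.:* i ℝ.:* (t ℝ.:* T))) ℝ.refl C total θ (θ ℝ.^ n) (n ℕ× ℝ.1#) ⟩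
          suc n ℕ× ℝ.1# ℝ.* (C ℝ.* total ℝ.* θ ℝ.^ suc n) ∎
          where
          g′ : ℕ → Carrier
          g′ j = g (suc j)
          f′ : ℕ → ℕ → Carrier
          f′ j = f (suc j)

    module DiagonalSum (W : Widening ρ) (C : ℝ.Carrier) (0≤C : ℝ.0# ≤ C) where
      open Widening W using (M; 0≤M; bound) renaming (ratio to ρ⁺)

      0≤C*total : ℝ.0# ≤ C ℝ.* total
      0≤C*total = ℝ.nonNeg-* 0≤C 0≤total

      opaque
        rows-diagonals⁺ : ∀ (f : ℕ → ℕ → Carrier) g →
          (∀ j n → ∣ f j n ∣ ≤ C ℝ.* (θ ℝ.^ j ℝ.* θ ℝ.^ n)) → (∀ j → HasSum (f j) (g j)) →
          ∀ n → ∣ ∑< n g - ∑< n (λ m → ∑△ m f) ∣ ≤ C ℝ.* total ℝ.* M ℝ.* Ratio.θ ρ⁺ ℝ.^ n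
        rows-diagonals⁺ f g f≤ rows n = begin
          ∣ ∑< n g - ∑< n (λ m → ∑△ m f) ∣
            ≤⟨ rows-diagonals C f g 0≤C f≤ rows n ⟩
          n ℕ× ℝ.1# ℝ.* (C ℝ.* total ℝ.* θ ℝ.^ n)
            ≤⟨ ℝ.*-monoʳ-≤ (ℝ.nonNeg-* 0≤C*total (0≤θ^ n)) (ℝ.ℕ×-mono (ℕₚ.n≤1+n n)) ⟩
          suc n ℕ× ℝ.1# ℝ.* (C ℝ.* total ℝ.* θ ℝ.^ n)
            ≈⟨ ℝ.solve 3 (λ N D T → N ℝ.:* (D ℝ.:* T) ℝ.:= D ℝ.:* (N ℝ.:* T)) ℝ.refl _ _ _ ⟩
          C ℝ.* total ℝ.* (suc n ℕ× ℝ.1# ℝ.* θ ℝ.^ n)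
            ≤⟨ ℝ.*-monoˡ-≤ 0≤C*total (bound n) ⟩
          C ℝ.* total ℝ.* (M ℝ.* Ratio.θ ρ⁺ ℝ.^ n)
            ≈⟨ ℝ.*-assoc _ _ _ ⟨
          C ℝ.* total ℝ.* M ℝ.* Ratio.θ ρ⁺ ℝ.^ n ∎

      opaque
        diagonals-⟶ : ∀ (f : ℕ → ℕ → Carrier) {g s} →
          (∀ j n → ∣ f j n ∣ ≤ C ℝ.* (θ ℝ.^ j ℝ.* θ ℝ.^ n)) → (∀ j → HasSum (f j) (g j)) →
          HasSum g s → HasSum (λ n → ∑△ n f) s
        diagonals-⟶ f {g} {s} f≤ rows g-sum = ⟶-null
          (λ n → ≤-trans (∣∣-triangle _ (∑< n g) s)
            (ℝ.+-monoˡ-≤ _ (≤-trans (≤-reflexive (∣∣-swap _ _)) (rows-diagonals⁺ f g f≤ rows n))))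
          (ℝ.null-+ (ℝ.null-*ˡ (C ℝ.* total ℝ.* M) (ℝ.nonNeg-* 0≤C*total 0≤M)
            (Ratio.0≤θ^ ρ⁺) (Ratio.null-θ^ ρ⁺)) g-sum)

    opaque
      diagonal-sum : ∀ C (f : ℕ → ℕ → Carrier) {g s} → ℝ.0# ≤ C →
        (∀ j n → ∣ f j n ∣ ≤ C ℝ.* (θ ℝ.^ j ℝ.* θ ℝ.^ n)) → (∀ j → HasSum (f j) (g j)) →
        HasSum g s → HasSum (λ n → ∑△ n f) s
      diagonal-sum C f 0≤C = DiagonalSum.diagonals-⟶ (ℝ.widen ρ) C 0≤C f

    opaque
      ∃-row-sum : ∀ C (f : ℕ → ℕ → Carrier) {g} → ℝ.0# ≤ C →
        (∀ j n → ∣ f j n ∣ ≤ C ℝ.* (θ ℝ.^ j ℝ.* θ ℝ.^ n)) → (∀ j → HasSum (f j) (g j)) → ∃ (HasSum g)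
      ∃-row-sum C f {g} 0≤C f≤ rows = geometric-HasSum (C ℝ.* total) g (ℝ.nonNeg-* 0≤C 0≤total) g≤
        where
        g≤ : ∀ j → ∣ g j ∣ ≤ C ℝ.* total ℝ.* θ ℝ.^ j
        g≤ j = begin
          ∣ g j ∣                                         ≈⟨ ∣∣-cong (x-0≈x (g j)) ⟨
          ∣ g j - 0# ∣
            -- The tail after 0 terms is the whole sum of the row.
            ≤⟨ geometric-tail (C ℝ.* θ ℝ.^ j) (ℝ.nonNeg-* 0≤C (0≤θ^ j))
                 (λ n → ≤-trans (f≤ j n) (≤-reflexive (ℝ.sym (ℝ.*-assoc _ _ _)))) (rows j) 0 ⟩
          C ℝ.* θ ℝ.^ j ℝ.* total ℝ.* ℝ.1#                ≈⟨ ℝ.*-identityʳ _ ⟩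
          C ℝ.* θ ℝ.^ j ℝ.* total
            ≈⟨ ℝ.solve 3 (λ C T i → C ℝ.:* T ℝ.:* i ℝ.:= C ℝ.:* i ℝ.:* T) ℝ.refl C (θ ℝ.^ j) total ⟩
          C ℝ.* total ℝ.* θ ℝ.^ j                         ∎

    opaque
      -- In the double series with entries aᵢbₖ, row i sums to aᵢs′ and the rows together to ss′, so
      -- `diagonal-sum` applies.
      cauchyProduct : ∀ A B {a b s s′} → ℝ.0# ≤ A → ℝ.0# ≤ B →
        (∀ n → ∣ a n ∣ ≤ A ℝ.* θ ℝ.^ n) → (∀ n → ∣ b n ∣ ≤ B ℝ.* θ ℝ.^ n) →
        HasSum a s → HasSum b s′ → HasSum (λ n → ∑△ n (λ i k → a i * b k)) (s * s′)
      cauchyProduct A B {a} {b} {s} {s′} 0≤A 0≤B a≤ b≤ a-sum b-sum =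
        diagonal-sum (A ℝ.* B) (λ i k → a i * b k) (ℝ.nonNeg-* 0≤A 0≤B)
          (λ i k → ≤-trans (≤-reflexive (∣∣-* (a i) (b k))) (≤-trans
            (ℝ.*-mono-≤ (0≤∣ a i ∣) (ℝ.nonNeg-* 0≤B (0≤θ^ k)) (a≤ i) (b≤ k))
            (≤-reflexive (ℝ.solve 4 (λ A x B y → A ℝ.:* x ℝ.:* (B ℝ.:* y) ℝ.:= A ℝ.:* B ℝ.:* (x ℝ.:* y))
              ℝ.refl A _ B _))))
          (λ i → hasSum-*ˡ (a i) b-sum)
          (⟶-cong (λ n → ∑<-cong n (λ i → *-comm s′ (a i))) (*-comm s′ s) (hasSum-*ˡ s′ a-sum))

    opaque
      ∣cauchyProduct∣≤ : ∀ (W : Widening ρ) A B {a b : ℕ → Carrier} → ℝ.0# ≤ A → ℝ.0# ≤ B →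
        (∀ n → ∣ a n ∣ ≤ A ℝ.* θ ℝ.^ n) → (∀ n → ∣ b n ∣ ≤ B ℝ.* θ ℝ.^ n) →
        ∀ n → ∣ ∑△ n (λ i k → a i * b k) ∣
              ≤ A ℝ.* B ℝ.* Widening.M W ℝ.* Ratio.θ (Widening.ratio W) ℝ.^ n
      ∣cauchyProduct∣≤ W A B {a} {b} 0≤A 0≤B a≤ b≤ n = begin
        ∣ ∑△ n (λ i k → a i * b k) ∣
          ≤⟨ ∣∑△∣≤ n {λ i k → a i * b k} each ⟩
        suc n ℕ× ℝ.1# ℝ.* (A ℝ.* B ℝ.* θ ℝ.^ n)
          ≈⟨ ℝ.solve 3 (λ N D T → N ℝ.:* (D ℝ.:* T) ℝ.:= D ℝ.:* (N ℝ.:* T)) ℝ.refl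
               (suc n ℕ× ℝ.1#) (A ℝ.* B) (θ ℝ.^ n) ⟩
        A ℝ.* B ℝ.* (suc n ℕ× ℝ.1# ℝ.* θ ℝ.^ n)
          ≤⟨ ℝ.*-monoˡ-≤ (ℝ.nonNeg-* 0≤A 0≤B) (Widening.bound W n) ⟩
        A ℝ.* B ℝ.* (Widening.M W ℝ.* Ratio.θ (Widening.ratio W) ℝ.^ n)
          ≈⟨ ℝ.*-assoc _ _ _ ⟨
        A ℝ.* B ℝ.* Widening.M W ℝ.* Ratio.θ (Widening.ratio W) ℝ.^ n ∎
        where
        each : ∀ i k → i ℕ.+ k ≡ n → ∣ a i * b k ∣ ≤ A ℝ.* B ℝ.* θ ℝ.^ n
        each i k i+k≡n = begin
          ∣ a i * b k ∣                                  ≈⟨ ∣∣-* _ _ ⟩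
          ∣ a i ∣ ℝ.* ∣ b k ∣
            ≤⟨ ℝ.*-mono-≤ (0≤∣ a i ∣) (ℝ.nonNeg-* 0≤B (0≤θ^ k)) (a≤ i) (b≤ k) ⟩
          A ℝ.* θ ℝ.^ i ℝ.* (B ℝ.* θ ℝ.^ k)
            ≈⟨ ℝ.solve 4 (λ A x B y → A ℝ.:* x ℝ.:* (B ℝ.:* y) ℝ.:= A ℝ.:* B ℝ.:* (x ℝ.:* y)) ℝ.refl
                 A (θ ℝ.^ i) B (θ ℝ.^ k) ⟩
          A ℝ.* B ℝ.* (θ ℝ.^ i ℝ.* θ ℝ.^ k)
            ≈⟨ ℝ.*-congˡ (ℝ.sym (ℝ.trans (ℝ.reflexive (≡.cong (θ ℝ.^_) (≡.sym i+k≡n))) (ℝ.^-homo-* θ i k))) ⟩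
          A ℝ.* B ℝ.* θ ℝ.^ n                            ∎

-- Infinite q-products and the q-binomial theorem.

module QSeries {c ℓ₁ ℓ₂ ℓ₃ k ℓ} {R : RealField c ℓ₁ ℓ₂ ℓ₃} (V : CompleteValuedField R k ℓ)
  (F : QFactorials (CompleteValuedField.commutativeRing V))
  (∣q∣<1 : RealField._<_ R (CompleteValuedField.∣_∣ V (QFactorials.q F)) (RealField.1# R))
  where
  open CompleteValuedField V
  open RealField R using (_<_; _≤_) renaming (1# to 1ℝ)
  open Exp commutativeSemiring using (_^_; ^-congˡ; ^-distrib-*; ^-homo-*)
  open QFactorials F
  open IntegerRingSolver commutativeRing
  open Sums commutativeRing
  open CauchyPolynomials commutativeRing q
  open RogersSzegő commutativeRing F
  open Convergence V
  private module ℝ = Real R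
  open ℝ using (Ratio; ≤-trans; ≤-reflexive; Widening)
  private module ≤ = ℝ.≤-Reasoning
  open SetoidReasoning setoid

  qRatio : Ratio
  qRatio = record { θ = ∣ q ∣ ; 0≤θ = 0≤∣ q ∣ ; θ<1 = ∣q∣<1 }

  open Ratio qRatio using () renaming (0≤θ^ to 0≤∣q∣^; θ^≤1 to ∣q∣^≤1; null-θ^ to null-∣q∣^)

  ∣q^n*a∣ : ∀ n a → ∣ q ^ n * a ∣ ℝ.≈ ∣ q ∣ ℝ.^ n ℝ.* ∣ a ∣
  ∣q^n*a∣ n a = ℝ.trans (∣∣-* _ _) (ℝ.*-congʳ (∣∣^ q n))

  ∣q^n*a∣≤ : ∀ n {a α} → ∣ a ∣ ≤ α → ∣ q ^ n * a ∣ ≤ α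
  ∣q^n*a∣≤ n {a} {α} a≤α = ≤-trans (≤-reflexive (∣q^n*a∣ n a)) (≤-trans
    (ℝ.*-mono-≤ (0≤∣q∣^ n) (≤-trans (0≤∣ a ∣) a≤α) (∣q∣^≤1 n) a≤α) (≤-reflexive (ℝ.*-identityˡ α)))

  -- `P n 1# a` is (a;q)ₙ. The bound is uniform in a, since the rows of the multiple series carry
  -- the parameters qʲy and qʲv/u and need constants independent of j.
  PochBound : ℝ.Carrier → Set (c ⊔ k ⊔ ℓ₃)
  PochBound α = ∃ λ B → ℝ.0# ≤ B × ∀ {a} → ∣ a ∣ ≤ α → ∀ n → ∣ P n 1# a ∣ ≤ B

  opaque
    poch-bound : ∀ α → ℝ.0# ≤ α → PochBound α
    poch-bound α 0≤α with ℝ.growthBound qRatio α 0≤α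
    ... | B , 1≤B , grow = B , ≤-trans ℝ.0≤1 1≤B , λ {a} a≤α n → ≤-trans
        (grow (λ n → ∣ P n 1# a ∣) (0≤∣ 1# ∣) (step a≤α) n)
        (≤-reflexive (ℝ.trans (ℝ.*-congˡ ∣1∣≈1) (ℝ.*-identityʳ B)))
      where
      step : ∀ {a} → ∣ a ∣ ≤ α → ∀ n →
        ∣ P n 1# a * (1# - q ^ n * a) ∣ ≤ ∣ P n 1# a ∣ ℝ.* (ℝ.1# ℝ.+ α ℝ.* ∣ q ∣ ℝ.^ n)
      step {a} a≤α n = ≤-trans (≤-reflexive (∣∣-* _ _)) (ℝ.*-monoˡ-≤ (0≤∣ _ ∣) (≤-trans (∣∣-+ _ _)
        (ℝ.+-mono-≤ (≤-reflexive ∣1∣≈1) (≤-trans (≤-reflexive (ℝ.trans (∣- _ ∣)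
          (ℝ.trans (∣q^n*a∣ n a) (ℝ.*-comm _ _)))) (ℝ.*-monoʳ-≤ (0≤∣q∣^ n) a≤α)))))

  opaque
    e-bound : ∃ λ E → ℝ.0# ≤ E × ∀ n → ∣ e n ∣ ≤ E
    e-bound with ℝ.growthBound qRatio (Ratio.total qRatio) (Ratio.0≤total qRatio)
    ... | B , 1≤B , grow = B , ≤-trans ℝ.0≤1 1≤B , λ n → ≤-trans
        (grow (λ n → ∣ e n ∣) (0≤∣ e 0 ∣) step n)
        (≤-reflexive (ℝ.trans (ℝ.*-congˡ (ℝ.trans (∣∣-cong e-zero) ∣1∣≈1)) (ℝ.*-identityʳ B)))
      where
      open Ratio qRatio using (total; 0≤total; total*[1-θ]≈1)
      step : ∀ n → ∣ e (suc n) ∣ ≤ ∣ e n ∣ ℝ.* (ℝ.1# ℝ.+ total ℝ.* ∣ q ∣ ℝ.^ n)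
      step n = ≤.begin
        E′                                          ≤.≈⟨ ℝ.*-identityʳ E′ ⟨
        E′ ℝ.* ℝ.1#                                 ≤.≤⟨ ℝ.*-monoˡ-≤ (0≤∣ e (suc n) ∣) (Ratio.1≤[1-θ^]*[1+total*θ^] qRatio n) ⟩
        E′ ℝ.* ((ℝ.1# ℝ.- κ ℝ.* κⁿ) ℝ.* g)          ≤.≈⟨ ℝ.*-assoc _ _ _ ⟨
        E′ ℝ.* (ℝ.1# ℝ.- κ ℝ.* κⁿ) ℝ.* g
          ≤.≤⟨ ℝ.*-monoʳ-≤ (ℝ.nonNeg+nonNeg ℝ.0≤1 (ℝ.nonNeg-* 0≤total (0≤∣q∣^ n))) E′[1-κ^]≤ ⟩
        ∣ e n ∣ ℝ.* g                               ≤.∎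
        where
        E′ κ κⁿ g : ℝ.Carrier
        E′ = ∣ e (suc n) ∣
        κ  = ∣ q ∣
        κⁿ = ∣ q ∣ ℝ.^ n
        g  = ℝ.1# ℝ.+ total ℝ.* κⁿ
        E′[1-κ^]≤ : E′ ℝ.* (ℝ.1# ℝ.- κ ℝ.* κⁿ) ≤ ∣ e n ∣
        -- Writing eₙ₊₁ = eₙ + qⁿ⁺¹eₙ₊₁ reduces the estimate to the triangle inequality, without a
        -- lower bound for |1 - qⁿ⁺¹|.
        E′[1-κ^]≤ = ℝ.0≤-⇒≤ (≤-trans (ℝ.≤⇒0≤- (≤.begin
          E′                                          ≤.≈⟨ ∣∣-cong e′≈ ⟩
          ∣ e n + q ^ suc n * e (suc n) ∣             ≤.≤⟨ ∣∣-+ _ _ ⟩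
          ∣ e n ∣ ℝ.+ ∣ q ^ suc n * e (suc n) ∣       ≤.≈⟨ ℝ.+-congˡ (∣q^n*a∣ (suc n) _) ⟩
          ∣ e n ∣ ℝ.+ κ ℝ.* κⁿ ℝ.* E′                 ≤.∎))
          (≤-reflexive (ℝ.solve 3 (λ a b E → a ℝ.:+ b ℝ.:* E ℝ.:- E ℝ.:= a ℝ.:- E ℝ.:* (ℝ.:1 ℝ.:- b))
            ℝ.refl _ _ _)))
          where
          e′≈ : e (suc n) ≈ e n + q ^ suc n * e (suc n)
          e′≈ = trans (solve 2 (λ u v → v := (:1 :- u) :* v :+ u :* v) refl (q ^ suc n) (e (suc n)))
                      (+-congʳ (e-suc n))

  opaque
    poch-step : ∀ B a → (∀ n → ∣ P n 1# a ∣ ≤ B) →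
      ∀ n → ∣ P (suc n) 1# a - P n 1# a ∣ ≤ B ℝ.* ∣ a ∣ ℝ.* ∣ q ∣ ℝ.^ n
    poch-step B a P≤B n = ≤.begin
      ∣ P n 1# a * (1# - q ^ n * a) - P n 1# a ∣
        ≤.≈⟨ ∣∣-cong (solve 2 (λ p b → p :* (:1 :- b) :- p := :- (p :* b)) refl _ _) ⟩
      ∣ - (P n 1# a * (q ^ n * a)) ∣
        ≤.≈⟨ ℝ.trans (∣- _ ∣) (ℝ.trans (∣∣-* _ _) (ℝ.*-congˡ (∣q^n*a∣ n a))) ⟩
      ∣ P n 1# a ∣ ℝ.* (∣ q ∣ ℝ.^ n ℝ.* ∣ a ∣)
        ≤.≤⟨ ℝ.*-monoʳ-≤ (ℝ.nonNeg-* (0≤∣q∣^ n) (0≤∣ a ∣)) (P≤B n) ⟩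
      B ℝ.* (∣ q ∣ ℝ.^ n ℝ.* ∣ a ∣)
        ≤.≈⟨ ℝ.solve 3 (λ B T a → B ℝ.:* (T ℝ.:* a) ℝ.:= B ℝ.:* a ℝ.:* T) ℝ.refl B _ _ ⟩
      B ℝ.* ∣ a ∣ ℝ.* ∣ q ∣ ℝ.^ n ≤.∎

  opaque
    poch-⟶ : ∀ a → ∃ λ p → (λ n → P n 1# a) ⟶ p
    poch-⟶ a = converge (poch-bound ∣ a ∣ (0≤∣ a ∣))
      where
      converge : PochBound ∣ a ∣ → ∃ λ p → (λ n → P n 1# a) ⟶ p
      converge (B , 0≤B , P≤B) = Product.map₂ proj₁ (geometric-⟶ qRatio (B ℝ.* ∣ a ∣) (λ n → P n 1# a)
        (ℝ.nonNeg-* 0≤B (0≤∣ a ∣)) (poch-step B a (P≤B (≤-reflexive ℝ.refl))))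

  P∞ : Carrier → Carrier
  P∞ a = proj₁ (poch-⟶ a)

  P⟶P∞ : ∀ a → (λ n → P n 1# a) ⟶ P∞ a
  P⟶P∞ a = proj₂ (poch-⟶ a)

  P∞-cong : ∀ {a b} → a ≈ b → P∞ a ≈ P∞ b
  P∞-cong {a} {b} a≈b = ⟶-unique (⟶-cong (λ n → P-cong n refl a≈b) refl (P⟶P∞ a)) (P⟶P∞ b)

  P-1-0 : ∀ n → P n 1# 0# ≈ 1#
  P-1-0 zero    = refl
  P-1-0 (suc n) = trans (*-congʳ (P-1-0 n))
    (trans (*-identityˡ _) (trans (+-congˡ (-‿cong (zeroʳ _))) (x-0≈x 1#)))

  P∞-zero : P∞ 0# ≈ 1#
  P∞-zero = ⟶-unique (P⟶P∞ 0#) (⟶-cong (λ n → sym (P-1-0 n)) refl (⟶-const 1#))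

  P∞-split : ∀ j a → P∞ a ≈ P j 1# a * P∞ (q ^ j * a)
  P∞-split j a = ⟶-unique (⟶-cong (λ n → P-+ j n 1# a) refl (⟶-shift j (P⟶P∞ a)))
    (⟶-*ˡ (P j 1# a) (P⟶P∞ (q ^ j * a)))

  term : Carrier → Carrier → ℕ → Carrier
  term a z n = P n 1# a * e n * z ^ n

  term-cong : ∀ {a b z w} → a ≈ b → z ≈ w → ∀ n → term a z n ≈ term b w n
  term-cong a≈b z≈w n = *-cong (*-congʳ (P-cong n refl a≈b)) (^-congˡ n z≈w)

  -- The constant precedes z and θ, so one bound serves the same parameter at different arguments
  -- and with different ratios.
  TermBound : ℝ.Carrier → Set (c ⊔ k ⊔ ℓ₃)
  TermBound α = ∃ λ C → ℝ.0# ≤ C ×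
    ∀ {a z θ} → ∣ a ∣ ≤ α → ∣ z ∣ ≤ θ → ∀ n → ∣ term a z n ∣ ≤ C ℝ.* θ ℝ.^ n

  opaque
    term-bound : ∀ α → ℝ.0# ≤ α → TermBound α
    term-bound α 0≤α = combine (poch-bound α 0≤α) e-bound
      where
      combine : PochBound α → (∃ λ E → ℝ.0# ≤ E × ∀ n → ∣ e n ∣ ≤ E) → TermBound α
      combine (B , 0≤B , P≤B) (E , 0≤E , e≤E) = B ℝ.* E , ℝ.nonNeg-* 0≤B 0≤E , λ {a} {z} a≤α z≤θ n →
        ≤-trans (≤-reflexive (ℝ.trans (∣∣-* _ _) (ℝ.*-cong (∣∣-* _ _) (∣∣^ z n))))
          (ℝ.*-mono-≤ (ℝ.nonNeg-* (0≤∣ P n 1# a ∣) (0≤∣ e n ∣)) (ℝ.^-nonNeg (≤-trans (0≤∣ z ∣) z≤θ) n)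
            (ℝ.*-mono-≤ (0≤∣ P n 1# a ∣) 0≤E (P≤B a≤α n) (e≤E n))
            (ℝ.^-monoˡ-≤ (0≤∣ z ∣) z≤θ n))

  opaque
    -- Passing from z to qz produces 1 - qⁿ⁺¹, which cancels the last factor of (q;q)ₙ₊₁; the last
    -- factor 1 - aqⁿ of (a;q)ₙ₊₁ then yields the two terms.
    term-step : ∀ a z n →
      term a z (suc n) - term a (q * z) (suc n) ≈ z * term a z n - a * z * term a (q * z) n
    term-step a z n = begin
      p * d * f * Z′ - p * d * f * (q * z) ^ suc n
        ≈⟨ +-congˡ (-‿cong (*-congˡ (^-distrib-* q z (suc n)))) ⟩
      p * d * f * Z′ - p * d * f * (u′ * Z′)
        ≈⟨ solve 5 (λ p d f Z u → p :* d :* f :* Z :- p :* d :* f :* (u :* Z)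
                      := p :* d :* ((:1 :- u) :* f) :* Z) refl p d f Z′ u′ ⟩
      p * d * ((1# - u′) * f) * Z′
        ≈⟨ *-congʳ (*-congˡ (e-suc n)) ⟩
      p * (1# - u * a) * e n * (z * Z)
        ≈⟨ solve 6 (λ p u a f z Z → p :* (:1 :- u :* a) :* f :* (z :* Z)
             := z :* (p :* f :* Z) :- a :* z :* (p :* f :* (u :* Z))) refl p u a (e n) z Z ⟩
      z * (p * e n * Z) - a * z * (p * e n * (u * Z))
        ≈⟨ +-congˡ (-‿cong (*-congˡ (*-congˡ (^-distrib-* q z n)))) ⟨
      z * term a z n - a * z * term a (q * z) n ∎
      where
      p d f u u′ Z Z′ : Carrier
      p = P n 1# a
      d = 1# - q ^ n * a
      f = e (suc n)
      u = q ^ n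
      u′ = q ^ suc n
      Z = z ^ n
      Z′ = z ^ suc n

  -- The coefficientwise form of F(z) - F(qz) = z F(z) - az F(qz).
  opaque
    term-functional : ∀ a z n →
      ∑< (suc n) (term a z) - ∑< (suc n) (term a (q * z)) ≈
      z * ∑< n (term a z) - a * z * ∑< n (term a (q * z))
    term-functional a z zero    =
      solve 3 (λ c a z → :0 :+ c :* :1 :- (:0 :+ c :* :1) := z :* :0 :- a :* z :* :0) refl
        (P 0 1# a * e 0) a z
    term-functional a z (suc n) = begin
      (s + t) - (s′ + t′)
        ≈⟨ solve 4 (λ a b c d → a :+ b :- (c :+ d) := (a :- c) :+ (b :- d)) refl s t s′ t′ ⟩
      (s - s′) + (t - t′)
        ≈⟨ +-cong (term-functional a z n) (term-step a z n) ⟩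
      (z * r - a * z * r′) + (z * term a z n - a * z * term a (q * z) n)
        ≈⟨ solve 6 (λ z s a r t u → z :* s :- a :* z :* r :+ (z :* t :- a :* z :* u)
                   := z :* (s :+ t) :- a :* z :* (r :+ u)) refl z r a r′ (term a z n) (term a (q * z) n) ⟩
      z * ∑< (suc n) (term a z) - a * z * ∑< (suc n) (term a (q * z)) ∎
      where
      s s′ r r′ t t′ : Carrier
      s = ∑< (suc n) (term a z)
      s′ = ∑< (suc n) (term a (q * z))
      r = ∑< n (term a z)
      r′ = ∑< n (term a (q * z))
      t = term a z (suc n)
      t′ = term a (q * z) (suc n)

  opaque
    sum-functional : ∀ {a z s s′} → HasSum (term a z) s → HasSum (term a (q * z)) s′ →
      (1# - z) * s ≈ (1# - a * z) * s′
    sum-functional {a} {z} {s} {s′} F F′ = begin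
      (1# - z) * s                 ≈⟨ solve 3 (λ z s r → (:1 :- z) :* s := (s :- r) :+ (r :- z :* s)) refl z s s′ ⟩
      (s - s′) + (s′ - z * s)      ≈⟨ +-congʳ limits ⟩
      (z * s - a * z * s′) + (s′ - z * s)
        ≈⟨ solve 4 (λ z s a r → (z :* s :- a :* z :* r) :+ (r :- z :* s) := (:1 :- a :* z) :* r) refl z s a s′ ⟩
      (1# - a * z) * s′            ∎
      where
      difference : ∀ {f g l m} → f ⟶ l → g ⟶ m → (λ n → f n - g n) ⟶ l - m
      difference {f} {g} {l} {m} f⟶l g⟶m = ⟶-cong
        (λ n → +-congˡ (solve 1 (λ a → :- :1 :* a := :- a) refl (g n)))
        (+-congˡ (solve 1 (λ a → :- :1 :* a := :- a) refl m)) (⟶-+ f⟶l (⟶-*ˡ (- 1#) g⟶m))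
      limits : s - s′ ≈ z * s - a * z * s′
      -- The left side of `term-functional` has one summand more than the right, hence the shift by
      -- 1.
      limits = ⟶-unique (⟶-cong (term-functional a z) refl (difference (⟶-shift 1 F) (⟶-shift 1 F′)))
        (difference (⟶-*ˡ z F) (⟶-*ˡ (a * z) F′))

  module _ (ρ : Ratio) where
    open Ratio ρ

    opaque
      term-HasSum : ∀ a {z} → ∣ z ∣ ≤ θ → ∃ (HasSum (term a z))
      term-HasSum a {z} ∣z∣≤θ = sum (term-bound ∣ a ∣ (0≤∣ a ∣))
        where
        sum : TermBound ∣ a ∣ → ∃ (HasSum (term a z))
        sum (C , 0≤C , term≤) = geometric-HasSum ρ C _ 0≤C (term≤ (≤-reflexive ℝ.refl) ∣z∣≤θ)

    opaque
      -- Every term but the first contains z. One factor |z| is estimated by δ and the remaining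
      -- powers by the fixed θ, so the bound is linear in δ; with δ = |q|ⁿ it shows F(qⁿz) → 1.
      term-sum-near-1 : ∀ C δ {a z s} → ℝ.0# ≤ C → ∣ z ∣ ≤ δ → ∣ z ∣ ≤ θ →
        (∀ n → ∣ term a z n ∣ ≤ C ℝ.* ∣ z ∣ ℝ.^ n) → HasSum (term a z) s →
        ∣ s - 1# ∣ ≤ C ℝ.* δ ℝ.* total
      term-sum-near-1 C δ {a} {z} {s} 0≤C z≤δ z≤θ term≤ F = conclude
        (geometric-⟶ ρ (C ℝ.* δ) (λ m → ∑< (suc m) (term a z)) (ℝ.nonNeg-* 0≤C 0≤δ) step)
        where
        0≤δ : ℝ.0# ≤ δ
        0≤δ = ≤-trans (0≤∣ z ∣) z≤δ
        step : ∀ m → ∣ ∑< (suc m) (term a z) + term a z (suc m) - ∑< (suc m) (term a z) ∣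
                     ≤ C ℝ.* δ ℝ.* θ ℝ.^ m
        step m = ≤.begin
          ∣ ∑< (suc m) (term a z) + term a z (suc m) - ∑< (suc m) (term a z) ∣
            ≤.≈⟨ ∣∣-cong (solve 2 (λ a b → a :+ b :- a := b) refl _ _) ⟩
          ∣ term a z (suc m) ∣
            ≤.≤⟨ term≤ (suc m) ⟩
          C ℝ.* (∣ z ∣ ℝ.* ∣ z ∣ ℝ.^ m)
            ≤.≤⟨ ℝ.*-monoˡ-≤ 0≤C (ℝ.*-mono-≤ (0≤∣ z ∣) (0≤θ^ m) z≤δ (ℝ.^-monoˡ-≤ (0≤∣ z ∣) z≤θ m)) ⟩
          C ℝ.* (δ ℝ.* θ ℝ.^ m)
            ≤.≈⟨ ℝ.*-assoc _ _ _ ⟨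
          C ℝ.* δ ℝ.* θ ℝ.^ m ≤.∎
        first : 1# ≈ ∑< 1 (term a z)
        first = sym (trans (+-identityˡ _) (trans (*-identityʳ _) (trans (*-identityˡ _) e-zero)))
        conclude : (∃ λ l → (λ m → ∑< (suc m) (term a z)) ⟶ l ×
                     ∀ m → ∣ l - ∑< (suc m) (term a z) ∣ ≤ C ℝ.* δ ℝ.* total ℝ.* θ ℝ.^ m) →
                   ∣ s - 1# ∣ ≤ C ℝ.* δ ℝ.* total
        conclude (l , ⟶l , close) = ≤-trans
          (≤-reflexive (∣∣-cong (+-cong (⟶-unique (⟶-shift 1 F) ⟶l) (-‿cong first))))
          (≤-trans (close 0) (≤-reflexive (ℝ.*-identityʳ _)))

    -- Iterating (1 - z) F(z) = (1 - az) F(qz) gives F(z) (z;q)ₙ = (az;q)ₙ F(qⁿz), and F(qⁿz) → 1.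
    module QBinomial (a z : Carrier) (∣z∣≤θ : ∣ z ∣ ≤ θ) where
      ∣zₙ∣≤θ : ∀ n → ∣ q ^ n * z ∣ ≤ θ
      ∣zₙ∣≤θ n = ∣q^n*a∣≤ n ∣z∣≤θ

      sₙ : ℕ → Carrier
      sₙ n = proj₁ (term-HasSum a (∣zₙ∣≤θ n))

      Fₙ : ∀ n → HasSum (term a (q ^ n * z)) (sₙ n)
      Fₙ n = proj₂ (term-HasSum a (∣zₙ∣≤θ n))

      opaque
        functional : ∀ n → (1# - q ^ n * z) * sₙ n ≈ (1# - a * (q ^ n * z)) * sₙ (suc n)
        functional n = sum-functional (Fₙ n) (hasSum-cong (term-cong refl (*-assoc q _ z)) (Fₙ (suc n)))

      opaque
        iterate : ∀ {s} → HasSum (term a z) s → ∀ n → s * P n 1# z ≈ P n 1# (a * z) * sₙ n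
        iterate {s} F zero    = trans (*-comm s 1#) (*-congˡ (⟶-unique F
          (hasSum-cong (term-cong refl (*-identityˡ z)) (Fₙ 0))))
        iterate {s} F (suc n) = begin
          s * (P n 1# z * (1# - q ^ n * z))                   ≈⟨ *-assoc _ _ _ ⟨
          s * P n 1# z * (1# - q ^ n * z)                     ≈⟨ *-congʳ (iterate F n) ⟩
          P n 1# (a * z) * sₙ n * (1# - q ^ n * z)            ≈⟨ trans (*-assoc _ _ _) (*-congˡ (*-comm _ _)) ⟩
          P n 1# (a * z) * ((1# - q ^ n * z) * sₙ n)          ≈⟨ *-congˡ (functional n) ⟩
          P n 1# (a * z) * ((1# - a * (q ^ n * z)) * sₙ (suc n))
            ≈⟨ solve 5 (λ p a u z s → p :* ((:1 :- a :* (u :* z)) :* s) := p :* (:1 :- u :* (a :* z)) :* s)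
                 refl (P n 1# (a * z)) a (q ^ n) z (sₙ (suc n)) ⟩
          P n 1# (a * z) * (1# - q ^ n * (a * z)) * sₙ (suc n) ∎

      opaque
        sₙ-bound : ∃ λ M → ℝ.0# ≤ M × ∀ n → ∣ sₙ n - 1# ∣ ≤ M ℝ.* ∣ q ∣ ℝ.^ n
        sₙ-bound = bound (term-bound ∣ a ∣ (0≤∣ a ∣))
          where
          ∣zₙ∣≤∣q∣^ : ∀ n → ∣ q ^ n * z ∣ ≤ ∣ q ∣ ℝ.^ n
          ∣zₙ∣≤∣q∣^ n = ≤-trans (≤-reflexive (∣q^n*a∣ n z)) (≤-trans
            (ℝ.*-monoˡ-≤ (0≤∣q∣^ n) (≤-trans ∣z∣≤θ (ℝ.<⇒≤ θ<1))) (≤-reflexive (ℝ.*-identityʳ _)))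
          bound : TermBound ∣ a ∣ → ∃ λ M → ℝ.0# ≤ M × ∀ n → ∣ sₙ n - 1# ∣ ≤ M ℝ.* ∣ q ∣ ℝ.^ n
          bound (C , 0≤C , term≤) = C ℝ.* total , ℝ.nonNeg-* 0≤C 0≤total , λ n → ≤-trans
            (term-sum-near-1 C (∣ q ∣ ℝ.^ n) 0≤C (∣zₙ∣≤∣q∣^ n) (∣zₙ∣≤θ n)
              (term≤ (≤-reflexive ℝ.refl) (≤-reflexive ℝ.refl)) (Fₙ n))
            (≤-reflexive (ℝ.trans (ℝ.*-assoc _ _ _)
              (ℝ.trans (ℝ.*-congˡ (ℝ.*-comm _ _)) (ℝ.sym (ℝ.*-assoc _ _ _)))))

      opaque
        remainder : (λ n → P n 1# (a * z) * (sₙ n - 1#)) ⟶ 0#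
        remainder = vanish sₙ-bound (poch-bound ∣ a * z ∣ (0≤∣ a * z ∣))
          where
          vanish : (∃ λ M → ℝ.0# ≤ M × ∀ n → ∣ sₙ n - 1# ∣ ≤ M ℝ.* ∣ q ∣ ℝ.^ n) → PochBound ∣ a * z ∣ →
            (λ n → P n 1# (a * z) * (sₙ n - 1#)) ⟶ 0#
          vanish (M , 0≤M , sₙ≤M) (B , 0≤B , P≤B) = ⟶-null
            (λ n → ≤-trans (≤-reflexive (ℝ.trans (∣∣-cong (x-0≈x _)) (∣∣-* _ _)))
              (≤-trans (ℝ.*-mono-≤ (0≤∣ P n 1# (a * z) ∣) (ℝ.nonNeg-* 0≤M (0≤∣q∣^ n))
                  (P≤B (≤-reflexive ℝ.refl) n) (sₙ≤M n))
                (≤-reflexive (ℝ.sym (ℝ.*-assoc _ _ _)))))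
            (ℝ.null-*ˡ (B ℝ.* M) (ℝ.nonNeg-* 0≤B 0≤M) 0≤∣q∣^ null-∣q∣^)

    opaque
      -- Stated as a product, because the nonvanishing of (z)_∞ in the unit disc is itself deduced
      -- from the case a = 0.
      q-binomial : ∀ a {z s} → ∣ z ∣ ≤ θ → HasSum (term a z) s → s * P∞ z ≈ P∞ (a * z)
      q-binomial a {z} {s} ∣z∣≤θ F = begin
        s * P∞ z             ≈⟨ ⟶-unique (⟶-*ˡ s (P⟶P∞ z)) (⟶-cong (λ n → sym (expand n)) refl
                                  (⟶-+ (P⟶P∞ (a * z)) remainder)) ⟩
        P∞ (a * z) + 0#      ≈⟨ +-identityʳ _ ⟩
        P∞ (a * z)           ∎
        where
        open QBinomial a z ∣z∣≤θ
        -- Splitting off sₙ - 1 avoids the limit of a product of two sequences: the second summand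
        -- is bounded times null.
        expand : ∀ n → s * P n 1# z ≈ P n 1# (a * z) + P n 1# (a * z) * (sₙ n - 1#)
        expand n = trans (iterate F n) (solve 2 (λ p s → p :* s := p :+ p :* (s :- :1)) refl (P n 1# (a * z)) (sₙ n))

    opaque
      inverse-P∞ : ∀ {z s} → ∣ z ∣ ≤ θ → HasSum (term 0# z) s → s * P∞ z ≈ 1#
      inverse-P∞ {z} ∣z∣≤θ F = trans (q-binomial 0# ∣z∣≤θ F) (trans (P∞-cong (zeroˡ z)) P∞-zero)

  ∣∣-pos : ∀ {x y} → x * y ≈ 1# → ℝ.0# < ∣ y ∣
  ∣∣-pos {x} {y} xy≈1 = ℝ.pos-cancelˡ (0≤∣ x ∣)
    (ℝ.<-respʳ (ℝ.trans (ℝ.sym ∣1∣≈1) (ℝ.trans (∣∣-cong (sym xy≈1)) (∣∣-* x y))) ℝ.0<1)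

  opaque
    -- The convergent series ∑ aⁿ/(q;q)ₙ is an inverse of (a)_∞.
    ∣P∞∣-pos-disc : ∀ {a} → ∣ a ∣ < 1ℝ → ℝ.0# < ∣ P∞ a ∣
    ∣P∞∣-pos-disc {a} ∣a∣<1 =
      ∣∣-pos (inverse-P∞ ρ (≤-reflexive ℝ.refl) (proj₂ (term-HasSum ρ 0# (≤-reflexive ℝ.refl))))
      where
      ρ : Ratio
      ρ = record { θ = ∣ a ∣ ; 0≤θ = 0≤∣ a ∣ ; θ<1 = ∣a∣<1 }

  opaque
    -- Once N factors are split off, qᴺa lies in the unit disc, where `∣P∞∣-pos-disc` applies; the
    -- split factors are nonzero by hypothesis.
    ∣P∞∣-pos : ∀ {a} → (∀ k → ℝ.0# < ∣ 1# - q ^ k * a ∣) → ℝ.0# < ∣ P∞ a ∣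
    ∣P∞∣-pos {a} regular = split (ℝ.null-*ˡ ∣ a ∣ (0≤∣ a ∣) 0≤∣q∣^ null-∣q∣^ ℝ.1# ℝ.0<1)
      where
      P-pos : ∀ n → ℝ.0# < ∣ P n 1# a ∣
      P-pos zero    = ℝ.<-respʳ (ℝ.sym ∣1∣≈1) ℝ.0<1
      P-pos (suc n) = ℝ.<-respʳ (ℝ.sym (∣∣-* _ _)) (ℝ.*-pos (P-pos n) (regular n))
      split : (∃ λ N → ∀ n → N ℕ.≤ n → ∣ a ∣ ℝ.* ∣ q ∣ ℝ.^ n < ℝ.1#) → ℝ.0# < ∣ P∞ a ∣
      split (N , <1) = ℝ.<-respʳ (ℝ.trans (ℝ.sym (∣∣-* _ _)) (∣∣-cong (sym (P∞-split N a))))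
        (ℝ.*-pos (P-pos N) (∣P∞∣-pos-disc (ℝ.<-respˡ (ℝ.trans (ℝ.*-comm _ _) (ℝ.sym (∣q^n*a∣ N a)))
          (<1 N ℕₚ.≤-refl))))

  -- The multiple series, summed by rows and by total degree in t.

  module Mehler (ρ : Ratio) (X Y t u v w y : Carrier) (v≈u*w : v ≈ u * w) (Y≈y*t : Y ≈ y * t)
    (∣t∣≤θ : ∣ t ∣ ≤ Ratio.θ ρ) (∣X∣≤θ : ∣ X ∣ ≤ Ratio.θ ρ)
    (∣ut∣≤θ : ∣ u * t ∣ ≤ Ratio.θ ρ) (∣uX∣≤θ : ∣ u * X ∣ ≤ Ratio.θ ρ)
    where
    open Ratio ρ

    -- With X = xt, Y = yt and w = v/u, the rows A j, B j and C j sum to (qʲyt)_∞/(t)_∞, 1/(qʲxt)_∞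
    -- and (qʲvxt)_∞/(uxt)_∞.
    A B C : ℕ → ℕ → Carrier
    A j = term (q ^ j * y) t
    B j = term 0# (q ^ j * X)
    C j = term (q ^ j * w) (u * X)

    AB : ℕ → ℕ → Carrier
    AB j p = ∑△ p (λ i k → A j i * B j k)

    -- This is (y)ⱼ (v/u)ⱼ (ut)ʲ/(q)ⱼ, since tʲ(y)ⱼ = Pⱼ(t, yt) and uʲ(v/u)ⱼ = Pⱼ(u, v). In this
    -- form `bilinear` applies to it.
    κ : ℕ → Carrier
    κ j = e j * (P j t Y * P j u v)

    row : ℕ → ℕ → Carrier
    row j n = κ j * ∑△ n (λ i p → C j i * AB j p)

    opaque
      A-sum : ∀ j → ∃ (HasSum (A j))
      A-sum j = term-HasSum ρ (q ^ j * y) ∣t∣≤θ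

      B-sum : ∀ j → ∃ (HasSum (B j))
      B-sum j = term-HasSum ρ 0# (∣q^n*a∣≤ j ∣X∣≤θ)

      C-sum : ∀ j → ∃ (HasSum (C j))
      C-sum j = term-HasSum ρ (q ^ j * w) ∣uX∣≤θ

    a b c′ : ℕ → Carrier
    a j = proj₁ (A-sum j)
    b j = proj₁ (B-sum j)
    c′ j = proj₁ (C-sum j)

    row-sum : ℕ → Carrier
    row-sum j = κ j * (c′ j * (a j * b j))

    P-t-Y : ∀ j → P j t Y ≈ t ^ j * P j 1# y
    P-t-Y j = trans (P-cong j (sym (*-identityʳ t)) (trans Y≈y*t (*-comm y t))) (P-scale j t 1# y)

    P-u-v : ∀ j → P j u v ≈ u ^ j * P j 1# w
    P-u-v j = trans (P-cong j (sym (*-identityʳ u)) v≈u*w) (P-scale j u 1# w)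

    opaque
      κ≈ : ∀ j → κ j ≈ term y (u * t) j * P j 1# w
      κ≈ j = begin
        e j * (P j t Y * P j u v)
          ≈⟨ *-congˡ (*-cong (P-t-Y j) (P-u-v j)) ⟩
        e j * (t ^ j * P j 1# y * (u ^ j * P j 1# w))
          ≈⟨ solve 5 (λ e t p u r → e :* (t :* p :* (u :* r)) := p :* e :* (u :* t) :* r)
               refl (e j) (t ^ j) (P j 1# y) (u ^ j) (P j 1# w) ⟩
        P j 1# y * e j * (u ^ j * t ^ j) * P j 1# w
          ≈⟨ *-congʳ (*-congˡ (^-distrib-* u t j)) ⟨
        term y (u * t) j * P j 1# w ∎

    opaque
      AB≈S : ∀ j p → AB j p ≈ S p t (q ^ j * X) (q ^ j * Y)
      AB≈S j p = ∑△-cong p λ i k _ → begin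
        P i 1# (q ^ j * y) * e i * t ^ i * (P k 1# 0# * e k * (q ^ j * X) ^ k)
          ≈⟨ *-congˡ (*-congʳ (trans (*-congʳ (P-1-0 k)) (*-identityˡ (e k)))) ⟩
        P i 1# (q ^ j * y) * e i * t ^ i * (e k * (q ^ j * X) ^ k)
          ≈⟨ solve 5 (λ p e t f x → p :* e :* t :* (f :* x) := e :* f :* (t :* p :* x))
               refl (P i 1# (q ^ j * y)) (e i) (t ^ i) (e k) ((q ^ j * X) ^ k) ⟩
        e i * e k * (t ^ i * P i 1# (q ^ j * y) * (q ^ j * X) ^ k)
          ≈⟨ *-congˡ (*-congʳ (P-scale i t 1# (q ^ j * y))) ⟨
        e i * e k * (P i (t * 1#) (t * (q ^ j * y)) * (q ^ j * X) ^ k)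
          ≈⟨ *-congˡ (*-congʳ (P-cong i (*-identityʳ t) (trans
               (solve 3 (λ t s y → t :* (s :* y) := s :* (y :* t)) refl t (q ^ j) y)
               (*-congˡ (sym Y≈y*t))))) ⟩
        e i * e k * (P i t (q ^ j * Y) * (q ^ j * X) ^ k) ∎

    opaque
      C≈ : ∀ j i → C j i ≈ P i u (q ^ j * v) * X ^ i * e i
      C≈ j i = begin
        P i 1# (q ^ j * w) * e i * (u * X) ^ i
          ≈⟨ *-congˡ (^-distrib-* u X i) ⟩
        P i 1# (q ^ j * w) * e i * (u ^ i * X ^ i)
          ≈⟨ solve 4 (λ p e u x → p :* e :* (u :* x) := u :* p :* x :* e)
               refl (P i 1# (q ^ j * w)) (e i) (u ^ i) (X ^ i) ⟩
        u ^ i * P i 1# (q ^ j * w) * X ^ i * e i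
          ≈⟨ *-congʳ (*-congʳ (P-scale i u 1# (q ^ j * w))) ⟨
        P i (u * 1#) (u * (q ^ j * w)) * X ^ i * e i
          ≈⟨ *-congʳ (*-congʳ (P-cong i (*-identityʳ u) (trans
               (solve 3 (λ u s w → u :* (s :* w) := s :* (u :* w)) refl u (q ^ j) w)
               (*-congˡ (sym v≈u*w))))) ⟩
        P i u (q ^ j * v) * X ^ i * e i ∎

    T : ℕ → Carrier → Carrier → Carrier
    T n x y = ∑△ n (λ k p → e k * e p * P k x y)

    -- For X = xt and Y = yt this is hₙ(x,y|q) hₙ(u,v|q) tⁿ/(q;q)ₙ: by homogeneity `S n X t Y` is
    -- tⁿhₙ(x,y|q)/(q;q)ₙ, and `T n u v` is hₙ(u,v|q)/(q;q)ₙ.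
    diagonals : ℕ → Carrier
    diagonals n = Q n * S n X t Y * T n u v

    opaque
      ∑△-row : ∀ n → ∑△ n row ≈ diagonals n
      ∑△-row n = trans (∑△-cong n λ j r _ → *-congˡ (∑△-cong r λ i p _ → *-cong (C≈ j i) (AB≈S j p)))
                       (bilinear n t X Y u v)

    -- One widening for each of the two nested Cauchy products; `diagonal-sum` makes a third for the
    -- sum over rows.
    module Bounds (W₁ : Widening ρ) (W₂ : Widening (Widening.ratio W₁))
      (A-bound : TermBound ∣ y ∣) (B-bound : TermBound ∣ 0# ∣) (C-bound : TermBound ∣ w ∣)
      (w-bound : PochBound ∣ w ∣) where
      open Widening W₁ using (θ^≤θ⁺^) renaming (ratio to ρ₁; M to M₁; 0≤M to 0≤M₁)
      open Widening W₂ using () renaming (ratio to ρ₂; M to M₂; 0≤M to 0≤M₂; θ^≤θ⁺^ to θ₁^≤θ₂^)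
      θ₁ θ₂ Cᴬ Cᴮ Cᶜ Cʷ Cᴬᴮ Cᶜᴬᴮ Cᵏ : ℝ.Carrier
      θ₁ = Ratio.θ ρ₁
      θ₂ = Ratio.θ ρ₂
      Cᴬ = proj₁ A-bound
      Cᴮ = proj₁ B-bound
      Cᶜ = proj₁ C-bound
      Cʷ = proj₁ w-bound
      Cᴬᴮ = Cᴬ ℝ.* Cᴮ ℝ.* M₁
      Cᶜᴬᴮ = Cᶜ ℝ.* Cᴬᴮ ℝ.* M₂
      Cᵏ = Cᴬ ℝ.* Cʷ

      0≤Cᴬ : ℝ.0# ≤ Cᴬ
      0≤Cᴬ = proj₁ (proj₂ A-bound)
      0≤Cᴮ : ℝ.0# ≤ Cᴮ
      0≤Cᴮ = proj₁ (proj₂ B-bound)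
      0≤Cᶜ : ℝ.0# ≤ Cᶜ
      0≤Cᶜ = proj₁ (proj₂ C-bound)
      0≤Cʷ : ℝ.0# ≤ Cʷ
      0≤Cʷ = proj₁ (proj₂ w-bound)
      0≤Cᴬᴮ : ℝ.0# ≤ Cᴬᴮ
      0≤Cᴬᴮ = ℝ.nonNeg-* (ℝ.nonNeg-* 0≤Cᴬ 0≤Cᴮ) 0≤M₁
      0≤Cᶜᴬᴮ : ℝ.0# ≤ Cᶜᴬᴮ
      0≤Cᶜᴬᴮ = ℝ.nonNeg-* (ℝ.nonNeg-* 0≤Cᶜ 0≤Cᴬᴮ) 0≤M₂
      0≤Cᵏ : ℝ.0# ≤ Cᵏ
      0≤Cᵏ = ℝ.nonNeg-* 0≤Cᴬ 0≤Cʷ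

      A≤ : ∀ j n → ∣ A j n ∣ ≤ Cᴬ ℝ.* θ ℝ.^ n
      A≤ j = proj₂ (proj₂ A-bound) (∣q^n*a∣≤ j (≤-reflexive ℝ.refl)) ∣t∣≤θ

      B≤ : ∀ j n → ∣ B j n ∣ ≤ Cᴮ ℝ.* θ ℝ.^ n
      B≤ j = proj₂ (proj₂ B-bound) (≤-reflexive ℝ.refl) (∣q^n*a∣≤ j ∣X∣≤θ)

      C≤ : ∀ j n → ∣ C j n ∣ ≤ Cᶜ ℝ.* θ₁ ℝ.^ n
      C≤ j n = ≤-trans (proj₂ (proj₂ C-bound) (∣q^n*a∣≤ j (≤-reflexive ℝ.refl)) ∣uX∣≤θ n)
        (ℝ.*-monoˡ-≤ 0≤Cᶜ (θ^≤θ⁺^ n))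

      AB≤ : ∀ j n → ∣ AB j n ∣ ≤ Cᴬᴮ ℝ.* θ₁ ℝ.^ n
      AB≤ j = ∣cauchyProduct∣≤ ρ W₁ Cᴬ Cᴮ 0≤Cᴬ 0≤Cᴮ (A≤ j) (B≤ j)

      CAB≤ : ∀ j n → ∣ ∑△ n (λ i p → C j i * AB j p) ∣ ≤ Cᶜᴬᴮ ℝ.* θ₂ ℝ.^ n
      CAB≤ j = ∣cauchyProduct∣≤ ρ₁ W₂ Cᶜ Cᴬᴮ 0≤Cᶜ 0≤Cᴬᴮ (C≤ j) (AB≤ j)

      κ≤ : ∀ j → ∣ κ j ∣ ≤ Cᵏ ℝ.* θ₂ ℝ.^ j
      κ≤ j = ≤.begin
        ∣ κ j ∣
          ≤.≈⟨ ℝ.trans (∣∣-cong (κ≈ j)) (∣∣-* _ _) ⟩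
        ∣ term y (u * t) j ∣ ℝ.* ∣ P j 1# w ∣
          ≤.≤⟨ ℝ.*-mono-≤ (0≤∣ _ ∣) 0≤Cʷ
                 -- The bound for the rows `A` is reused at the argument ut, as the parameter is
                 -- again y.
                 (≤-trans (proj₂ (proj₂ A-bound) (≤-reflexive ℝ.refl) ∣ut∣≤θ j)
                   (ℝ.*-monoˡ-≤ 0≤Cᴬ (≤-trans (θ^≤θ⁺^ j) (θ₁^≤θ₂^ j))))
                 (proj₂ (proj₂ w-bound) (≤-reflexive ℝ.refl) j) ⟩
        Cᴬ ℝ.* θ₂ ℝ.^ j ℝ.* Cʷ
          ≤.≈⟨ ℝ.trans (ℝ.*-assoc _ _ _) (ℝ.trans (ℝ.*-congˡ (ℝ.*-comm _ _)) (ℝ.sym (ℝ.*-assoc _ _ _))) ⟩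
        Cᵏ ℝ.* θ₂ ℝ.^ j ≤.∎

      row≤ : ∀ j n → ∣ row j n ∣ ≤ Cᵏ ℝ.* Cᶜᴬᴮ ℝ.* (θ₂ ℝ.^ j ℝ.* θ₂ ℝ.^ n)
      row≤ j n = ≤.begin
        ∣ row j n ∣
          ≤.≈⟨ ∣∣-* _ _ ⟩
        ∣ κ j ∣ ℝ.* ∣ ∑△ n (λ i p → C j i * AB j p) ∣
          ≤.≤⟨ ℝ.*-mono-≤ (0≤∣ κ j ∣) (ℝ.nonNeg-* 0≤Cᶜᴬᴮ (Ratio.0≤θ^ ρ₂ n)) (κ≤ j) (CAB≤ j n) ⟩
        Cᵏ ℝ.* θ₂ ℝ.^ j ℝ.* (Cᶜᴬᴮ ℝ.* θ₂ ℝ.^ n)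
          ≤.≈⟨ ℝ.solve 4 (λ A x B y → A ℝ.:* x ℝ.:* (B ℝ.:* y) ℝ.:= A ℝ.:* B ℝ.:* (x ℝ.:* y)) ℝ.refl
                 Cᵏ (θ₂ ℝ.^ j) Cᶜᴬᴮ (θ₂ ℝ.^ n) ⟩
        Cᵏ ℝ.* Cᶜᴬᴮ ℝ.* (θ₂ ℝ.^ j ℝ.* θ₂ ℝ.^ n) ≤.∎

      row-HasSum : ∀ j → HasSum (row j) (row-sum j)
      row-HasSum j = hasSum-*ˡ (κ j) (cauchyProduct ρ₁ Cᶜ Cᴬᴮ 0≤Cᶜ 0≤Cᴬᴮ (C≤ j) (AB≤ j) (proj₂ (C-sum j))
        (cauchyProduct ρ Cᴬ Cᴮ 0≤Cᴬ 0≤Cᴮ (A≤ j) (B≤ j) (proj₂ (A-sum j)) (proj₂ (B-sum j))))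

      sums : ∃ λ s → HasSum row-sum s × HasSum diagonals s
      sums = proj₁ ∃s , proj₂ ∃s , hasSum-cong ∑△-row
        (diagonal-sum ρ₂ (Cᵏ ℝ.* Cᶜᴬᴮ) row (ℝ.nonNeg-* 0≤Cᵏ 0≤Cᶜᴬᴮ) row≤ row-HasSum (proj₂ ∃s))
        where
        ∃s : ∃ (HasSum row-sum)
        ∃s = ∃-row-sum ρ₂ (Cᵏ ℝ.* Cᶜᴬᴮ) row (ℝ.nonNeg-* 0≤Cᵏ 0≤Cᶜᴬᴮ) row≤ row-HasSum

    opaque
      ∃-common-sum : ∃ λ s → HasSum row-sum s × HasSum diagonals s
      ∃-common-sum = Bounds.sums (ℝ.widen ρ) (ℝ.widen _) (term-bound ∣ y ∣ (0≤∣ y ∣))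
        (term-bound ∣ 0# ∣ (0≤∣ 0# ∣)) (term-bound ∣ w ∣ (0≤∣ w ∣)) (poch-bound ∣ w ∣ (0≤∣ w ∣))

    numerator denominator : Carrier
    numerator = P∞ Y * P∞ (v * X)
    denominator = P∞ t * (P∞ X * P∞ (u * X))

    opaque
      a*P∞ : ∀ j → a j * P∞ t ≈ P∞ (q ^ j * Y)
      a*P∞ j = trans (q-binomial ρ (q ^ j * y) ∣t∣≤θ (proj₂ (A-sum j)))
        (P∞-cong (trans (*-assoc _ _ _) (*-congˡ (sym Y≈y*t))))

      b*P∞ : ∀ j → b j * P∞ (q ^ j * X) ≈ 1#
      b*P∞ j = inverse-P∞ ρ (∣q^n*a∣≤ j ∣X∣≤θ) (proj₂ (B-sum j))

      c*P∞ : ∀ j → c′ j * P∞ (u * X) ≈ P∞ (q ^ j * (v * X))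
      c*P∞ j = trans (q-binomial ρ (q ^ j * w) ∣uX∣≤θ (proj₂ (C-sum j)))
        (P∞-cong (trans (solve 4 (λ s w u x → s :* w :* (u :* x) := s :* (u :* w :* x)) refl (q ^ j) w u X)
          (*-congˡ (*-congʳ (sym v≈u*w)))))

    opaque
      -- `H` is known only through its equation with cleared denominator. Splitting (Y)_∞ and (vX)_∞
      -- after j factors supplies that denominator, and the remaining products are those of the row
      -- sums.
      hypergeometric≈row-sum : ∀ j H →
        H * (Q j * (P j 1# Y * P j 1# (v * X))) ≈ P j 1# y * (P j 1# X * P j 1# w) * (u * t) ^ j →
        numerator * H ≈ denominator * row-sum j
      hypergeometric≈row-sum j H H≈ = begin
        P∞ Y * P∞ (v * X) * H
          ≈⟨ *-congʳ (*-cong (P∞-split j Y) (P∞-split j (v * X))) ⟩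
        pY * Y′ * (pv * v′) * H
          ≈⟨ *-identityʳ _ ⟨
        pY * Y′ * (pv * v′) * H * 1#
          ≈⟨ *-congˡ (Q*e≈1 j) ⟨
        pY * Y′ * (pv * v′) * H * (Q j * e j)
          ≈⟨ solve 7 (λ a b c d h Q e → a :* b :* (c :* d) :* h :* (Q :* e) := h :* (Q :* (a :* c)) :* (e :* (b :* d)))
               refl pY Y′ pv v′ H (Q j) (e j) ⟩
        H * (Q j * (pY * pv)) * (e j * (Y′ * v′))
          ≈⟨ *-congʳ H≈ ⟩
        P j 1# y * (pX * P j 1# w) * (u * t) ^ j * (e j * (Y′ * v′))
          -- The extra factor 1 becomes bⱼ (qʲX)_∞ next, and (X)ⱼ (qʲX)_∞ is then recombined to
          -- (X)_∞.
          ≈⟨ solve 7 (λ p x w z e a b → p :* (x :* w) :* z :* (e :* (a :* b)) := p :* e :* z :* w :* (x :* (b :* (a :* :1))))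
               refl (P j 1# y) pX (P j 1# w) ((u * t) ^ j) (e j) Y′ v′ ⟩
        term y (u * t) j * P j 1# w * (pX * (v′ * (Y′ * 1#)))
          ≈⟨ *-cong (κ≈ j) (*-congˡ (*-cong (c*P∞ j) (*-cong (a*P∞ j) (b*P∞ j)))) ⟨
        κ j * (pX * (c′ j * P∞ (u * X) * (a j * P∞ t * (b j * X′))))
          ≈⟨ solve 8 (λ k x c U a T b X → k :* (x :* (c :* U :* (a :* T :* (b :* X))))
                 := T :* (x :* X :* U) :* (k :* (c :* (a :* b))))
               refl (κ j) pX (c′ j) (P∞ (u * X)) (a j) (P∞ t) (b j) X′ ⟩
        P∞ t * (pX * X′ * P∞ (u * X)) * row-sum j
          ≈⟨ *-congʳ (*-congˡ (*-congʳ (P∞-split j X))) ⟨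
        denominator * row-sum j ∎
        where
        pX pY pv X′ Y′ v′ : Carrier
        pX = P j 1# X
        pY = P j 1# Y
        pv = P j 1# (v * X)
        X′ = P∞ (q ^ j * X)
        Y′ = P∞ (q ^ j * Y)
        v′ = P∞ (q ^ j * (v * X))

    opaque
      series-term : ∀ {x h h′ r} n → X ≈ x * t →
        h ≈ Q n * T n x y → h′ ≈ Q n * T n u v → r * Q n ≈ t ^ n → h * h′ * r ≈ diagonals n
      series-term {x} {h} {h′} {r} n X≈ h≈ h′≈ r≈ = begin
        h * h′ * r
          ≈⟨ *-congʳ (*-cong h≈ h′≈) ⟩
        Q n * T n x y * (Q n * T n u v) * r
          ≈⟨ solve 4 (λ Q s s′ r → Q :* s :* (Q :* s′) :* r := Q :* (r :* Q :* s) :* s′)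
               refl (Q n) (T n x y) (T n u v) r ⟩
        Q n * (r * Q n * T n x y) * T n u v
          ≈⟨ *-congʳ (*-congˡ (*-congʳ r≈)) ⟩
        Q n * (t ^ n * T n x y) * T n u v
          ≈⟨ *-congʳ (*-congˡ (*-congˡ (∑△-cong n (λ i k _ → *-congˡ
               (trans (*-congˡ (1^ k)) (*-identityʳ _)))))) ⟨
        Q n * (t ^ n * S n x 1# y) * T n u v
          ≈⟨ *-congʳ (*-congˡ (S-scale n t x 1# y)) ⟨
        Q n * S n (t * x) (t * 1#) (t * y) * T n u v
          ≈⟨ *-congʳ (*-congˡ (S-cong n (trans (*-comm t x) (sym X≈)) (*-identityʳ t)
               (trans (*-comm t y) (sym Y≈y*t)))) ⟩
        diagonals n ∎
        where
        1^ : ∀ k → 1# ^ k ≈ 1#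
        1^ zero    = refl
        1^ (suc k) = trans (*-identityˡ _) (1^ k)

    opaque
      -- The hypergeometric series needs no convergence proof of its own: its terms are the row sums
      -- times the constant `n⁻¹ * denominator`.
      conclusion : ∀ {N D r n⁻¹ : Carrier} (H : ℕ → Carrier) →
        N ≈ numerator → D ≈ denominator → r * D ≈ N → n⁻¹ * numerator ≈ 1# →
        (∀ j → H j * (Q j * (P j 1# Y * P j 1# (v * X))) ≈ P j 1# y * (P j 1# X * P j 1# w) * (u * t) ^ j) →
        ∃ λ Φ → HasSum H Φ × HasSum diagonals (r * Φ)
      conclusion {N} {D} {r} {n⁻¹} H N≈ D≈ rD≈N inv H≈ =
        n⁻¹ * denominator * s , hasSum-cong scaled (hasSum-*ˡ (n⁻¹ * denominator) (proj₁ (proj₂ ∃-common-sum))) ,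
        ⟶-cong (λ _ → refl) (sym total≈) (proj₂ (proj₂ ∃-common-sum))
        where
        s : Carrier
        s = proj₁ ∃-common-sum
        scaled : ∀ j → n⁻¹ * denominator * row-sum j ≈ H j
        scaled j = begin
          n⁻¹ * denominator * row-sum j     ≈⟨ *-assoc _ _ _ ⟩
          n⁻¹ * (denominator * row-sum j)   ≈⟨ *-congˡ (hypergeometric≈row-sum j (H j) (H≈ j)) ⟨
          n⁻¹ * (numerator * H j)           ≈⟨ *-assoc _ _ _ ⟨
          n⁻¹ * numerator * H j             ≈⟨ *-congʳ inv ⟩
          1# * H j                          ≈⟨ *-identityˡ _ ⟩
          H j                               ∎
        total≈ : r * (n⁻¹ * denominator * s) ≈ s
        total≈ = begin
          r * (n⁻¹ * denominator * s)
            ≈⟨ solve 4 (λ r n d s → r :* (n :* d :* s) := n :* (r :* d) :* s) refl r n⁻¹ denominator s ⟩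
          n⁻¹ * (r * denominator) * s
            ≈⟨ *-congʳ (*-congˡ (trans (*-congˡ (sym D≈)) (trans rD≈N N≈))) ⟩
          n⁻¹ * numerator * s               ≈⟨ *-congʳ inv ⟩
          1# * s                            ≈⟨ *-identityˡ s ⟩
          s                                 ∎

-- The complex numbers as a complete valued field.

module ComplexField {c ℓ₁ ℓ₂ ℓ₃} (R : RealField c ℓ₁ ℓ₂ ℓ₃) where
  open ComplexAnalysis R
  private module ℝ = Real R
  open ℝ using (_≤_; ≤-trans; ≤-reflexive; solve; _:=_; _:+_; _:*_; _:-_; :-_)
  open ℝ.≤-Reasoning

  opaque
    *ℂ-assoc : ∀ x y z → (x * y) * z ≈ x * (y * z)
    *ℂ-assoc (a +i b) (c +i d) (e +i f) =
      solve 6 (λ a b c d e f → (a :* c :- b :* d) :* e :- (a :* d :+ b :* c) :* f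
        := a :* (c :* e :- d :* f) :- b :* (c :* f :+ d :* e)) ℝ.refl a b c d e f ,
      solve 6 (λ a b c d e f → (a :* c :- b :* d) :* f :+ (a :* d :+ b :* c) :* e
        := a :* (c :* f :+ d :* e) :+ b :* (c :* e :- d :* f)) ℝ.refl a b c d e f

    *ℂ-comm : ∀ x y → x * y ≈ y * x
    *ℂ-comm (a +i b) (c +i d) =
      solve 4 (λ a b c d → a :* c :- b :* d := c :* a :- d :* b) ℝ.refl a b c d ,
      solve 4 (λ a b c d → a :* d :+ b :* c := c :* b :+ d :* a) ℝ.refl a b c d

    *ℂ-identityˡ : ∀ x → 1ℂ * x ≈ x
    *ℂ-identityˡ (a +i b) =
      solve 2 (λ a b → ℝ.:1 :* a :- ℝ.:0 :* b := a) ℝ.refl a b ,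
      solve 2 (λ a b → ℝ.:1 :* b :+ ℝ.:0 :* a := b) ℝ.refl a b

    *ℂ-distribˡ : ∀ x y z → x * (y + z) ≈ x * y + x * z
    *ℂ-distribˡ (a +i b) (c +i d) (e +i f) =
      solve 6 (λ a b c d e f → a :* (c :+ e) :- b :* (d :+ f)
        := a :* c :- b :* d :+ (a :* e :- b :* f)) ℝ.refl a b c d e f ,
      solve 6 (λ a b c d e f → a :* (d :+ f) :+ b :* (c :+ e)
        := a :* d :+ b :* c :+ (a :* f :+ b :* e)) ℝ.refl a b c d e f

  ≈-sym : ∀ {x y} → x ≈ y → y ≈ x
  ≈-sym (p , q) = ℝ.sym p , ℝ.sym q

  ≈-trans : ∀ {x y z} → x ≈ y → y ≈ z → x ≈ z
  ≈-trans (p , q) (p′ , q′) = ℝ.trans p p′ , ℝ.trans q q′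

  *ℂ-cong : ∀ {x y z w} → x ≈ y → z ≈ w → x * z ≈ y * w
  *ℂ-cong (p , q) (p′ , q′) =
    ℝ.+-cong (ℝ.*-cong p p′) (ℝ.-‿cong (ℝ.*-cong q q′)) , ℝ.+-cong (ℝ.*-cong p q′) (ℝ.*-cong q p′)

  commutativeRing : CommutativeRing c ℓ₁
  commutativeRing = record
    { Carrier = ℂ ; _≈_ = _≈_ ; _+_ = _+_ ; _*_ = _*_
    ; -_ = λ z → (ℝ.- re z) +i (ℝ.- im z) ; 0# = 0ℂ ; 1# = 1ℂ
    ; isCommutativeRing = record
      { isRing = record
        { +-isAbelianGroup = record
          { isGroup = record
            { isMonoid = record
              { isSemigroup = record
                { isMagma = record
                  { isEquivalence = record
                    { refl = ℝ.refl , ℝ.refl ; sym = ≈-sym ; trans = ≈-trans }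
                  ; ∙-cong = λ (p , q) (p′ , q′) → ℝ.+-cong p p′ , ℝ.+-cong q q′
                  }
                ; assoc = λ x y z → ℝ.+-assoc _ _ _ , ℝ.+-assoc _ _ _
                }
              ; identity = (λ x → ℝ.+-identityˡ _ , ℝ.+-identityˡ _)
                         , (λ x → ℝ.+-identityʳ _ , ℝ.+-identityʳ _)
              }
            ; inverse = (λ x → ℝ.-‿inverseˡ _ , ℝ.-‿inverseˡ _)
                      , (λ x → ℝ.-‿inverseʳ _ , ℝ.-‿inverseʳ _)
            ; ⁻¹-cong = λ (p , q) → ℝ.-‿cong p , ℝ.-‿cong q
            }
          ; comm = λ x y → ℝ.+-comm _ _ , ℝ.+-comm _ _
          }
        ; *-cong = *ℂ-cong
        ; *-assoc = *ℂ-assoc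
        ; *-identity = *ℂ-identityˡ , λ x → ≈-trans (*ℂ-comm x 1ℂ) (*ℂ-identityˡ x)
        ; distrib = *ℂ-distribˡ , λ x y z → ≈-trans (*ℂ-comm (y + z) x) (≈-trans (*ℂ-distribˡ x y z)
            (ℝ.+-cong (proj₁ (*ℂ-comm x y)) (proj₁ (*ℂ-comm x z))
            , ℝ.+-cong (proj₂ (*ℂ-comm x y)) (proj₂ (*ℂ-comm x z))))
        }
      ; *-comm = *ℂ-comm
      }
    }

  0≤∣_∣ : ∀ z → 0ℝ ≤ ∣ z ∣
  0≤∣ z ∣ = ℝ.√-nonNeg _ (normSq-nonNeg z)

  opaque
    ∣∣≈ : ∀ z {r} → 0ℝ ≤ r → normSq z ℝ.≈ r ℝ.* r → ∣ z ∣ ℝ.≈ r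
    ∣∣≈ z 0≤r eq = ℝ.square-cancel-≈ 0≤∣ z ∣ 0≤r (ℝ.trans (∣∣² z) eq)

    ∣∣≤ : ∀ z {r} → 0ℝ ≤ r → normSq z ≤ r ℝ.* r → ∣ z ∣ ≤ r
    ∣∣≤ z 0≤r le = ℝ.square-cancel-≤ 0≤r (≤-trans (≤-reflexive (∣∣² z)) le)

    ∣∣-cong : ∀ {x y} → x ≈ y → ∣ x ∣ ℝ.≈ ∣ y ∣
    ∣∣-cong {x} {y} (p , q) = ∣∣≈ x 0≤∣ y ∣ (ℝ.trans
      (ℝ.+-cong (ℝ.*-cong p p) (ℝ.*-cong q q)) (ℝ.sym (∣∣² y)))

    ∣∣-* : ∀ x y → ∣ x * y ∣ ℝ.≈ ∣ x ∣ ℝ.* ∣ y ∣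
    ∣∣-* x y = ∣∣≈ (x * y) (ℝ.nonNeg-* 0≤∣ x ∣ 0≤∣ y ∣) (ℝ.trans (normSq-* x y) (ℝ.trans
      (ℝ.*-cong (ℝ.sym (∣∣² x)) (ℝ.sym (∣∣² y)))
      (solve 2 (λ a b → a :* a :* (b :* b) := a :* b :* (a :* b)) ℝ.refl ∣ x ∣ ∣ y ∣)))

    re≤∣∣ : ∀ z → re z ≤ ∣ z ∣
    re≤∣∣ z = ℝ.square-cancel-≤ 0≤∣ z ∣ (≤-trans (ℝ.x≤x+nonNeg (ℝ.square-nonNeg (im z)))
      (≤-reflexive (ℝ.sym (∣∣² z))))

    im≤∣∣ : ∀ z → im z ≤ ∣ z ∣
    im≤∣∣ z = ℝ.square-cancel-≤ 0≤∣ z ∣ (≤-trans (ℝ.x≤x+nonNeg (ℝ.square-nonNeg (re z)))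
      (≤-reflexive (ℝ.trans (ℝ.+-comm _ _) (ℝ.sym (∣∣² z)))))

    ∣∣-+ : ∀ x y → ∣ x + y ∣ ≤ ∣ x ∣ ℝ.+ ∣ y ∣
    ∣∣-+ x@(a +i b) y@(c +i d) = ∣∣≤ (x + y) (ℝ.nonNeg+nonNeg 0≤∣ x ∣ 0≤∣ y ∣) (begin
      normSq (x + y)
        ≈⟨ solve 4 (λ a b c d → (a :+ c) :* (a :+ c) :+ (b :+ d) :* (b :+ d)
             := (a :* a :+ b :* b :+ (c :* c :+ d :* d)) :+ ((a :* c :+ b :* d) :+ (a :* c :+ b :* d)))
             ℝ.refl a b c d ⟩
      (normSq x ℝ.+ normSq y) ℝ.+ (inner ℝ.+ inner)
        ≤⟨ ℝ.+-monoʳ-≤ _ (ℝ.+-mono-≤ inner≤ inner≤) ⟩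
      (normSq x ℝ.+ normSq y) ℝ.+ (∣ x ∣ ℝ.* ∣ y ∣ ℝ.+ ∣ x ∣ ℝ.* ∣ y ∣)
        ≈⟨ ℝ.+-congʳ (ℝ.+-cong (∣∣² x) (∣∣² y)) ⟨
      (∣ x ∣ ℝ.* ∣ x ∣ ℝ.+ ∣ y ∣ ℝ.* ∣ y ∣) ℝ.+ (∣ x ∣ ℝ.* ∣ y ∣ ℝ.+ ∣ x ∣ ℝ.* ∣ y ∣)
        ≈⟨ solve 2 (λ a b → a :* a :+ b :* b :+ (a :* b :+ a :* b) := (a :+ b) :* (a :+ b))
             ℝ.refl ∣ x ∣ ∣ y ∣ ⟩
      (∣ x ∣ ℝ.+ ∣ y ∣) ℝ.* (∣ x ∣ ℝ.+ ∣ y ∣) ∎)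
      where
      inner : ℝ
      inner = a ℝ.* c ℝ.+ b ℝ.* d
      -- Cauchy-Schwarz by Lagrange's identity: the difference of the sides is (ad - bc)².
      inner² : inner ℝ.* inner ≤ normSq x ℝ.* normSq y
      inner² = ℝ.0≤-⇒≤ (≤-trans (ℝ.square-nonNeg (a ℝ.* d ℝ.- b ℝ.* c)) (≤-reflexive
        (solve 4 (λ a b c d → (a :* d :- b :* c) :* (a :* d :- b :* c)
          := (a :* a :+ b :* b) :* (c :* c :+ d :* d) :- (a :* c :+ b :* d) :* (a :* c :+ b :* d))
          ℝ.refl a b c d)))
      inner≤ : inner ≤ ∣ x ∣ ℝ.* ∣ y ∣
      inner≤ = ℝ.square-cancel-≤ (ℝ.nonNeg-* 0≤∣ x ∣ 0≤∣ y ∣) (begin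
        inner ℝ.* inner            ≤⟨ inner² ⟩
        normSq x ℝ.* normSq y      ≈⟨ ℝ.*-cong (∣∣² x) (∣∣² y) ⟨
        ∣ x ∣ ℝ.* ∣ x ∣ ℝ.* (∣ y ∣ ℝ.* ∣ y ∣)
          ≈⟨ solve 2 (λ a b → a :* a :* (b :* b) := a :* b :* (a :* b)) ℝ.refl ∣ x ∣ ∣ y ∣ ⟩
        ∣ x ∣ ℝ.* ∣ y ∣ ℝ.* (∣ x ∣ ℝ.* ∣ y ∣) ∎)

    ∣-_∣ : ∀ z → ∣ (ℝ.- re z) +i (ℝ.- im z) ∣ ℝ.≈ ∣ z ∣
    ∣- z ∣ = ∣∣≈ _ 0≤∣ z ∣ (ℝ.trans
      (ℝ.+-cong (ℝ.-x*-x≈x*x (re z)) (ℝ.-x*-x≈x*x (im z))) (ℝ.sym (∣∣² z)))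

    ∣0∣≈0 : ∣ 0ℂ ∣ ℝ.≈ 0ℝ
    ∣0∣≈0 = ∣∣≈ 0ℂ (≤-reflexive ℝ.refl)
      (solve 0 (ℝ.:0 :* ℝ.:0 :+ ℝ.:0 :* ℝ.:0 := ℝ.:0 :* ℝ.:0) ℝ.refl)

    ∣1∣≈1 : ∣ 1ℂ ∣ ℝ.≈ 1ℝ
    ∣1∣≈1 = ∣∣≈ 1ℂ ℝ.0≤1
      (solve 0 (ℝ.:1 :* ℝ.:1 :+ ℝ.:0 :* ℝ.:0 := ℝ.:1 :* ℝ.:1) ℝ.refl)

    ∣z∣≤0⇒z≈0 : ∀ {z} → ∣ z ∣ ≤ 0ℝ → z ≈ 0ℂ
    ∣z∣≤0⇒z≈0 {z} ∣z∣≤0 =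
      zero-part (≤-trans (re≤∣∣ z) ∣z∣≤0) (≤-trans (re≤∣∣ -z) ∣-z∣≤0) ,
      zero-part (≤-trans (im≤∣∣ z) ∣z∣≤0) (≤-trans (im≤∣∣ -z) ∣-z∣≤0)
      where
      -z : ℂ
      -z = (ℝ.- re z) +i (ℝ.- im z)
      ∣-z∣≤0 : ∣ -z ∣ ≤ 0ℝ
      ∣-z∣≤0 = ≤-trans (≤-reflexive ∣- z ∣) ∣z∣≤0
      zero-part : ∀ {a} → a ≤ 0ℝ → ℝ.- a ≤ 0ℝ → a ℝ.≈ 0ℝ
      zero-part {a} a≤0 -a≤0 = ℝ.≤-antisym a≤0 (ℝ.0≤-⇒≤ (≤-trans (ℝ.≤⇒0≤- -a≤0) (≤-reflexive
        (solve 1 (λ a → ℝ.:0 :- :- a := a :- ℝ.:0) ℝ.refl a))))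

    /-* : ∀ z w (w≠0 : NonZero w) → (z / w [ w≠0 ]) * w ≈ z
    /-* z@(a +i b) w@(c +i d) w≠0 =
      ℝ.trans (solve 5 (λ s a b c d → s :* (a :* c :- b :* :- d) :* c :- s :* (a :* :- d :+ b :* c) :* d
                  := s :* (c :* c :+ d :* d) :* a) ℝ.refl s a b c d) (unit a) ,
      ℝ.trans (solve 5 (λ s a b c d → s :* (a :* c :- b :* :- d) :* d :+ s :* (a :* :- d :+ b :* c) :* c
                  := s :* (c :* c :+ d :* d) :* b) ℝ.refl s a b c d) (unit b)
      where
      i s : ℝ
      i = ∣ w ∣⁻¹ w≠0
      s = i ℝ.* i
      i*∣w∣ : i ℝ.* ∣ w ∣ ℝ.≈ 1ℝ
      i*∣w∣ = ℝ.trans (ℝ.*-congˡ (ℝ.sym (ℝ.x-0≈x ∣ w ∣)))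
        (proj₁ (proj₂ (ℝ.#⇒invertible (ℝ.pos⇒# w≠0))))
      unit : ∀ a → s ℝ.* normSq w ℝ.* a ℝ.≈ a
      unit a = ℝ.trans (ℝ.*-congʳ (ℝ.trans (ℝ.*-congˡ (ℝ.sym (∣∣² w))) (ℝ.trans
        (solve 2 (λ i m → i :* i :* (m :* m) := i :* m :* (i :* m)) ℝ.refl i ∣ w ∣)
        (ℝ.trans (ℝ.*-cong i*∣w∣ i*∣w∣) (ℝ.*-identityˡ 1ℝ))))) (ℝ.*-identityˡ a)

    ∣∣<-parts : ∀ z {δ} → 0ℝ < δ → re z < δ → ℝ.- re z < δ → im z < δ → ℝ.- im z < δ →
      ∣ z ∣ ≤ δ ℝ.+ δ
    ∣∣<-parts (a +i b) {δ} 0<δ a<δ -a<δ b<δ -b<δ =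
      ∣∣≤ (a +i b) (ℝ.nonNeg+nonNeg (ℝ.<⇒≤ 0<δ) (ℝ.<⇒≤ 0<δ)) (begin
        a ℝ.* a ℝ.+ b ℝ.* b                 ≤⟨ ℝ.+-mono-≤ (square≤ a<δ -a<δ) (square≤ b<δ -b<δ) ⟩
        δ ℝ.* δ ℝ.+ δ ℝ.* δ
          ≤⟨ ℝ.x≤x+nonNeg (ℝ.nonNeg+nonNeg (ℝ.square-nonNeg δ) (ℝ.square-nonNeg δ)) ⟩
        δ ℝ.* δ ℝ.+ δ ℝ.* δ ℝ.+ (δ ℝ.* δ ℝ.+ δ ℝ.* δ)
          ≈⟨ solve 1 (λ d → d :* d :+ d :* d :+ (d :* d :+ d :* d) := (d :+ d) :* (d :+ d)) ℝ.refl δ ⟩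
        (δ ℝ.+ δ) ℝ.* (δ ℝ.+ δ)             ∎)
      where
      square≤ : ∀ {a} → a < δ → ℝ.- a < δ → a ℝ.* a ≤ δ ℝ.* δ
      square≤ {a} a<δ -a<δ = ℝ.0≤-⇒≤ (≤-trans
        (ℝ.nonNeg-* (ℝ.<⇒≤ (ℝ.pos-diff a<δ)) (ℝ.<⇒≤ (ℝ.pos-diff -a<δ)))
        (≤-reflexive (solve 2 (λ a d → (d :- a) :* (d :- :- a) := d :* d :- a :* a) ℝ.refl a δ)))

  IsCauchyℂ : (ℕ → ℂ) → Set (c ⊔ ℓ₃)
  IsCauchyℂ s = ∀ ε → 0ℝ < ε → ∃ λ N → ∀ m n → N ℕ.≤ m → N ℕ.≤ n → ∣ s m - s n ∣ < ε

  opaque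
    part-isCauchy : ∀ {s} (part : ℂ → ℝ) → (∀ z w → part z ℝ.- part w ≤ ∣ z - w ∣) →
      IsCauchyℂ s → ℝ.IsCauchy (λ n → part (s n))
    part-isCauchy {s} part part≤ cauchy ε 0<ε with cauchy ε 0<ε
    ... | N , close = N , λ m n N≤m N≤n → ℝ.<-respˡ
      (solve 2 (λ a b → a :- b :+ b := a) ℝ.refl (part (s m)) (part (s n)))
      (ℝ.<-respʳ (ℝ.+-comm ε (part (s n)))
        (ℝ.+-monoˡ-< (part (s n)) (ℝ.≤-<-trans (part≤ (s m) (s n)) (close m n N≤m N≤n))))

    parts-⟶ : ∀ {s a b} → ℝ.IsLimit (λ n → re (s n)) a → ℝ.IsLimit (λ n → im (s n)) b → s ⟶ a +i b
    parts-⟶ {s} {a} {b} re⟶a im⟶b ε 0<ε = near ℝ.half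
      where
      below : ∀ {x y δ} → x < y ℝ.+ δ → x ℝ.- y < δ
      below {x} {y} {δ} x<y+δ = ℝ.<-respʳ (solve 2 (λ y d → y :+ d :- y := d) ℝ.refl y δ)
        (ℝ.+-monoˡ-< (ℝ.- y) x<y+δ)
      above : ∀ {x y δ} → y < x ℝ.+ δ → ℝ.- (x ℝ.- y) < δ
      above {x} {y} {δ} y<x+δ = ℝ.<-respˡ (solve 2 (λ x y → y :- x := :- (x :- y)) ℝ.refl x y) (below y<x+δ)
      near : (∃ λ h → 0ℝ < h × h ℝ.+ h ℝ.≈ 1ℝ) → ∃ λ N → ∀ n → N ℕ.≤ n → ∣ s n - (a +i b) ∣ < ε
      near (h , 0<h , h+h≈1) = both (re⟶a δ 0<δ) (im⟶b δ 0<δ)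
        where
        δ : ℝ
        -- δ is ε/4: real and imaginary parts within δ give a modulus of at most 2δ = ε/2, which is
        -- strictly below ε.
        δ = ε ℝ.* h ℝ.* h
        0<δ : 0ℝ < δ
        0<δ = ℝ.*-pos (ℝ.*-pos 0<ε 0<h) 0<h
        ε≈ : ε ℝ.* h ℝ.+ ε ℝ.* h ℝ.≈ ε
        ε≈ = ℝ.trans (solve 2 (λ e h → e :* h :+ e :* h := e :* (h :+ h)) ℝ.refl ε h)
          (ℝ.trans (ℝ.*-congˡ h+h≈1) (ℝ.*-identityʳ ε))
        2δ<ε : δ ℝ.+ δ < ε
        2δ<ε = begin-strict
          δ ℝ.+ δ                   ≈⟨ solve 2 (λ a h → a :* h :+ a :* h := a :* (h :+ h)) ℝ.refl (ε ℝ.* h) h ⟩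
          ε ℝ.* h ℝ.* (h ℝ.+ h)     ≈⟨ ℝ.trans (ℝ.*-congˡ h+h≈1) (ℝ.*-identityʳ _) ⟩
          ε ℝ.* h                   ≈⟨ ℝ.+-identityˡ _ ⟨
          0ℝ ℝ.+ ε ℝ.* h            <⟨ ℝ.+-monoˡ-< _ (ℝ.*-pos 0<ε 0<h) ⟩
          ε ℝ.* h ℝ.+ ε ℝ.* h       ≈⟨ ε≈ ⟩
          ε                         ∎
        both : (∃ λ N → ∀ n → N ℕ.≤ n → re (s n) < a ℝ.+ δ × a < re (s n) ℝ.+ δ) →
               (∃ λ N → ∀ n → N ℕ.≤ n → im (s n) < b ℝ.+ δ × b < im (s n) ℝ.+ δ) →
               ∃ λ N → ∀ n → N ℕ.≤ n → ∣ s n - (a +i b) ∣ < ε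
        both (M , re<) (N , im<) = M ℕ.⊔ N , λ n M⊔N≤n →
          let re<n = re< n (ℕₚ.≤-trans (ℕₚ.m≤m⊔n M N) M⊔N≤n)
              im<n = im< n (ℕₚ.≤-trans (ℕₚ.m≤n⊔m M N) M⊔N≤n)
          in ℝ.≤-<-trans (∣∣<-parts _ 0<δ (below (proj₁ re<n)) (above (proj₂ re<n))
                            (below (proj₁ im<n)) (above (proj₂ im<n))) 2δ<ε

    complete : ∀ s → IsCauchyℂ s → ∃ (s ⟶_)
    complete s cauchy = (proj₁ re-limit +i proj₁ im-limit) , parts-⟶ (proj₂ re-limit) (proj₂ im-limit)
      where
      re-limit : ∃ (ℝ.IsLimit (λ n → re (s n)))
      re-limit = ℝ.complete _ (part-isCauchy re (λ z w → re≤∣∣ (z - w)) cauchy)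
      im-limit : ∃ (ℝ.IsLimit (λ n → im (s n)))
      im-limit = ℝ.complete _ (part-isCauchy im (λ z w → im≤∣∣ (z - w)) cauchy)

  ℂ-field : CompleteValuedField R c ℓ₁
  ℂ-field = record
    { commutativeRing = commutativeRing
    ; ∣_∣ = ∣_∣
    ; ∣∣-cong = ∣∣-cong
    ; 0≤∣_∣ = 0≤∣_∣
    ; ∣x∣≤0⇒x≈0 = ∣z∣≤0⇒z≈0
    ; ∣0∣≈0 = ∣0∣≈0
    ; ∣1∣≈1 = ∣1∣≈1
    ; ∣-_∣ = ∣-_∣
    ; ∣∣-* = ∣∣-*
    ; ∣∣-+ = ∣∣-+
    ; invertible = λ {z} z≠0 → (1ℂ / z [ z≠0 ]) , /-* 1ℂ z z≠0
    ; complete = complete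
    }

-- Clearing denominators.

module Quotients {c ℓ} (K : CommutativeRing c ℓ) where
  open CommutativeRing K
  open IntegerRingSolver K
  open SetoidReasoning setoid

  *-cancelʳ-unit : ∀ {x y w} i → i * w ≈ 1# → x * w ≈ y * w → x ≈ y
  *-cancelʳ-unit {x} {y} {w} i iw≈1 xw≈yw = begin
    x              ≈⟨ through x ⟩
    i * (x * w)    ≈⟨ *-congˡ xw≈yw ⟩
    i * (y * w)    ≈⟨ through y ⟨
    y              ∎
    where
    through : ∀ x → x ≈ i * (x * w)
    through x = begin
      x              ≈⟨ *-identityˡ x ⟨
      1# * x         ≈⟨ *-congʳ iw≈1 ⟨
      i * w * x      ≈⟨ solve 3 (λ i w x → i :* w :* x := i :* (x :* w)) refl i w x ⟩
      i * (x * w)    ∎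

  quotient₂ : ∀ n {a b a⁻¹ b⁻¹} → a * a⁻¹ ≈ 1# → b * b⁻¹ ≈ 1# → n * (a⁻¹ * b⁻¹) * (a * b) ≈ n
  quotient₂ n {a} {b} {a⁻¹} {b⁻¹} aa⁻¹≈1 bb⁻¹≈1 = begin
    n * (a⁻¹ * b⁻¹) * (a * b)
      ≈⟨ solve 5 (λ n a b i j → n :* (i :* j) :* (a :* b) := n :* (a :* i :* (b :* j))) refl n a b a⁻¹ b⁻¹ ⟩
    n * (a * a⁻¹ * (b * b⁻¹))
      ≈⟨ *-congˡ (trans (*-cong aa⁻¹≈1 bb⁻¹≈1) (*-identityˡ 1#)) ⟩
    n * 1#
      ≈⟨ *-identityʳ n ⟩
    n ∎

  hypergeometric-term : ∀ {r z d n d′ n′ z′} → r * d ≈ n → d ≈ d′ → n ≈ n′ → z ≈ z′ →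
    r * z * d′ ≈ n′ * z′
  hypergeometric-term {r} {z} {d} {n} {d′} {n′} {z′} rd≈n d≈ n≈ z≈ = begin
    r * z * d′     ≈⟨ *-congˡ d≈ ⟨
    r * z * d      ≈⟨ solve 3 (λ r z d → r :* z :* d := r :* d :* z) refl r z d ⟩
    r * d * z      ≈⟨ *-cong (trans rd≈n n≈) z≈ ⟩
    n′ * z′        ∎

-- Transfer to the complex series and products of the theorem.

module ComplexQSeries {c ℓ₁ ℓ₂ ℓ₃} (R : RealField c ℓ₁ ℓ₂ ℓ₃) (q : ComplexAnalysis.ℂ R)
  (∣q∣<1 : RealField._<_ R (ComplexAnalysis.∣_∣ R q) (RealField.1# R)) where
  open ComplexAnalysis R
  open ComplexField R using (ℂ-field; /-*)
  private module K = CompleteValuedField ℂ-field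
  open Quotients K.commutativeRing
  open Sums K.commutativeRing using (∑△; ∑<≈∑△; ∑<-distribˡ-*)
  private module S = Sums K.commutativeRing
  private module E = Exp K.commutativeSemiring
  open CauchyPolynomials K.commutativeRing q using (P; P-cong)
  private module V = Convergence ℂ-field

  ^≡ : ∀ z n → z ^ n ≡ z E.^ n
  ^≡ z zero    = ≡.refl
  ^≡ z (suc n) = ≡.cong (z *_) (^≡ z n)

  ^≈ : ∀ z n → z ^ n ≈ z E.^ n
  ^≈ z n = K.reflexive (^≡ z n)

  ∑<≡ : ∀ n f → ∑< n f ≡ S.∑< n f
  ∑<≡ zero    f = ≡.refl
  ∑<≡ (suc n) f = ≡.cong (_+ f n) (∑<≡ n f)

  hasSum : ∀ {f g s} → (∀ n → f n ≈ g n) → V.HasSum g s → HasSum f s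
  hasSum {f} {g} f≈g = V.⟶-cong
    (λ n → K.trans (S.∑<-cong n (λ k → K.sym (f≈g k))) (K.reflexive (≡.sym (∑<≡ n f)))) K.refl

  poch≈ : ∀ a n → ⟨ a ⨾ q ⟩ n ≈ P n 1ℂ a
  poch≈ a zero    = K.refl
  poch≈ a (suc n) = K.*-cong (poch≈ a n)
    (K.+-congˡ (K.-‿cong (K.trans (K.*-comm a (q ^ n)) (K.*-congʳ (^≈ q n)))))

  cauchyPoly≈ : ∀ n x y → cauchyPoly q ∣q∣<1 n x y ≈ P n x y
  cauchyPoly≈ zero    x y = K.refl
  cauchyPoly≈ (suc n) x y = K.*-cong (cauchyPoly≈ n x y) (K.+-congˡ (K.-‿cong (K.*-congʳ (^≈ q n))))

  Q e : ℕ → ℂ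
  Q = ⟨ q ⨾ q ⟩_
  e n = 1ℂ / Q n [ qq-NonZero q ∣q∣<1 n ]

  Q-suc : ∀ n → Q (suc n) ≈ Q n * (1ℂ - q E.^ suc n)
  Q-suc n = K.*-congˡ (K.+-congˡ (K.-‿cong (K.*-congˡ (^≈ q n))))

  Q*e≈1 : ∀ n → Q n * e n ≈ 1ℂ
  Q*e≈1 n = K.trans (K.*-comm (Q n) (e n)) (/-* 1ℂ (Q n) (qq-NonZero q ∣q∣<1 n))

  /-unique : ∀ z w (w≠0 : NonZero w) {x} → x * w ≈ z → z / w [ w≠0 ] ≈ x
  /-unique z w w≠0 xw≈z = *-cancelʳ-unit (1ℂ / w [ w≠0 ]) (/-* 1ℂ w w≠0)
    (K.trans (/-* z w w≠0) (K.sym xw≈z))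

  rogersSzegő≈ : ∀ n x y (g : ∀ k → NonZero (Q k * Q (n ℕ.∸ k))) →
    ∑< (suc n) (λ k → (Q n / (Q k * Q (n ℕ.∸ k)) [ g k ]) * cauchyPoly q ∣q∣<1 k x y)
      ≈ Q n * ∑△ n (λ k p → e k * e p * P k x y)
  rogersSzegő≈ n x y g = K.trans (K.reflexive (∑<≡ (suc n) _)) (K.trans
    (S.∑<-cong (suc n) {g = λ k → Q n * (e k * e (n ℕ.∸ k) * P k x y)}
      (λ k → K.trans (K.*-cong (gauss≈ k) (cauchyPoly≈ k x y)) (K.*-assoc _ _ _)))
    (K.trans (∑<-distribˡ-* (suc n) (Q n) (λ k → e k * e (n ℕ.∸ k) * P k x y))
      (K.*-congˡ (∑<≈∑△ n (λ k p → e k * e p * P k x y)))))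
    where
    gauss≈ : ∀ k → Q n / (Q k * Q (n ℕ.∸ k)) [ g k ] ≈ Q n * (e k * e (n ℕ.∸ k))
    gauss≈ k = /-unique (Q n) (Q k * Q (n ℕ.∸ k)) (g k)
      (quotient₂ (Q n) (Q*e≈1 k) (Q*e≈1 (n ℕ.∸ k)))

  qFactorials : QFactorials K.commutativeRing
  qFactorials = record
    { q = q ; Q = Q ; e = e ; Q-zero = K.refl ; Q-suc = Q-suc ; Q*e≈1 = Q*e≈1 }

  open QSeries ℂ-field qFactorials ∣q∣<1 using (P∞; P⟶P∞; P∞-cong; ∣P∞∣-pos; ∣P∞∣-pos-disc)
  private module QS = QSeries ℂ-field qFactorials ∣q∣<1

  hasProduct : ∀ a → HasProduct (qFactor a q) (P∞ a)
  hasProduct a = V.⟶-cong (λ n → K.sym (poch≈ a n)) K.refl (P⟶P∞ a)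

  P∞-NonZero : ∀ {a} → Regular q a → NonZero (P∞ a)
  P∞-NonZero {a} regular = ∣P∞∣-pos λ k → RealFieldProperties.<-respʳ R
    (K.∣∣-cong (K.+-congˡ {x = 1ℂ} (K.-‿cong (K.trans (K.*-comm a (q ^ k)) (K.*-congʳ (^≈ q k)))))) (regular k)

  module Mehler (x y u v t : ℂ)
    (∣t∣<1 : ∣ t ∣ < 1ℝ) (∣xt∣<1 : ∣ x * t ∣ < 1ℝ) (∣ut∣<1 : ∣ u * t ∣ < 1ℝ) (∣uxt∣<1 : ∣ u * x * t ∣ < 1ℝ)
    (u≠0 : NonZero u) (yt-regular : Regular q (y * t)) (vxt-regular : Regular q (v * x * t))
    where
    open RealField R using (_≤_)
    open RealOrder R using (Ratio; join; ≤-trans)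
    open RealFieldProperties R using (<-respˡ)

    w : ℂ
    w = v / u [ u≠0 ]

    v≈u*w : v ≈ u * w
    v≈u*w = K.trans (K.sym (/-* v u u≠0)) (K.*-comm w u)

    ratio : ∀ z → ∣ z ∣ < 1ℝ → Ratio
    ratio z ∣z∣<1 = record { θ = ∣ z ∣ ; 0≤θ = K.0≤∣ z ∣ ; θ<1 = ∣z∣<1 }

    opaque
      ∃-ratio : Σ Ratio λ ρ → ∣ t ∣ ≤ Ratio.θ ρ × ∣ x * t ∣ ≤ Ratio.θ ρ ×
        ∣ u * t ∣ ≤ Ratio.θ ρ × ∣ u * (x * t) ∣ ≤ Ratio.θ ρ
      ∃-ratio = combine (join (ratio t ∣t∣<1) (ratio (x * t) ∣xt∣<1)) (join (ratio (u * t) ∣ut∣<1)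
        (ratio (u * (x * t)) (<-respˡ (K.∣∣-cong (K.*-assoc u x t)) ∣uxt∣<1)))
        where
        combine : ∀ {a b c d} → (Σ Ratio λ ρ → a ≤ Ratio.θ ρ × b ≤ Ratio.θ ρ) →
          (Σ Ratio λ ρ → c ≤ Ratio.θ ρ × d ≤ Ratio.θ ρ) →
          Σ Ratio λ ρ → a ≤ Ratio.θ ρ × b ≤ Ratio.θ ρ × c ≤ Ratio.θ ρ × d ≤ Ratio.θ ρ
        combine (ρ₁ , a≤ , b≤) (ρ₂ , c≤ , d≤) =
          let ρ , ρ₁≤ , ρ₂≤ = join ρ₁ ρ₂
          in ρ , ≤-trans a≤ ρ₁≤ , ≤-trans b≤ ρ₁≤ , ≤-trans c≤ ρ₂≤ , ≤-trans d≤ ρ₂≤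

    module M = QS.Mehler (proj₁ ∃-ratio)
      (x * t) (y * t) t u v w y v≈u*w K.refl (proj₁ (proj₂ ∃-ratio)) (proj₁ (proj₂ (proj₂ ∃-ratio)))
      (proj₁ (proj₂ (proj₂ (proj₂ ∃-ratio)))) (proj₂ (proj₂ (proj₂ (proj₂ ∃-ratio))))

    -- The trailing `1ℂ` is the empty product at the end of each list of parameters.
    N D : ℂ
    N = P∞ (y * t) * (P∞ (v * x * t) * 1ℂ)
    D = P∞ t * (P∞ (x * t) * (P∞ (u * x * t) * 1ℂ))

    N≈ : N ≈ M.numerator
    N≈ = K.*-congˡ (K.trans (K.*-identityʳ _) (P∞-cong (K.*-assoc v x t)))

    D≈ : D ≈ M.denominator
    D≈ = K.*-congˡ (K.*-congˡ (K.trans (K.*-identityʳ _) (P∞-cong (K.*-assoc u x t))))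

    N≠0 : NonZero N
    N≠0 = *-NonZero (P∞-NonZero yt-regular) (*-NonZero (P∞-NonZero vxt-regular) 1-NonZero)

    D≠0 : NonZero D
    D≠0 = *-NonZero (∣P∞∣-pos-disc ∣t∣<1)
      (*-NonZero (∣P∞∣-pos-disc ∣xt∣<1) (*-NonZero (∣P∞∣-pos-disc ∣uxt∣<1) 1-NonZero))

    N-product : ⟪ y * t ∷ v * x * t ∷ [] ⨾ q ⟫∞≡ N
    N-product =
      P∞ (y * t) , P∞ (v * x * t) * 1ℂ , hasProduct (y * t) ,
      (P∞ (v * x * t) , 1ℂ , hasProduct (v * x * t) , lift (K.refl {1ℂ}) , K.refl {P∞ (v * x * t) * 1ℂ}) ,
      K.refl {N}

    D-product : ⟪ t ∷ x * t ∷ u * x * t ∷ [] ⨾ q ⟫∞≡ D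
    D-product =
      P∞ t , P∞ (x * t) * (P∞ (u * x * t) * 1ℂ) , hasProduct t ,
      (P∞ (x * t) , P∞ (u * x * t) * 1ℂ , hasProduct (x * t) ,
        (P∞ (u * x * t) , 1ℂ , hasProduct (u * x * t) , lift (K.refl {1ℂ}) , K.refl {P∞ (u * x * t) * 1ℂ}) ,
        K.refl {P∞ (x * t) * (P∞ (u * x * t) * 1ℂ)}) ,
      K.refl {D}

    -- Generic in the proofs that the denominators do not vanish: a quotient mentions its proof, and
    -- unifying two large proofs would unfold them.
    module _ (p : ∀ n → NonZero (⟪ q ∷ y * t ∷ v * x * t ∷ [] ⨾ q ⟫ n))
             (g g′ : ∀ n k → NonZero (Q k * Q (n ℕ.∸ k))) (r : ∀ n → NonZero (Q n)) where

      hypergeometric : ℕ → ℂ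
      hypergeometric n =
        ⟪ y ∷ x * t ∷ w ∷ [] ⨾ q ⟫ n / ⟪ q ∷ y * t ∷ v * x * t ∷ [] ⨾ q ⟫ n [ p n ] * (u * t) ^ n

      series : ℕ → ℂ
      series n =
        ∑< (suc n) (λ k → (Q n / (Q k * Q (n ℕ.∸ k)) [ g n k ]) * cauchyPoly q ∣q∣<1 k x y) *
        ∑< (suc n) (λ k → (Q n / (Q k * Q (n ℕ.∸ k)) [ g′ n k ]) * cauchyPoly q ∣q∣<1 k u v) *
        ((t ^ n) / Q n [ r n ])

      hypergeometric≈ : ∀ j →
        hypergeometric j * (Q j * (P j 1ℂ (y * t) * P j 1ℂ (v * (x * t)))) ≈
        P j 1ℂ y * (P j 1ℂ (x * t) * P j 1ℂ w) * (u * t) E.^ j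
      hypergeometric≈ j = hypergeometric-term
        (/-* (⟪ y ∷ x * t ∷ w ∷ [] ⨾ q ⟫ j) (⟪ q ∷ y * t ∷ v * x * t ∷ [] ⨾ q ⟫ j) (p j))
        (K.*-congˡ {x = Q j} (K.*-cong (poch≈ (y * t) j) (K.trans (K.*-identityʳ _)
          (K.trans (poch≈ (v * x * t) j) (P-cong j K.refl (K.*-assoc v x t))))))
        (K.*-cong (poch≈ y j) (K.*-cong (poch≈ (x * t) j) (K.trans (K.*-identityʳ _) (poch≈ w j))))
        (^≈ (u * t) j)

      series≈ : ∀ n → series n ≈ M.diagonals n
      series≈ n = M.series-term n K.refl (rogersSzegő≈ n x y (g n)) (rogersSzegő≈ n u v (g′ n))
        (K.trans (/-* (t ^ n) (Q n) (r n)) (^≈ t n))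

      opaque
        mehler : ∃ λ Φ → HasSum hypergeometric Φ × HasSum series ((N / D [ D≠0 ]) * Φ)
        mehler = convert (M.conclusion {N} {D} {N / D [ D≠0 ]} {1ℂ / N [ N≠0 ]} hypergeometric N≈ D≈
            (/-* N D D≠0) (K.trans (K.*-congˡ (K.sym N≈)) (/-* 1ℂ N N≠0)) hypergeometric≈)
          where
          convert : (∃ λ Φ → V.HasSum hypergeometric Φ × V.HasSum M.diagonals ((N / D [ D≠0 ]) * Φ)) →
            ∃ λ Φ → HasSum hypergeometric Φ × HasSum series ((N / D [ D≠0 ]) * Φ)
          convert (Φ , hyper , diagonals) = Φ , hasSum (λ _ → K.refl) hyper , hasSum series≈ diagonals

      theorem : ∃ λ N → ∃ λ D → ∃ λ Φ →
        ⟪ y * t ∷ v * x * t ∷ [] ⨾ q ⟫∞≡ N ×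
        ⟪ t ∷ x * t ∷ u * x * t ∷ [] ⨾ q ⟫∞≡ D ×
        HasSum hypergeometric Φ ×
        Σ (NonZero D) λ D≠0 → HasSum series ((N / D [ D≠0 ]) * Φ)
      theorem =
        N , D , proj₁ mehler , N-product , D-product , proj₁ (proj₂ mehler) , D≠0 , proj₂ (proj₂ mehler)

theorem2p1 : ∀ {c ℓ₁ ℓ₂ ℓ₃} (R : RealField c ℓ₁ ℓ₂ ℓ₃) → let open ComplexAnalysis R in
    (q x y u v t : ℂ) →
    0ℝ < ∣ q ∣ → (∣q∣<1 : ∣ q ∣ < 1ℝ) →
    ∣ t ∣ < 1ℝ → ∣ x * t ∣ < 1ℝ → ∣ u * t ∣ < 1ℝ → ∣ u * x * t ∣ < 1ℝ →
    (u≠0 : NonZero u) →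
    (yt-regular : Regular q (y * t)) → (vxt-regular : Regular q (v * x * t)) →
    ∃ λ N → ∃ λ D → ∃ λ Φ →
    ⟪ y * t ∷ v * x * t ∷ [] ⨾ q ⟫∞≡ N ×
    ⟪ t ∷ x * t ∷ u * x * t ∷ [] ⨾ q ⟫∞≡ D ×
    HasSum (hypergeometricTerm q ∣q∣<1
    (y ∷ x * t ∷ (v / u [ u≠0 ]) ∷ [])
    (y * t ∷ v * x * t ∷ [])
    (yt-regular ∷ vxt-regular ∷ [])
    (u * t)) Φ ×
    Σ (NonZero D) λ D≠0 →
    HasSum (λ n → rogersSzegő q ∣q∣<1 n x y * rogersSzegő q ∣q∣<1 n u v *
    ((t ^ n) / (⟨ q ⨾ q ⟩ n) [ qq-NonZero q ∣q∣<1 n ]))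
    ((N / D [ D≠0 ]) * Φ)
theorem2p1 R q x y u v t _ ∣q∣<1 ∣t∣<1 ∣xt∣<1 ∣ut∣<1 ∣uxt∣<1 u≠0 yt-regular vxt-regular =
  ComplexQSeries.Mehler.theorem R q ∣q∣<1 x y u v t ∣t∣<1 ∣xt∣<1 ∣ut∣<1 ∣uxt∣<1 u≠0 yt-regular vxt-regular
    -- The nonvanishing proofs inside the quotients, determined by the goal.
    _ _ _ _
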